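{- (1) If $\kappa$ is a measurable cardinal, then in $V^{\mathrm{Coll}(\omega_1,<\kappa)}$, $\aleph_2\to_{hc}(\aleph_2)^2_\omega$ holds. (2) If $\kappa$ is a supercompact cardinal, then in $V^{\mathrm{Coll}(\omega_1,<\kappa)}$, $\lambda\to_{hc}(\lambda)^2_\omega$ holds for every regular cardinal $\lambda\ge\aleph_2$.
   Context: $\mathrm{Coll}(\omega_1,<\kappa)$ is the Levy collapse (countable-support product of the posets of countable partial functions from $\omega_1$ to $\alpha$, $\alpha<\kappa$), making $\kappa=\aleph_2$. A graph $(X,E)$ is highly connected if for every $Y\subseteq X$ with $|Y|<|X|$ the induced subgraph on $X\setminus Y$ is connected. $\lambda\to_{hc}(\lambda)^2_\omega$: for every $c:[\lambda]^2\to\omega$ there are $i\in\omega$ and $A\in[\lambda]^\lambda$ with $(A,c^{ -1}(i)\cap[A]^2)$ highly connected. -}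

module Defs where

open import Level using (Level; Lift; suc)
open import Data.Empty.Polymorphic using (⊥)
open import Data.Product using (Σ; Σ-syntax; ∃-syntax; _×_)
open import Data.Sum using (_⊎_)

-- A structure for the language {ε , ≐} of set theory whose truth values lie in Ω.
-- The formulas below are written once, over an arbitrary such structure, and
-- are then read both in the universe V of sets (Ω = types) and in the forcing
-- extension V^P (Ω = predicates on conditions, i.e. the forcing relation).
record Structure (ℓ : Level) : Set (suc (suc (suc ℓ))) where
  infix  8 _ε_ _≐_
  infixr 6 _∧_
  infixr 5 _∨_
  infixr 4 _⇒_
  field
    Dom         : Set (suc ℓ)
    Ω           : Set (suc (suc ℓ))
    _ε_ _≐_     : Dom → Dom → Ω
    falsum      : Ω
    _∧_ _∨_ _⇒_ : Ω → Ω → Ω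
    all ex      : (Dom → Ω) → Ω

module Formulas {ℓ : Level} (S : Structure ℓ) where
  open Structure S

  infix  7 ~_
  infix  3 _⇔_
  infix  8 _⊆_ _≼_ _≺_ _≃_
  infix  2 all-syntax ex-syntax all∈ ex∈

  Class : Set (suc (suc ℓ))
  Class = Dom → Ω

  ~_ : Ω → Ω
  ~ φ = φ ⇒ falsum

  _⇔_ : Ω → Ω → Ω
  φ ⇔ ψ = (φ ⇒ ψ) ∧ (ψ ⇒ φ)

  all-syntax ex-syntax : Class → Ω
  all-syntax = all
  ex-syntax  = ex

  all∈ ex∈ : Dom → Class → Ω
  all∈ a φ = all λ x → x ε a ⇒ φ x
  ex∈  a φ = ex λ x → x ε a ∧ φ x

  syntax all-syntax (λ x → φ) = ⋀[ x ] φ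
  syntax ex-syntax  (λ x → φ) = ⋁[ x ] φ
  syntax all∈ a (λ x → φ)     = ⋀[ x ∈ a ] φ
  syntax ex∈  a (λ x → φ)     = ⋁[ x ∈ a ] φ

  _⊆_ : Dom → Dom → Ω
  x ⊆ y = ⋀[ z ∈ x ] z ε y

  Nonempty : Class
  Nonempty x = ⋁[ z ] z ε x

  -- u = {x , y}
  IsUPair : Dom → Dom → Dom → Ω
  IsUPair u x y = ⋀[ z ] (z ε u ⇔ (z ≐ x ∨ z ≐ y))

  -- u = (x , y) = {{x} , {x , y}}
  IsOPair : Dom → Dom → Dom → Ω
  IsOPair u x y = ⋁[ s ] ⋁[ t ] (IsUPair s x x ∧ IsUPair t x y ∧ IsUPair u s t)

  -- (x , y) ∈ f
  Maps : Dom → Dom → Dom → Ω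
  Maps f x y = ⋁[ u ∈ f ] IsOPair u x y

  IsPartialFun : Dom → Class → Class → Ω
  IsPartialFun f A B =
      (⋀[ u ∈ f ] ⋁[ x ] ⋁[ y ] (A x ∧ B y ∧ IsOPair u x y))
    ∧ (⋀[ x ] ⋀[ y ] ⋀[ y′ ] (Maps f x y ⇒ Maps f x y′ ⇒ y ≐ y′))

  IsFun : Dom → Class → Class → Ω
  IsFun f A B = IsPartialFun f A B ∧ (⋀[ x ] (A x ⇒ (⋁[ y ] Maps f x y)))

  IsInjection : Dom → Dom → Dom → Ω
  IsInjection f A B =
      IsFun f (_ε A) (_ε B)
    ∧ (⋀[ x ] ⋀[ x′ ] ⋀[ y ] (Maps f x y ⇒ Maps f x′ y ⇒ x ≐ x′))

  IsBijection : Dom → Dom → Dom → Ω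
  IsBijection f A B = IsInjection f A B ∧ (⋀[ y ∈ B ] ⋁[ x ∈ A ] Maps f x y)

  -- |A| ≤ |B| , |A| < |B| , |A| = |B|
  _≼_ _≺_ _≃_ : Dom → Dom → Ω
  A ≼ B = ⋁[ f ] IsInjection f A B
  A ≺ B = A ≼ B ∧ ~ (B ≼ A)
  A ≃ B = ⋁[ f ] IsBijection f A B

  IsTransitive : Class
  IsTransitive x = ⋀[ y ∈ x ] y ⊆ x

  -- By foundation, linearity of ε makes it a well-order.
  IsOrdinal : Class
  IsOrdinal x =
    IsTransitive x ∧ (⋀[ y ∈ x ] ⋀[ z ∈ x ] (y ε z ∨ y ≐ z ∨ z ε y))

  -- m = n ∪ {n}
  IsSuccessor : Dom → Dom → Ω
  IsSuccessor m n = ⋀[ z ] (z ε m ⇔ (z ε n ∨ z ≐ n))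

  IsLimit : Class
  IsLimit x = IsOrdinal x ∧ Nonempty x ∧ (⋀[ y ∈ x ] ⋁[ z ∈ x ] y ε z)

  IsOmega : Class
  IsOmega w = IsLimit w ∧ (⋀[ n ∈ w ] ~ IsLimit n)

  IsCountable : Class
  IsCountable x = ⋁[ w ] (IsOmega w ∧ x ≼ w)

  IsCardinal : Class
  IsCardinal k = IsOrdinal k ∧ (⋀[ α ∈ k ] ~ (k ≃ α))

  -- k = μ⁺ , for μ a cardinal
  IsCardinalSucc : Dom → Dom → Ω
  IsCardinalSucc k μ = IsCardinal k ∧ μ ε k ∧ (⋀[ α ∈ k ] α ≼ μ)

  IsAleph1 : Class
  IsAleph1 k = ⋁[ w ] (IsOmega w ∧ IsCardinalSucc k w)

  IsAleph2 : Class
  IsAleph2 k = ⋁[ w ] (IsAleph1 w ∧ IsCardinalSucc k w)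

  IsUncountableCardinal : Class
  IsUncountableCardinal k = IsCardinal k ∧ (⋁[ w ] (IsOmega w ∧ w ε k))

  -- An infinite cardinal with no cofinal function from a smaller ordinal.
  IsRegular : Class
  IsRegular k =
      IsCardinal k
    ∧ (⋁[ w ] (IsOmega w ∧ w ⊆ k))
    ∧ (⋀[ α ∈ k ] ⋀[ f ] (IsFun f (_ε α) (_ε k)
         ⇒ ~ (⋀[ β ∈ k ] ⋁[ ξ ∈ α ] ⋁[ η ] (Maps f ξ η ∧ β ⊆ η))))

  -- The axiom of choice, for families of pairwise disjoint nonempty sets.
  Choice : Ω
  Choice = ⋀[ F ]
    ( (⋀[ x ∈ F ] Nonempty x)
    ⇒ (⋀[ x ∈ F ] ⋀[ y ∈ F ] ((⋁[ z ] (z ε x ∧ z ε y)) ⇒ x ≐ y))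
    ⇒ (⋁[ C ] ⋀[ x ∈ F ] ⋁[ z ] ⋀[ z′ ] ((z′ ε x ∧ z′ ε C) ⇔ z′ ≐ z)))

  IsUltrafilter : Dom → Dom → Ω
  IsUltrafilter U S′ =
      (⋀[ X ∈ U ] X ⊆ S′)
    ∧ S′ ε U
    ∧ (⋀[ X ∈ U ] Nonempty X)
    ∧ (⋀[ X ∈ U ] ⋀[ Y ] (X ⊆ Y ⇒ Y ⊆ S′ ⇒ Y ε U))
    ∧ (⋀[ X ∈ U ] ⋀[ Y ∈ U ] ⋀[ Z ] ((⋀[ z ] (z ε Z ⇔ (z ε X ∧ z ε Y))) ⇒ Z ε U))
    ∧ (⋀[ X ] ⋀[ Y ] (X ⊆ S′
         ⇒ (⋀[ z ] (z ε Y ⇔ (z ε S′ ∧ ~ (z ε X))))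
         ⇒ X ε U ∨ Y ε U))

  -- Closure under intersections (inside S′) of fewer than k members.
  IsComplete : Dom → Dom → Dom → Ω
  IsComplete U S′ k = ⋀[ F ] (F ⊆ U ⇒ F ≺ k
    ⇒ (⋀[ X ] ((⋀[ z ] (z ε X ⇔ (z ε S′ ∧ (⋀[ Y ∈ F ] z ε Y)))) ⇒ X ε U)))

  IsNonprincipal : Dom → Dom → Ω
  IsNonprincipal U S′ = ⋀[ x ∈ S′ ] ⋀[ X ] (IsUPair X x x ⇒ ~ (X ε U))

  IsMeasurable : Class
  IsMeasurable k =
    IsUncountableCardinal k
    ∧ (⋁[ U ] (IsUltrafilter U k ∧ IsComplete U k k ∧ IsNonprincipal U k))

  -- T = P_k(A) = {x ⊆ A : |x| < k}
  IsSmallPowerset : Dom → Dom → Dom → Ω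
  IsSmallPowerset T k A = ⋀[ x ] (x ε T ⇔ (x ⊆ A ∧ x ≺ k))

  -- {x ∈ T : a ∈ x} ∈ U for every a ∈ A
  IsFine : Dom → Dom → Dom → Ω
  IsFine U T A =
    ⋀[ a ∈ A ] ⋀[ X ] ((⋀[ x ] (x ε X ⇔ (x ε T ∧ a ε x))) ⇒ X ε U)

  -- If f(x) ∈ x for U-almost all x, then f is constant on a set in U.
  IsNormal : Dom → Dom → Dom → Ω
  IsNormal U T A = ⋀[ f ] (IsFun f (_ε T) (_ε A)
    ⇒ (⋁[ X ∈ U ] ⋀[ x ∈ X ] ⋁[ a ] (Maps f x a ∧ a ε x))
    ⇒ (⋁[ a ∈ A ] ⋁[ X ∈ U ] ⋀[ x ∈ X ] Maps f x a))

  -- For every A with |A| ≥ k there is a normal measure on P_k(A).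
  IsSupercompact : Class
  IsSupercompact k =
    IsUncountableCardinal k
    ∧ (⋀[ A ] (k ≼ A ⇒ (⋀[ T ] (IsSmallPowerset T k A
         ⇒ (⋁[ U ] ( IsUltrafilter U T ∧ IsComplete U T k
                   ∧ IsFine U T A ∧ IsNormal U T A))))))

  -- p is a function on k, p(α) is a countable partial function from w to α for
  -- each α < k, and the support {α < k : p(α) ≠ ∅} is countable.
  IsCollCondition : Dom → Dom → Class
  IsCollCondition w k p =
      IsFun p (_ε k) (λ g → IsPartialFun g (_ε w) (_ε k))
    ∧ (⋀[ α ∈ k ] ⋀[ g ] (Maps p α g
         ⇒ IsPartialFun g (_ε w) (_ε α) ∧ IsCountable g))
    ∧ (⋁[ s ] ( IsCountable s
              ∧ (⋀[ α ] (α ε s ⇔ (α ε k ∧ (⋁[ g ] (Maps p α g ∧ Nonempty g)))))))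

  -- P is the underlying set of Coll(ω₁ , <k).
  IsColl : Dom → Dom → Ω
  IsColl P k = ⋁[ w ] (IsAleph1 w ∧ (⋀[ p ] (p ε P ⇔ IsCollCondition w k p)))

  -- p is stronger than q: p(α) ⊇ q(α) for all α < k.
  CollOrder : Dom → Dom → Dom → Ω
  CollOrder k p q = ⋀[ α ∈ k ] ⋀[ g ] ⋀[ h ] (Maps p α g ⇒ Maps q α h ⇒ h ⊆ g)

  -- e ∈ [A]², for a class A
  IsTwoSubset : Class → Class
  IsTwoSubset A e = ⋁[ x ] ⋁[ y ] (A x ∧ A y ∧ ~ (x ≐ y) ∧ IsUPair e x y)

  -- f is a walk of n edges from x to y in the graph (X , E):
  -- f : n + 1 → X, f(0) = x, f(n) = y and {f(i) , f(i+1)} ∈ E for i < n.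
  IsPath : Class → Class → Dom → Dom → Dom → Dom → Ω
  IsPath X E n f x y =
      (⋁[ m ] (IsSuccessor m n ∧ IsFun f (_ε m) X))
    ∧ (⋁[ o ] (~ Nonempty o ∧ Maps f o x))
    ∧ Maps f n y
    ∧ (⋀[ i ∈ n ] ⋁[ j ] ⋁[ a ] ⋁[ b ] ⋁[ e ]
         (IsSuccessor j i ∧ Maps f i a ∧ Maps f j b ∧ IsUPair e a b ∧ E e))

  IsConnected : Class → Class → Ω
  IsConnected X E = ⋀[ x ] ⋀[ y ] (X x ⇒ X y
    ⇒ (⋁[ w ] (IsOmega w ∧ (⋁[ n ∈ w ] ⋁[ f ] IsPath X E n f x y))))

  IsHighlyConnected : Dom → Class → Ω
  IsHighlyConnected X E = ⋀[ Y ] (Y ⊆ X ⇒ Y ≺ X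
    ⇒ IsConnected (X∖ Y) (λ e → E e ∧ IsTwoSubset (X∖ Y) e))
    where
    X∖ : Dom → Class
    X∖ Y x = x ε X ∧ ~ (x ε Y)

  -- l →hc (l)²_ω
  HCArrow : Class
  HCArrow l = ⋀[ w ] (IsOmega w ⇒ (⋀[ c ] (IsFun c (IsTwoSubset (_ε l)) (_ε w)
    ⇒ (⋁[ i ∈ w ] ⋁[ A ] ( A ⊆ l ∧ A ≃ l
         ∧ IsHighlyConnected A (λ e → Maps c e i ∧ IsTwoSubset (_ε A) e))))))

  HCArrowAtAleph2 : Ω
  HCArrowAtAleph2 = ⋀[ l ] (IsAleph2 l ⇒ HCArrow l)

  HCArrowAtRegularsFromAleph2 : Ω
  HCArrowAtRegularsFromAleph2 =
    ⋀[ l ] (IsRegular l ⇒ (⋁[ a ] (IsAleph2 a ∧ a ⊆ l)) ⇒ HCArrow l)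

-- The cumulative hierarchy of (Aczel) iterative sets. Under excluded middle it
-- satisfies ZF, with Choice the remaining axiom of ZFC.
data V (ℓ : Level) : Set (suc ℓ) where
  sup : (A : Set ℓ) → (A → V ℓ) → V ℓ

module _ {ℓ : Level} where

  Index : V ℓ → Set ℓ
  Index (sup A _) = A

  elem : (a : V ℓ) → Index a → V ℓ
  elem (sup _ f) = f

  _≈_ : V ℓ → V ℓ → Set ℓ
  sup A f ≈ sup B g =
    (∀ a → Σ[ b ∈ B ] f a ≈ g b) × (∀ b → Σ[ a ∈ A ] f a ≈ g b)

  _∈_ : V ℓ → V ℓ → Set ℓ
  a ∈ b = Σ[ i ∈ Index b ] a ≈ elem b i

universe : ∀ ℓ → Structure ℓ
universe ℓ = record
  { Dom    = V ℓ
  ; Ω      = Set (suc ℓ)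
  ; _ε_    = λ a b → Lift (suc ℓ) (a ∈ b)
  ; _≐_    = λ a b → Lift (suc ℓ) (a ≈ b)
  ; falsum = ⊥
  ; _∧_    = _×_
  ; _∨_    = _⊎_
  ; _⇒_    = λ φ ψ → φ → ψ
  ; all    = λ φ → ∀ x → φ x
  ; ex     = λ φ → ∃[ x ] φ x
  }

-- Forcing over a notion of forcing with conditions C; p ≤ q means that p is
-- stronger than q.
module Forcing {ℓ : Level} (C : Set ℓ) (_≤_ : C → C → Set (suc ℓ)) where

  -- mk I σ s is the name {(σ i , s i) : i ∈ I}.
  data Name : Set (suc ℓ) where
    mk : (I : Set ℓ) → (I → Name) → (I → C) → Name

  DenseBelow : C → (C → Set (suc ℓ)) → Set (suc ℓ)
  DenseBelow p D = ∀ q → q ≤ p → Σ[ r ∈ C ] (r ≤ q × D r)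

  -- p ⊩ σ = τ iff p ⊩ σ ⊆ τ and p ⊩ τ ⊆ σ, with ⊩ ∈ (see forces-∈) unfolded
  -- so that the recursion on names is structural.
  forces-≈ : Name → Name → C → Set (suc ℓ)
  forces-≈ (mk I σ s) (mk J τ t) p =
      (∀ i q → q ≤ p → q ≤ s i →
         DenseBelow q λ r → Σ[ j ∈ J ] (r ≤ t j × forces-≈ (σ i) (τ j) r))
    × (∀ j q → q ≤ p → q ≤ t j →
         DenseBelow q λ r → Σ[ i ∈ I ] (r ≤ s i × forces-≈ (σ i) (τ j) r))

  forces-∈ : Name → Name → C → Set (suc ℓ)
  forces-∈ σ (mk J τ t) p =
    DenseBelow p λ r → Σ[ j ∈ J ] (r ≤ t j × forces-≈ σ (τ j) r)

  -- The forcing relation: the truth value of φ is {p : p ⊩ φ}.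
  extension : Structure ℓ
  extension = record
    { Dom    = Name
    ; Ω      = C → Set (suc ℓ)
    ; _ε_    = forces-∈
    ; _≐_    = forces-≈
    ; falsum = λ _ → ⊥
    ; _∧_    = λ φ ψ p → φ p × ψ p
    ; _∨_    = λ φ ψ p → DenseBelow p λ q → φ q ⊎ ψ q
    ; _⇒_    = λ φ ψ p → ∀ q → q ≤ p → φ q → ψ q
    ; all    = λ φ p → ∀ x → φ x p
    ; ex     = λ φ p → DenseBelow p λ q → ∃[ x ] φ x q
    }

module In-V {ℓ : Level} = Formulas (universe ℓ)

Sentence : ∀ ℓ → Set (suc (suc (suc ℓ)))
Sentence ℓ = (S : Structure ℓ) → Structure.Ω S

-- φ holds in V^P, where P is (the underlying set of) Coll(ω₁ , <κ): every
-- condition forces φ.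
CollExtension_,_⊨_ : ∀ {ℓ} → V ℓ → V ℓ → Sentence ℓ → Set (suc ℓ)
CollExtension κ , P ⊨ φ = ∀ p → φ extension p
  where open Forcing (Index P) (λ p q → In-V.CollOrder κ (elem P p) (elem P q))

{-# OPTIONS --safe #-}
module Submission where

-- Let U be a κ-complete ultrafilter and P = Coll(ω₁ , <κ). Functions F from the
-- underlying set T of U to P, modulo U, are the conditions of j(P) for the ultrapower
-- embedding j. They are closed under countable limits, and the part of F that is constant
-- almost everywhere, its stem, is a condition of P each of whose extensions is compatible
-- with almost all F(t). Let m : T → λ be unbounded modulo U (the identity if κ = λ is
-- measurable, an upper bound of t ∈ P_κ(λ) if κ is supercompact). F decides that the vertex
-- α has colour n if F(t) ⊩ c(α , m t) = n for almost all t.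
--
-- First F is strengthened until every colour n is of one of two kinds: almost no vertex
-- m t can still receive n below F and F(t), or almost every vertex can, also below each
-- stronger F′. A binary tree of conditions with a common stem then yields F and a colour n
-- of the second kind such that any two strengthenings of F with a common stem can be
-- strengthened to decide n for a common vertex δ, for almost all δ: otherwise each node of
-- level n splits into two conditions that do not both admit n for δ, and following for one
-- such δ the branch that loses colour n at step n leads to a condition below which δ has no
-- colour. Let A be the set of vertices that receive n by a strengthening of F with stem in
-- the generic filter. Two vertices α and α′ of A are then joined by paths α β δ β′ α′,
-- where β is a common neighbour of α and δ and β′ one of δ and α′. The vertices β, δ, β′
-- can be found beyond any bound, and as λ is regular in the extension, a subset of A of
-- smaller cardinality is bounded.
--
-- In the extension κ is ℵ₂: ω₁ is preserved because P is countably closed, every α < κ is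
-- collapsed, and an injection κ → ω₁ would be decided by some F to be constant, while F(t₀)
-- and F(t) are compatible.

open import Level using (Level; Lift; lift; lower; suc)
open import Axiom.ExcludedMiddle using (ExcludedMiddle)
open import Data.Bool.Base using (Bool; true; false; if_then_else_)
open import Data.Empty using () renaming (⊥ to ⊥₀; ⊥-elim to ⊥₀-elim)
open import Data.Empty.Polymorphic using (⊥; ⊥-elim)
open import Data.Nat.Base using (ℕ; zero; _+_; _⊔_; _<_; z<s; s<s; z≤n; _≤′_; ≤′-reflexive; ≤′-step)
open import Data.Nat.Induction using (<-wellFounded)
open import Data.Nat.Properties using (<-cmp; m<n⇒m<1+n; n<1+n; m≤n⇒m<n∨m≡n; ≤-<-trans; +-identityʳ; +-suc; m≤m⊔n; m≤n⊔m; ≤⇒≤′)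
open import Data.Product.Base using (Σ-syntax; ∃; ∃-syntax; _×_; _,_; proj₁; proj₂)
open import Data.Sum.Base using (_⊎_; inj₁; inj₂; [_,_]′)
open import Data.Unit.Base using (⊤; tt)
open import Function.Base using (_∘_; id; case_of_)
open import Induction.WellFounded using (Acc; acc)
open import Relation.Binary.Definitions using (tri<; tri≈; tri>)
open import Relation.Binary.PropositionalEquality using (_≡_; refl; sym; trans; cong; subst)
open import Relation.Nullary using (¬_; Dec; yes; no)
open import Relation.Nullary.Decidable using (True; toWitness; fromWitness; ⌊_⌋)
open import Defs hiding (_∈_; _≈_)

-- Two vertices α and α′ of A may owe their colour to strengthenings of F that are incompatible, and
-- then nothing gives them a common neighbour. Hence the paths of four edges. The tree has its shape
-- because only countable closure is available: level n is spent on colour n alone, each level is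
-- finite so that one stem serves all of its nodes, and there are countably many nodes so that one t
-- realises all the splittings.
--
-- No generic filter, ultrapower or elementary embedding is formed. Truth in the extension is
-- density below a condition, and [F] is a function on the indices of `T`. Different indices may
-- present the same set, so a function picked index by index need not respect `~`; the axiom of
-- choice in V, in the form of the field `choose`, repairs this.

pattern 1+ n = ℕ.suc n

-- Iterative sets: equality, pairs, ordinals and numerals.

module Sets {ℓ : Level} where

  private
    raw-refl : (x : V ℓ) → x Defs.≈ x
    raw-refl (sup A f) = (λ i → i , raw-refl (f i)) , (λ i → i , raw-refl (f i))

    raw-sym : (x y : V ℓ) → x Defs.≈ y → y Defs.≈ x
    raw-sym (sup A f) (sup B g) (h , k) =
      (λ b → proj₁ (k b) , raw-sym _ _ (proj₂ (k b))) ,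
      (λ a → proj₁ (h a) , raw-sym _ _ (proj₂ (h a)))

    raw-trans : (x y z : V ℓ) → x Defs.≈ y → y Defs.≈ z → x Defs.≈ z
    raw-trans (sup A f) (sup B g) (sup C h) (p , q) (r , s) =
      (λ a → let b , e = p a ; c , e′ = r b in c , raw-trans _ _ _ e e′) ,
      (λ c → let b , e = s c ; a , e′ = q b in a , raw-trans _ _ _ e′ e)

  -- Defs._≈_ and Defs._∈_ compute, so that their arguments cannot be inferred from
  -- a proof; these records can, and they live at the level of the formulas.
  infix 4 _≈_ _∈_

  record _≈_ (x y : V ℓ) : Set (suc ℓ) where
    constructor mk≈
    field un≈ : x Defs.≈ y
  open _≈_ public

  record _∈_ (x y : V ℓ) : Set (suc ℓ) where
    constructor _at_
    field
      pos   : Index y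
      at-eq : x ≈ elem y pos
  open _∈_ public

  lift∈ : ∀ {x y} → x ∈ y → Lift (suc ℓ) (x Defs.∈ y)
  lift∈ (i at mk≈ e) = lift (i , e)

  lower∈ : ∀ {x y} → Lift (suc ℓ) (x Defs.∈ y) → x ∈ y
  lower∈ (lift (i , e)) = i at mk≈ e

  lift≈ : ∀ {x y} → x ≈ y → Lift (suc ℓ) (x Defs.≈ y)
  lift≈ (mk≈ e) = lift e

  lower≈ : ∀ {x y} → Lift (suc ℓ) (x Defs.≈ y) → x ≈ y
  lower≈ (lift e) = mk≈ e

  private variable x y z u v : V ℓ

  ≈-refl : ∀ {x} → x ≈ x
  ≈-refl = mk≈ (raw-refl _)

  ≈-sym : x ≈ y → y ≈ x
  ≈-sym (mk≈ e) = mk≈ (raw-sym _ _ e)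

  ≈-trans : x ≈ y → y ≈ z → x ≈ z
  ≈-trans (mk≈ e) (mk≈ e′) = mk≈ (raw-trans _ _ _ e e′)

  elem∈ : (a : V ℓ) (i : Index a) → elem a i ∈ a
  elem∈ a i = i at ≈-refl

  ∈-resp-≈ˡ : x ≈ y → x ∈ z → y ∈ z
  ∈-resp-≈ˡ e (i at e′) = i at ≈-trans (≈-sym e) e′

  ∈-resp-≈ʳ : y ≈ z → x ∈ y → x ∈ z
  ∈-resp-≈ʳ {sup _ _} {sup _ _} (mk≈ (p , _)) (i at e) =
    let j , e′ = p i in j at ≈-trans e (mk≈ e′)

  extensionality : (∀ z → z ∈ x → z ∈ y) → (∀ z → z ∈ y → z ∈ x) → x ≈ y
  extensionality {sup A f} {sup B g} p q = mk≈
    ( (λ i → let j at e = p (f i) (i at ≈-refl) in j , un≈ e)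
    , (λ j → let i at e = q (g j) (j at ≈-refl) in i , un≈ (≈-sym e)))

  -- The cycle is rotated so that it starts at the member of `x` occurring in it; the induction is
  -- on that member.
  no-3-cycle : ∀ x {y z : V ℓ} → x ∈ y → y ∈ z → z ∈ x → ⊥₀
  no-3-cycle (sup A f) {y} p q (i at e) =
    no-3-cycle (f i) {sup A f} {y} (i at ≈-refl) p (∈-resp-≈ʳ e q)

  no-2-cycle : ∀ x {y : V ℓ} → x ∈ y → y ∈ x → ⊥₀
  no-2-cycle (sup A f) p (i at e) = no-2-cycle (f i) (i at ≈-refl) (∈-resp-≈ʳ e p)

  ∈-irrefl : x ≈ y → x ∈ y → ⊥₀
  ∈-irrefl {x} e p = no-2-cycle x (∈-resp-≈ʳ (≈-sym e) p) (∈-resp-≈ʳ (≈-sym e) p)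

  Respects : (V ℓ → Set (suc ℓ)) → Set (suc ℓ)
  Respects Φ = ∀ {x y} → x ≈ y → Φ x → Φ y

  Respects₂ : (V ℓ → V ℓ → Set (suc ℓ)) → Set (suc ℓ)
  Respects₂ R = ∀ {x x′ y y′} → x ≈ x′ → y ≈ y′ → R x y → R x′ y′

  Respects₃ : (V ℓ → V ℓ → V ℓ → Set (suc ℓ)) → Set (suc ℓ)
  Respects₃ R = ∀ {x x′ y y′ z z′} → x ≈ x′ → y ≈ y′ → z ≈ z′ → R x y z → R x′ y′ z′

  upair : V ℓ → V ℓ → V ℓ
  upair x y = sup (Lift ℓ Bool) (λ b → if lower b then x else y)

  ∈upair⁻ : z ∈ upair x y → z ≈ x ⊎ z ≈ y
  ∈upair⁻ ((lift true) at e)  = inj₁ e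
  ∈upair⁻ ((lift false) at e) = inj₂ e

  ∈upairˡ : z ≈ x → z ∈ upair x y
  ∈upairˡ e = lift true at e

  ∈upairʳ : z ≈ y → z ∈ upair x y
  ∈upairʳ e = lift false at e

  upair-cong : ∀ {x x′ y y′} → x ≈ x′ → y ≈ y′ → upair x y ≈ upair x′ y′
  upair-cong (mk≈ e) (mk≈ e′) = mk≈
    ( (λ { (lift true) → lift true , e ; (lift false) → lift false , e′ })
    , (λ { (lift true) → lift true , e ; (lift false) → lift false , e′ }))

  opair : V ℓ → V ℓ → V ℓ
  opair x y = upair (upair x x) (upair x y)

  opair-cong : ∀ {x x′ y y′ : V ℓ} → x ≈ x′ → y ≈ y′ → opair x y ≈ opair x′ y′
  opair-cong e e′ = upair-cong (upair-cong e e) (upair-cong e e′)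

  private
    opair-inj₁ : ∀ {x y x′ y′ : V ℓ} → opair x y ≈ opair x′ y′ → x ≈ x′
    opair-inj₁ {x} {y} {x′} {y′} e with ∈upair⁻ (∈-resp-≈ʳ (≈-sym e) (∈upairˡ {y = upair x′ y′} (≈-refl {upair x′ x′})))
    ... | inj₁ s = [ ≈-sym , ≈-sym ]′ (∈upair⁻ (∈-resp-≈ʳ s (∈upairˡ {y = x′} (≈-refl {x′}))))
    ... | inj₂ s = [ id , id ]′ (∈upair⁻ (∈-resp-≈ʳ (≈-sym s) (∈upairˡ {y = y} (≈-refl {x}))))

    opair-snd : ∀ {x y x′ y′ : V ℓ} → opair x y ≈ opair x′ y′ → y ≈ x′ ⊎ y ≈ y′
    opair-snd {x} {y} {x′} {y′} e with ∈upair⁻ (∈-resp-≈ʳ e (∈upairʳ {x = upair x x} (≈-refl {upair x y})))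
    ... | inj₁ s = inj₁ ([ id , id ]′ (∈upair⁻ (∈-resp-≈ʳ s (∈upairʳ {x = x} (≈-refl {y})))))
    ... | inj₂ s = ∈upair⁻ (∈-resp-≈ʳ s (∈upairʳ {x = x} (≈-refl {y})))

  opair-injective : ∀ {x y x′ y′ : V ℓ} → opair x y ≈ opair x′ y′ → x ≈ x′ × y ≈ y′
  opair-injective e = opair-inj₁ e , snd (opair-snd e) (opair-snd (≈-sym e))
    where
    snd : _ → _ → _
    snd (inj₂ p) _ = p
    snd (inj₁ p) (inj₂ q) = ≈-sym q
    snd (inj₁ p) (inj₁ q) = ≈-trans p (≈-trans (≈-sym (opair-inj₁ e)) (≈-sym q))

  open In-V {ℓ}

  upair⇒ : IsUPair u x y → u ≈ upair x y
  upair⇒ h = extensionality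
    (λ z m → case proj₁ (h z) (lift∈ m) of λ { (inj₁ e) → ∈upairˡ (lower≈ e) ; (inj₂ e) → ∈upairʳ (lower≈ e) })
    (λ z m → lower∈ (proj₂ (h z) ([ inj₁ ∘ lift≈ , inj₂ ∘ lift≈ ]′ (∈upair⁻ m))))

  ⇒upair : u ≈ upair x y → IsUPair u x y
  ⇒upair e z =
    (λ m → [ inj₁ ∘ lift≈ , inj₂ ∘ lift≈ ]′ (∈upair⁻ (∈-resp-≈ʳ e (lower∈ m)))) ,
    (λ m → lift∈ (∈-resp-≈ʳ (≈-sym e) ([ ∈upairˡ ∘ lower≈ , ∈upairʳ ∘ lower≈ ]′ m)))

  opair⇒ : IsOPair u x y → u ≈ opair x y
  opair⇒ (s , t , hs , ht , hu) = ≈-trans (upair⇒ hu) (upair-cong (upair⇒ hs) (upair⇒ ht))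

  ⇒opair : u ≈ opair x y → IsOPair u x y
  ⇒opair e = _ , _ , ⇒upair ≈-refl , ⇒upair ≈-refl , ⇒upair e

  maps⇒ : Maps v x y → opair x y ∈ v
  maps⇒ (u , m , h) = ∈-resp-≈ˡ (opair⇒ h) (lower∈ m)

  ⇒maps : opair x y ∈ v → Maps v x y
  ⇒maps m = _ , lift∈ m , ⇒opair ≈-refl

  maps-resp : ∀ {x x′ y y′ v : V ℓ} → x ≈ x′ → y ≈ y′ → Maps v x y → Maps v x′ y′
  maps-resp {v = v} e e′ m = ⇒maps {v = v} (∈-resp-≈ˡ (opair-cong e e′) (maps⇒ {v = v} m))

  maps-resp-fun : v ≈ u → Maps v x y → Maps u x y
  maps-resp-fun {v} {u} e m = ⇒maps {v = u} (∈-resp-≈ʳ e (maps⇒ {v = v} m))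

  partialFun-maps : ∀ {A B : V ℓ → Set (suc ℓ)} → Respects A → Respects B →
    IsPartialFun v A B → Maps v x y → A x × B y
  partialFun-maps rA rB (h , _) (u , m , o) =
    let x′ , y′ , ax , by , o′ = h u m
        e , e′ = opair-injective (≈-trans (≈-sym (opair⇒ {u = u} o′)) (opair⇒ {u = u} o))
    in rA e ax , rB e′ by

  succ : V ℓ → V ℓ
  succ x = sup (Index x ⊎ Lift ℓ ⊤) [ elem x , (λ _ → x) ]′

  ∈succ⁻ : z ∈ succ x → z ∈ x ⊎ z ≈ x
  ∈succ⁻ ((inj₁ i) at e) = inj₁ (i at e)
  ∈succ⁻ ((inj₂ _) at e) = inj₂ e

  ∈succˡ : z ∈ x → z ∈ succ x
  ∈succˡ (i at e) = inj₁ i at e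

  ∈succʳ : z ≈ x → z ∈ succ x
  ∈succʳ e = inj₂ _ at e

  Ord : V ℓ → Set (suc ℓ)
  Ord x = (∀ {y z} → z ∈ y → y ∈ x → z ∈ x)
        × (∀ {y z} → y ∈ x → z ∈ x → y ∈ z ⊎ y ≈ z ⊎ z ∈ y)

  ordinal⇒ : IsOrdinal x → Ord x
  ordinal⇒ (t , l) =
    (λ m n → lower∈ (t _ (lift∈ n) _ (lift∈ m))) ,
    (λ m n → case l _ (lift∈ m) _ (lift∈ n) of λ
      { (inj₁ p)        → inj₁ (lower∈ p)
      ; (inj₂ (inj₁ p)) → inj₂ (inj₁ (lower≈ p))
      ; (inj₂ (inj₂ p)) → inj₂ (inj₂ (lower∈ p)) })

  ⇒ordinal : Ord x → IsOrdinal x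
  ⇒ordinal (t , l) =
    (λ y n z m → lift∈ (t (lower∈ m) (lower∈ n))) ,
    (λ y m z n → case l (lower∈ m) (lower∈ n) of λ
      { (inj₁ p)        → inj₁ (lift∈ p)
      ; (inj₂ (inj₁ p)) → inj₂ (inj₁ (lift≈ p))
      ; (inj₂ (inj₂ p)) → inj₂ (inj₂ (lift∈ p)) })

  ord-∈ : Ord x → y ∈ x → Ord y
  ord-∈ {x} {y} (t , l) m = tr , (λ p q → l (t p m) (t q m))
    where
    tr : ∀ {v z} → z ∈ v → v ∈ y → z ∈ y
    tr p q with l (t p (t q m)) m
    ... | inj₁ r = r
    ... | inj₂ (inj₁ e) = ⊥₀-elim (no-2-cycle _ q (∈-resp-≈ˡ e p))
    ... | inj₂ (inj₂ r) = ⊥₀-elim (no-3-cycle _ r p q)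

  num : ℕ → V ℓ
  num zero   = sup ⊥ λ ()
  num (1+ n) = succ (num n)

  num-< : ∀ {m n} → m < n → num m ∈ num n
  num-< {n = 1+ n} (s<s p) with m≤n⇒m<n∨m≡n p
  ... | inj₁ q    = ∈succˡ (num-< q)
  ... | inj₂ refl = ∈succʳ ≈-refl

-- The Cantor-Bernstein theorem relative to a preorder of conditions.

module CantorBernstein {ℓ : Level} (em : ExcludedMiddle (suc ℓ))
  {C : Set ℓ} (_≤_ : C → C → Set (suc ℓ)) (≤-refl : ∀ {p} → p ≤ p)
  (≤-trans : ∀ {p q r} → p ≤ q → q ≤ r → p ≤ r) where
  open Sets {ℓ}

  Dense : C → (C → Set (suc ℓ)) → Set (suc ℓ)
  Dense p D = ∀ q → q ≤ p → Σ[ r ∈ C ] (r ≤ q × D r)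

  -- `R x y p` is to be read as: p forces f(x) = y, for an injection f of X into the part of X that
  -- lies in the class `B`. The one-point order gives the ordinary theorem in V, so a single proof
  -- serves both V and the extension.
  record KInjection (X : V ℓ) (B : V ℓ → C → Set (suc ℓ)) (p₀ : C) : Set (suc (suc ℓ)) where
    field
      R      : V ℓ → V ℓ → C → Set (suc ℓ)
      R-mono : ∀ {x y p q} → q ≤ p → R x y p → R x y q
      R-resp : ∀ {x x′ y y′ p} → x ≈ x′ → y ≈ y′ → R x y p → R x′ y′ p
      R-into : ∀ {x y p} → p ≤ p₀ → R x y p → y ∈ X × Dense p (B y)
      R-func : ∀ {x y y′ p} → p ≤ p₀ → R x y p → R x y′ p → y ≈ y′
      R-inj  : ∀ {x x′ y p} → p ≤ p₀ → R x y p → R x′ y p → x ≈ x′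
      R-tot  : ∀ {x p} → p ≤ p₀ → x ∈ X → Dense p (λ q → ∃[ y ] R x y q)

  record KBijection (X : V ℓ) (B : V ℓ → C → Set (suc ℓ)) (p₀ : C) : Set (suc (suc ℓ)) where
    field
      injection : KInjection X B p₀
    open KInjection injection public
    field
      onto : ∀ {y p} → p ≤ p₀ → y ∈ X → B y p → Dense p (λ q → ∃[ x ] x ∈ X × R x y q)

  module _ {X : V ℓ} {B : V ℓ → C → Set (suc ℓ)} {p₀ : C} (I : KInjection X B p₀)
    (B-mono : ∀ {x p q} → q ≤ p → B x p → B x q) (B-resp : ∀ {x x′ p} → x ≈ x′ → B x p → B x′ p) where
    open KInjection I

    private
      -- The n-th iterated image of the part of X outside `B`. As in the classical proof, the
      -- bijection follows the injection on the union of these images and is the identity elsewhere.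
      Orbit : ℕ → V ℓ → C → Set (suc ℓ)
      Orbit zero   x p = x ∈ X × (∀ q → q ≤ p → ¬ B x q)
      Orbit (1+ n) x p = ∃[ y ] y ∈ X × Orbit n y p × R y x p

      orbit-mono : ∀ n {x p q} → q ≤ p → Orbit n x p → Orbit n x q
      orbit-mono zero   l (m , h) = m , λ r k → h r (≤-trans k l)
      orbit-mono (1+ n) l (y , m , o , r) = y , m , orbit-mono n l o , R-mono l r

      orbit-resp : ∀ n {x x′ p} → x ≈ x′ → Orbit n x p → Orbit n x′ p
      orbit-resp zero   e (m , h) = ∈-resp-≈ˡ e m , λ q k b → h q k (B-resp (≈-sym e) b)
      orbit-resp (1+ n) e (y , m , o , r) = y , m , o , R-resp ≈-refl e r

      Moved Fixed : V ℓ → C → Set (suc ℓ)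
      Moved x p = Σ[ n ∈ ℕ ] Orbit n x p
      Fixed x p = ∀ q → q ≤ p → ¬ Moved x q

      moved? : ∀ x p → Σ[ r ∈ C ] (r ≤ p × (Moved x r ⊎ Fixed x r))
      moved? x p with em {Σ[ r ∈ C ] (r ≤ p × Moved x r)}
      ... | yes (r , l , m) = r , l , inj₁ m
      ... | no h = p , ≤-refl , inj₂ λ q l m → h (q , l , m)

    cantor-bernstein : KBijection X B p₀
    cantor-bernstein = record
      { injection = record
        { R = H
        ; R-mono = λ { l (m , inj₁ ((n , o) , r)) → m , inj₁ ((n , orbit-mono n l o) , R-mono l r)
                     ; l (m , inj₂ (f , e)) → m , inj₂ ((λ q k → f q (≤-trans k l)) , e) }
        ; R-resp = λ { e e′ (m , inj₁ ((n , o) , r)) → ∈-resp-≈ˡ e m , inj₁ ((n , orbit-resp n e o) , R-resp e e′ r)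
                     ; e e′ (m , inj₂ (f , d)) → ∈-resp-≈ˡ e m ,
                         inj₂ ((λ q k (n , o) → f q k (n , orbit-resp n (≈-sym e) o)) , ≈-trans (≈-sym e) (≈-trans d e′)) }
        ; R-into = into ; R-func = func ; R-inj = inj ; R-tot = tot }
      ; onto = onto′ }
      where
      H : V ℓ → V ℓ → C → Set (suc ℓ)
      H x y p = x ∈ X × (Moved x p × R x y p ⊎ Fixed x p × x ≈ y)

      into : ∀ {x y p} → p ≤ p₀ → H x y p → y ∈ X × Dense p (B y)
      into l (m , inj₁ (_ , r)) = R-into l r
      into {x} {y} {p} l (m , inj₂ (f , e)) = ∈-resp-≈ˡ e m , d
        where
        d : Dense p (B y)
        d q k with em {Σ[ r ∈ C ] (r ≤ q × B y r)}
        ... | yes b = b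
        -- A fixed point must lie in `B`: otherwise it would start an orbit below `q`.
        ... | no h = ⊥₀-elim (f q k (0 , m , λ r k′ b → h (r , k′ , B-resp e b)))

      func : ∀ {x y y′ p} → p ≤ p₀ → H x y p → H x y′ p → y ≈ y′
      func l (_ , inj₁ (_ , r)) (_ , inj₁ (_ , r′)) = R-func l r r′
      func l (_ , inj₁ (m , _)) (_ , inj₂ (f , _)) = ⊥₀-elim (f _ ≤-refl m)
      func l (_ , inj₂ (f , _)) (_ , inj₁ (m , _)) = ⊥₀-elim (f _ ≤-refl m)
      func l (_ , inj₂ (_ , e)) (_ , inj₂ (_ , e′)) = ≈-trans (≈-sym e) e′

      inj : ∀ {x x′ y p} → p ≤ p₀ → H x y p → H x′ y p → x ≈ x′
      inj l (_ , inj₁ (_ , r)) (_ , inj₁ (_ , r′)) = R-inj l r r′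
      inj l (d , inj₁ ((n , o) , r)) (_ , inj₂ (f , e)) =
        ⊥₀-elim (f _ ≤-refl (1+ n , _ , d , o , R-resp ≈-refl (≈-sym e) r))
      inj l (_ , inj₂ (f , e)) (d , inj₁ ((n , o) , r)) =
        ⊥₀-elim (f _ ≤-refl (1+ n , _ , d , o , R-resp ≈-refl (≈-sym e) r))
      inj l (_ , inj₂ (_ , e)) (_ , inj₂ (_ , e′)) = ≈-trans e (≈-sym e′)

      tot : ∀ {x p} → p ≤ p₀ → x ∈ X → Dense p (λ q → ∃[ y ] H x y q)
      tot {x} l m q k with moved? x q
      ... | r , k′ , inj₂ f = r , k′ , x , m , inj₂ (f , ≈-refl)
      ... | r , k′ , inj₁ (n , o) with R-tot (≤-trans k′ (≤-trans k l)) m r ≤-refl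
      ...   | s , k″ , y , h = s , ≤-trans k″ k′ , y , m , inj₁ ((n , orbit-mono n k″ o) , h)

      onto′ : ∀ {y p} → p ≤ p₀ → y ∈ X → B y p → Dense p (λ q → ∃[ x ] x ∈ X × H x y q)
      onto′ {y} l m b q k with moved? y q
      ... | r , k′ , inj₂ f = r , k′ , y , m , m , inj₂ (f , ≈-refl)
      ... | r , k′ , inj₁ (zero , _ , nb) = ⊥₀-elim (nb r ≤-refl (B-mono (≤-trans k′ k) b))
      ... | r , k′ , inj₁ (1+ n , x , d , o , h) = r , k′ , x , d , d , inj₁ ((n , o) , h)

-- Classical set theory in V: separation, injections, ω and countability.

module Classical {ℓ : Level} (em : ExcludedMiddle (suc ℓ)) where
  open Sets {ℓ}
  open In-V {ℓ}

  by-contra : {A : Set (suc ℓ)} → (¬ A → ⊥₀) → A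
  by-contra {A} h with em {A}
  ... | yes a = a
  ... | no ¬a = ⊥₀-elim (h ¬a)

  -- Excluded middle resizes every proposition to the bottom level, which is what
  -- makes full separation available in V.
  Small : Set (suc ℓ) → Set ℓ
  Small A = Lift ℓ (True (em {A}))

  small : ∀ {A} → A → Small A
  small a = lift (fromWitness a)

  unsmall : ∀ {A} → Small A → A
  unsmall s = toWitness (lower s)

  private variable a b c x y z u v : V ℓ

  sep : V ℓ → (V ℓ → Set (suc ℓ)) → V ℓ
  sep a Φ = sup (Σ[ i ∈ Index a ] Small (Φ (elem a i))) (elem a ∘ proj₁)

  ∈sep : ∀ {Φ} → Respects Φ → x ∈ a → Φ x → x ∈ sep a Φ
  ∈sep r (i at e) φ = (i , small (r e φ)) at e

  ∈sep⁻ : ∀ {Φ} → Respects Φ → x ∈ sep a Φ → x ∈ a × Φ x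
  ∈sep⁻ r ((i , s) at e) = i at e , r (≈-sym e) (unsmall s)

  relSet : V ℓ → V ℓ → (V ℓ → V ℓ → Set (suc ℓ)) → V ℓ
  relSet a b R = sup (Σ[ i ∈ Index a ] Σ[ j ∈ Index b ] Small (R (elem a i) (elem b j)))
                     (λ (i , j , _) → opair (elem a i) (elem b j))

  module _ {R : V ℓ → V ℓ → Set (suc ℓ)} (resp : Respects₂ R) where

    ∈relSet : x ∈ a → y ∈ b → R x y → Maps (relSet a b R) x y
    ∈relSet {a = a} {b = b} (i at e) (j at e′) r =
      ⇒maps {v = relSet a b R} ((i , j , small (resp e e′ r)) at opair-cong e e′)

    ∈relSet⁻ : Maps (relSet a b R) x y → x ∈ a × y ∈ b × R x y
    ∈relSet⁻ {a = a} {b = b} m with maps⇒ {v = relSet a b R} m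
    ... | (i , j , s) at e = let e₁ , e₂ = opair-injective e in
      i at e₁ , j at e₂ , resp (≈-sym e₁) (≈-sym e₂) (unsmall s)

    relSet-isPartialFun : (∀ {x y y′} → x ∈ a → R x y → R x y′ → y ≈ y′) →
      IsPartialFun (relSet a b R) (λ x → Lift (suc ℓ) (x Defs.∈ a)) (λ y → Lift (suc ℓ) (y Defs.∈ b))
    relSet-isPartialFun {a = a} {b = b} func =
      (λ u m → let (i , j , s) at e = lower∈ {y = relSet a b R} m in
         _ , _ , lift∈ (elem∈ a i) , lift∈ (elem∈ b j) , ⇒opair e) ,
      (λ x y y′ m m′ → let p , _ , r = ∈relSet⁻ {a = a} {b} m ; _ , _ , r′ = ∈relSet⁻ {a = a} {b} m′ in
         lift≈ (func p r r′))

    relSet-isInjection : (∀ {x y y′} → x ∈ a → R x y → R x y′ → y ≈ y′) →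
      (∀ {x x′ y} → R x y → R x′ y → x ≈ x′) →
      (∀ {x} → x ∈ a → ∃[ y ] y ∈ b × R x y) → IsInjection (relSet a b R) a b
    relSet-isInjection {a = a} {b = b} func inj tot =
      (relSet-isPartialFun {a = a} {b = b} func ,
       (λ x m → let y , n , r = tot (lower∈ m) in y , ∈relSet {a = a} {b = b} (lower∈ m) n r)) ,
      (λ x x′ y m m′ → let _ , _ , r = ∈relSet⁻ {a = a} {b} m ; _ , _ , r′ = ∈relSet⁻ {a = a} {b} m′ in
         lift≈ (inj r r′))

  -- Acts on indices, so that injections compose without passing through their graphs; `fun-resp`
  -- makes the map independent of the index that presents an element.
  record Injective (a b : V ℓ) : Set (suc ℓ) where
    constructor injective
    field
      fun      : Index a → Index b
      fun-resp : ∀ {i j} → elem a i ≈ elem a j → elem b (fun i) ≈ elem b (fun j)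
      fun-inj  : ∀ {i j} → elem b (fun i) ≈ elem b (fun j) → elem a i ≈ elem a j
  open Injective public

  injective-∘ : Injective b c → Injective a b → Injective a c
  injective-∘ (injective h r i) (injective h′ r′ i′) = injective (h ∘ h′) (r ∘ r′) (i′ ∘ i)

  ⊆⇒injective : (∀ {x} → x ∈ a → x ∈ b) → Injective a b
  ⊆⇒injective {a} s = injective (λ i → pos (s (elem∈ a i)))
    (λ e → ≈-trans (≈-sym (at-eq (s _))) (≈-trans e (at-eq (s _))))
    (λ e → ≈-trans (at-eq (s _)) (≈-trans e (≈-sym (at-eq (s _)))))

  ≼⇒injective : a ≼ b → Injective a b
  ≼⇒injective {a} {b} (f , (pf , tot) , inj) = injective (λ i → pos (val∈ i))
    (λ {i} {j} e → ≈-trans (≈-sym (at-eq (val∈ i))) (≈-trans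
      (lower≈ (proj₂ pf _ _ _ (maps-resp {v = f} e ≈-refl (mp i)) (mp j))) (at-eq (val∈ j))))
    (λ {i} {j} e → lower≈ (inj _ _ _ (mp i)
      (maps-resp {v = f} ≈-refl (≈-trans (at-eq (val∈ j)) (≈-trans (≈-sym e) (≈-sym (at-eq (val∈ i))))) (mp j))))
    where
    val : Index a → V ℓ
    val i = proj₁ (tot (elem a i) (lift∈ (elem∈ a i)))
    mp : ∀ i → Maps f (elem a i) (val i)
    mp i = proj₂ (tot (elem a i) (lift∈ (elem∈ a i)))
    val∈ : ∀ i → val i ∈ b
    val∈ i = lower∈ (proj₂ (partialFun-maps {v = f}
      {A = λ x → Lift (suc ℓ) (x Defs.∈ a)} {B = λ x → Lift (suc ℓ) (x Defs.∈ b)}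
      (λ e m → lift∈ {y = a} (∈-resp-≈ˡ e (lower∈ m))) (λ e m → lift∈ {y = b} (∈-resp-≈ˡ e (lower∈ m))) pf (mp i)))

  record Graph (f : Injective a b) (x y : V ℓ) : Set (suc ℓ) where
    constructor graph
    field
      {arg}  : Index a
      arg-eq : x ≈ elem a arg
      val-eq : y ≈ elem b (fun f arg)

  graph-resp : (f : Injective a b) → Respects₂ (Graph f)
  graph-resp f e e′ (graph p q) = graph (≈-trans (≈-sym e) p) (≈-trans (≈-sym e′) q)

  graph-func : (f : Injective a b) → ∀ {x y y′} → Graph f x y → Graph f x y′ → y ≈ y′
  graph-func f (graph p q) (graph p′ q′) =
    ≈-trans q (≈-trans (fun-resp f (≈-trans (≈-sym p) p′)) (≈-sym q′))

  graph-inj : (f : Injective a b) → ∀ {x x′ y} → Graph f x y → Graph f x′ y → x ≈ x′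
  graph-inj f (graph p q) (graph p′ q′) =
    ≈-trans p (≈-trans (fun-inj f (≈-trans (≈-sym q) q′)) (≈-sym p′))

  graph-tot : (f : Injective a b) → ∀ {x} → x ∈ a → ∃[ y ] y ∈ b × Graph f x y
  graph-tot {b = b} f (i at e) = _ , elem∈ b (fun f i) , graph e ≈-refl

  injective⇒≼ : Injective a b → a ≼ b
  injective⇒≼ {a} {b} f = relSet a b (Graph f) ,
    relSet-isInjection (graph-resp f) (λ _ → graph-func f) (graph-inj f) (graph-tot f)

  -- Double induction. If no member of x equals or contains y, the induction hypothesis puts all
  -- members of x into y; symmetrically for y, and extensionality finishes.
  trichotomy : Ord x → Ord y → x ∈ y ⊎ x ≈ y ⊎ y ∈ x
  trichotomy {x} {y} = go x y
    where
    step : ∀ x y → Ord x → Ord y → (∀ i → elem x i ∈ y ⊎ elem x i ≈ y ⊎ y ∈ elem x i) →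
      (∀ j → x ∈ elem y j ⊎ x ≈ elem y j ⊎ elem y j ∈ x) → x ∈ y ⊎ x ≈ y ⊎ y ∈ x
    step x y ox oy l r
      with em {Σ[ i ∈ Index x ] (elem x i ≈ y ⊎ y ∈ elem x i)} | em {Σ[ j ∈ Index y ] (x ∈ elem y j ⊎ x ≈ elem y j)}
    ... | yes (i , inj₁ e) | _ = inj₂ (inj₂ (i at ≈-sym e))
    ... | yes (i , inj₂ m) | _ = inj₂ (inj₂ (proj₁ ox m (elem∈ x i)))
    ... | _ | yes (j , inj₂ e) = inj₁ (j at e)
    ... | _ | yes (j , inj₁ m) = inj₁ (proj₁ oy m (elem∈ y j))
    ... | no ¬p | no ¬q = inj₂ (inj₁ (extensionality
          (λ { z (i at e) → ∈-resp-≈ˡ (≈-sym e) (case l i of λ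
              { (inj₁ m) → m ; (inj₂ m) → ⊥₀-elim (¬p (i , m)) }) })
          (λ { z (j at e) → ∈-resp-≈ˡ (≈-sym e) (case r j of λ
              { (inj₂ (inj₂ m)) → m
              ; (inj₂ (inj₁ m)) → ⊥₀-elim (¬q (j , inj₂ m))
              ; (inj₁ m) → ⊥₀-elim (¬q (j , inj₁ m)) }) })))
    go : ∀ x y → Ord x → Ord y → x ∈ y ⊎ x ≈ y ⊎ y ∈ x
    go (sup A f) (sup B g) ox oy = step (sup A f) (sup B g) ox oy
      (λ i → go (f i) (sup B g) (ord-∈ ox (elem∈ (sup A f) i)) oy)
      (λ j → go (sup A f) (g j) ox (ord-∈ oy (elem∈ (sup B g) j)))

  num∈⁻ : ∀ n → x ∈ num n → Σ[ m ∈ ℕ ] m < n × x ≈ num m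
  num∈⁻ (1+ n) m with ∈succ⁻ m
  ... | inj₁ p = let k , q , e = num∈⁻ n p in k , m<n⇒m<1+n q , e
  ... | inj₂ e = n , n<1+n n , e

  num-injective : ∀ m n → num m ≈ num n → m ≡ n
  num-injective m n e with <-cmp m n
  ... | tri< p _ _ = ⊥₀-elim (∈-irrefl e (num-< p))
  ... | tri≈ _ p _ = p
  ... | tri> _ _ p = ⊥₀-elim (∈-irrefl (≈-sym e) (num-< p))

  num-trichotomy : ∀ m n → num m ∈ num n ⊎ num m ≈ num n ⊎ num n ∈ num m
  num-trichotomy m n with <-cmp m n
  ... | tri< p _ _    = inj₁ (num-< p)
  ... | tri≈ _ refl _ = inj₂ (inj₁ ≈-refl)
  ... | tri> _ _ p    = inj₂ (inj₂ (num-< p))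

  ωV : V ℓ
  ωV = sup (Lift ℓ ℕ) (num ∘ lower)

  num∈ω : ∀ n → num n ∈ ωV
  num∈ω n = lift n at ≈-refl

  ω-ord : Ord ωV
  ω-ord =
    (λ { p (lift n at e) → let m , _ , e′ = num∈⁻ n (∈-resp-≈ʳ e p) in lift m at e′ }) ,
    (λ { (lift m at e) (lift n at e′) → case num-trichotomy m n of λ
      { (inj₁ p) → inj₁ (∈-resp-≈ˡ (≈-sym e) (∈-resp-≈ʳ (≈-sym e′) p))
      ; (inj₂ (inj₁ p)) → inj₂ (inj₁ (≈-trans e (≈-trans p (≈-sym e′))))
      ; (inj₂ (inj₂ p)) → inj₂ (inj₂ (∈-resp-≈ˡ (≈-sym e′) (∈-resp-≈ʳ (≈-sym e) p))) } })

  ω-isOmega : IsOmega ωV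
  ω-isOmega = (⇒ordinal ω-ord , (num 0 , lift∈ (num∈ω 0)) , unb) , notLimit
    where
    unb : ∀ y → _ → _
    unb y m = let lift n at e = lower∈ {y = ωV} m in
      num (1+ n) , lift∈ (num∈ω (1+ n)) , lift∈ (∈succʳ e)
    notLimit : ∀ y → Lift (suc ℓ) (y Defs.∈ ωV) → ~ IsLimit y
    notLimit y m (_ , (z , ne) , lim) = go (lower∈ {y = ωV} m)
      where
      go : y ∈ ωV → ⊥
      go (lift zero at e) = case num∈⁻ 0 (∈-resp-≈ʳ e (lower∈ ne)) of λ { (_ , () , _) }
      go (lift (1+ n) at e) = let v , p , q = lim (num n) (lift∈ (∈-resp-≈ʳ (≈-sym e) (∈succʳ ≈-refl))) in
        case ∈succ⁻ (∈-resp-≈ʳ e (lower∈ p)) of λ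
          { (inj₁ r)  → ⊥₀-elim (no-2-cycle v r (lower∈ q))
          ; (inj₂ e′) → ⊥₀-elim (∈-irrefl (≈-sym e′) (lower∈ q)) }

  -- Induction on x: a nonempty member of ω without a largest element would be a limit, which
  -- `IsOmega` excludes, and one with a largest element is the successor of that element.
  omega⇒num : ∀ {w} → IsOmega w → ∀ x → x ∈ w → Σ[ n ∈ ℕ ] x ≈ num n
  omega⇒num {w} ((ow , _) , nl) = go
    where
    o : Ord w
    o = ordinal⇒ ow
    go : ∀ x → x ∈ w → Σ[ n ∈ ℕ ] x ≈ num n
    go (sup A f) m with em {Lift (suc ℓ) A}
    ... | no ¬a = 0 , extensionality (λ { z (i at _) → ⊥₀-elim (¬a (lift i)) }) (λ { z (() at _) })
    ... | yes (lift a₀) with em {Σ[ i ∈ A ] (∀ j → ¬ (f i ∈ f j))}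
    ...   | no h = ⊥-elim (nl _ (lift∈ m) (⇒ordinal (ord-∈ o m) , (f a₀ , lift∈ (elem∈ (sup A f) a₀)) ,
              (λ y p → let i at e = lower∈ {y = sup A f} p
                           j , q = by-contra {Σ[ j ∈ A ] f i ∈ f j} (λ k → h (i , λ j r → k (j , r)))
                       in f j , lift∈ (elem∈ (sup A f) j) , lift∈ (∈-resp-≈ˡ (≈-sym e) q))))
    ...   | yes (i , top) = let n , e = go (f i) (proj₁ o (elem∈ (sup A f) i) m) in 1+ n , extensionality
              (λ { z (j at e′) → ∈-resp-≈ˡ (≈-sym e′) (case proj₂ (ord-∈ o m) (elem∈ (sup A f) i) (elem∈ (sup A f) j) of λ
                 { (inj₁ p) → ⊥₀-elim (top j p)
                 ; (inj₂ (inj₁ p)) → ∈succʳ (≈-trans (≈-sym p) e)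
                 ; (inj₂ (inj₂ p)) → ∈succˡ (∈-resp-≈ʳ e p) }) })
              (λ z p → case ∈succ⁻ p of λ
                 { (inj₁ q) → proj₁ (ord-∈ o m) (∈-resp-≈ʳ (≈-sym e) q) (elem∈ (sup A f) i)
                 ; (inj₂ q) → i at ≈-trans q (≈-sym e) })

  num∈omega : ∀ {w} → IsOmega w → ∀ n → num n ∈ w
  num∈omega {w} h@((ow , (z , ne) , lim) , _) n = let m , p , q = above n in proj₁ (ordinal⇒ ow) (num-< p) q
    where
    above : ∀ n → Σ[ m ∈ ℕ ] n < m × num m ∈ w
    next : ∀ m → num m ∈ w → Σ[ k ∈ ℕ ] m < k × num k ∈ w
    next m p with lim (num m) (lift∈ p)
    ... | v , vw , mv with omega⇒num {w} h v (lower∈ vw)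
    ...   | k , e with <-cmp m k
    ...     | tri< q _ _ = k , q , ∈-resp-≈ˡ e (lower∈ vw)
    ...     | tri≈ _ refl _ = ⊥₀-elim (∈-irrefl (≈-sym e) (lower∈ mv))
    ...     | tri> _ _ q = ⊥₀-elim (no-2-cycle _ (num-< q) (∈-resp-≈ʳ e (lower∈ mv)))
    above zero = let m , e = omega⇒num {w} h z (lower∈ ne)
                     k , q , r = next m (∈-resp-≈ˡ e (lower∈ ne)) in k , ≤-<-trans z≤n q , r
    above (1+ n) = let m , p , q = above n ; k , r , s = next m q in k , ≤-<-trans p r , s

  least : (P : ℕ → Set (suc ℓ)) → ∀ n → P n → Σ[ m ∈ ℕ ] P m × (∀ k → k < m → ¬ P k)
  least P n = go n (<-wellFounded n)
    where
    go : ∀ n → Acc _<_ n → P n → Σ[ m ∈ ℕ ] P m × (∀ k → k < m → ¬ P k)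
    go n (acc rs) p with em {Σ[ k ∈ ℕ ] k < n × P k}
    ... | yes (k , q , r) = go k (rs q) r
    ... | no h = n , p , λ k q r → h (k , q , r)

  -- The values of `e` may lie outside `a`, so that a partial enumeration can be completed by
  -- default values.
  Cover : V ℓ → Set (suc ℓ)
  Cover a = Σ[ e ∈ (ℕ → V ℓ) ] (∀ {x} → x ∈ a → Σ[ n ∈ ℕ ] x ≈ e n)

  countable⇒cover : IsCountable a → Cover a
  countable⇒cover {a} (w , hw , le) = e , cov
    where
    inj : Injective a w
    inj = ≼⇒injective {a} {w} le
    h = fun inj
    hit : ℕ → Set (suc ℓ)
    hit n = Σ[ i ∈ Index a ] elem w (h i) ≈ num n
    e : ℕ → V ℓ
    e n with em {hit n}
    ... | yes (i , _) = elem a i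
    ... | no _ = num 0
    e-hit : ∀ {n} i → elem w (h i) ≈ num n → elem a i ≈ e n
    e-hit {n} i p with em {hit n}
    ... | yes (j , q) = fun-inj inj (≈-trans p (≈-sym q))
    ... | no ¬q = ⊥₀-elim (¬q (i , p))
    cov : ∀ {x} → x ∈ a → Σ[ n ∈ ℕ ] x ≈ e n
    cov (i at p) = let n , q = omega⇒num hw _ (elem∈ w (h i)) in n , ≈-trans p (e-hit i q)

  -- Each element goes to its least place in the enumeration; leastness makes the place depend on
  -- the set and not on its index.
  cover⇒injective : ∀ {w} → IsOmega w → Cover a → Injective a w
  cover⇒injective {a} {w} hw (e , cov) = injective (λ i → pos (nw i))
    (λ {i} {j} p → ≈-trans (≈-sym (at-eq (nw i))) (≈-trans (subst (λ k → num (n i) ≈ num k) (n-ext p) ≈-refl) (at-eq (nw j))))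
    (λ {i} {j} p → ≈-trans (n-spec i) (≈-trans
       (subst (λ k → e (n i) ≈ e k) (num-injective _ _ (≈-trans (at-eq (nw i)) (≈-trans p (≈-sym (at-eq (nw j)))))) ≈-refl)
       (≈-sym (n-spec j))))
    where
    L : ∀ i → _
    L i = let k , q = cov (elem∈ a i) in least (λ m → elem a i ≈ e m) k q
    n : Index a → ℕ
    n i = proj₁ (L i)
    n-spec : ∀ i → elem a i ≈ e (n i)
    n-spec i = proj₁ (proj₂ (L i))
    nw : ∀ i → num (n i) ∈ w
    nw i = num∈omega hw (n i)
    n-ext : ∀ {i j} → elem a i ≈ elem a j → n i ≡ n j
    n-ext {i} {j} p with <-cmp (n i) (n j)
    ... | tri< q _ _ = ⊥₀-elim (proj₂ (proj₂ (L j)) _ q (≈-trans (≈-sym p) (n-spec i)))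
    ... | tri≈ _ q _ = q
    ... | tri> _ _ q = ⊥₀-elim (proj₂ (proj₂ (L i)) _ q (≈-trans p (n-spec j)))

  cover⇒countable : Cover a → IsCountable a
  cover⇒countable {a} c = ωV , ω-isOmega , injective⇒≼ {a} {ωV} (cover⇒injective ω-isOmega c)

  private
    -- The one-point order, for which the relative theorem speaks of V.
    open module CB = CantorBernstein em {Lift ℓ ⊤} (λ _ _ → Lift (suc ℓ) ⊤) _ _

  -- `IsCardinal` excludes bijections with smaller ordinals; Cantor-Bernstein turns an injection
  -- into such a bijection.
  cardinal-no-injection : ∀ {k α} → IsCardinal k → α ∈ k → ¬ Injective k α
  cardinal-no-injection {k} {α} (ok , nb) m f = ⊥-elim (nb α (lift∈ m) (relSet k α H ,
    relSet-isInjection resp (λ _ → R-func _) (R-inj _)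
      (λ d → let _ , _ , y , h = R-tot _ d _ _ in y , proj₂ (proj₂ (proj₂ (R-into _ h) _ _)) , h) ,
    (λ y n → let n′ = lower∈ n ; _ , _ , x , d , h = onto _ (proj₁ (ordinal⇒ ok) n′ m) n′ _ _
             in x , lift∈ d , ∈relSet resp d n′ h)))
    where
    I : KInjection k (λ y _ → y ∈ α) (lift tt)
    I = record
      { R = λ x y _ → Graph f x y
      ; R-mono = λ _ → id
      ; R-resp = graph-resp f
      ; R-into = λ { _ (graph _ e) → let d = _ at e in proj₁ (ordinal⇒ ok) d m , λ _ _ → _ , _ , d }
      ; R-func = λ _ → graph-func f
      ; R-inj = λ _ → graph-inj f
      ; R-tot = λ _ d _ _ → let y , _ , g = graph-tot f d in _ , _ , y , g }
    open KBijection (cantor-bernstein I (λ _ → id) ∈-resp-≈ˡ)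
    H : V ℓ → V ℓ → Set (suc ℓ)
    H x y = R x y (lift tt)
    resp : Respects₂ H
    resp = R-resp

  cardinal-uncovered : ∀ {k w} → IsCardinal k → IsOmega w → w ∈ k → ¬ Cover k
  cardinal-uncovered hk hw m c = cardinal-no-injection hk m (cover⇒injective hw c)

-- The forcing relation, names, and canonical names of sets of V.

module Names {ℓ : Level} (C : Set ℓ) (_≤_ : C → C → Set (suc ℓ)) where
  open Forcing C _≤_

  Ix : Name → Set ℓ
  Ix (mk I _ _) = I

  el : (σ : Name) → Ix σ → Name
  el (mk _ σ _) = σ

  tag : (σ : Name) → Ix σ → C
  tag (mk _ _ s) = s

module Extension {ℓ : Level} (em : ExcludedMiddle (suc ℓ))
  {C : Set ℓ} (_≤_ : C → C → Set (suc ℓ)) (≤-refl : ∀ {p} → p ≤ p)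
  (≤-trans : ∀ {p q r} → p ≤ q → q ≤ r → p ≤ r) (𝟙 : C) (≤-𝟙 : ∀ {p} → p ≤ 𝟙) where
  open Sets {ℓ}
  open Classical em
  open Forcing C _≤_ public
  open Names C _≤_ public
  module F = Formulas extension

  Dense : C → (C → Set (suc ℓ)) → Set (suc ℓ)
  Dense = DenseBelow

  dense-mono : {p q : C} {D : C → Set (suc ℓ)} → q ≤ p → Dense p D → Dense q D
  dense-mono l d r k = d r (≤-trans k l)

  dense-bind : {p : C} {D E : C → Set (suc ℓ)} → Dense p D → (∀ q → q ≤ p → D q → Dense q E) → Dense p E
  dense-bind d f q l =
    let r , k , x = d q l ; s , k′ , y = f r (≤-trans k l) x r ≤-refl in s , ≤-trans k′ k , y

  dense-map : {p : C} {D E : C → Set (suc ℓ)} → Dense p D → (∀ q → q ≤ p → D q → E q) → Dense p E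
  dense-map d f q l = let r , k , x = d q l in r , k , f r (≤-trans k l) x

  dense-return : {p : C} {D : C → Set (suc ℓ)} → (∀ q → q ≤ p → D q) → Dense p D
  dense-return f q l = q , ≤-refl , f q l

  dense? : {p : C} (D : C → Set (suc ℓ)) → Dense p (λ q → D q ⊎ (∀ r → r ≤ q → ¬ D r))
  dense? D q l with em {Σ[ r ∈ C ] (r ≤ q × D r)}
  ... | yes (r , k , x) = r , k , inj₁ x
  ... | no h = q , ≤-refl , inj₂ λ r k x → h (r , k , x)

  dense-absurd : {p : C} {D : C → Set (suc ℓ)} → Dense p D → (∀ q → q ≤ p → ¬ D q) → ⊥₀
  dense-absurd d f = let r , k , x = d _ ≤-refl in f r k x

  private
    raw-mono : ∀ σ τ {p q} → q ≤ p → forces-≈ σ τ p → forces-≈ σ τ q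
    raw-mono (mk I σ s) (mk J τ t) l (f , g) =
      (λ i r k → f i r (≤-trans k l)) , (λ j r k → g j r (≤-trans k l))

    raw-refl : ∀ σ p → forces-≈ σ σ p
    raw-refl (mk I σ s) p =
      (λ i q l k r h → r , ≤-refl , i , ≤-trans h k , raw-refl (σ i) r) ,
      (λ i q l k r h → r , ≤-refl , i , ≤-trans h k , raw-refl (σ i) r)

    raw-sym : ∀ σ τ p → forces-≈ σ τ p → forces-≈ τ σ p
    raw-sym (mk I σ s) (mk J τ t) p (f , g) =
      (λ j q l k r h → let r′ , h′ , i , k′ , e = g j q l k r h in r′ , h′ , i , k′ , raw-sym _ _ _ e) ,
      (λ i q l k r h → let r′ , h′ , j , k′ , e = f i q l k r h in r′ , h′ , j , k′ , raw-sym _ _ _ e)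

    raw-trans : ∀ σ τ ρ p → forces-≈ σ τ p → forces-≈ τ ρ p → forces-≈ σ ρ p
    raw-trans (mk I σ s) (mk J τ t) (mk K ρ u) p (f , g) (f′ , g′) =
      (λ i q l k r h →
        let r₁ , h₁ , j , k₁ , e₁ = f i q l k r h
            r₂ , h₂ , m , k₂ , e₂ = f′ j r₁ (≤-trans h₁ (≤-trans h l)) k₁ r₁ ≤-refl
        in r₂ , ≤-trans h₂ h₁ , m , k₂ , raw-trans _ _ _ _ (raw-mono _ _ h₂ e₁) e₂) ,
      (λ m q l k r h →
        let r₁ , h₁ , j , k₁ , e₁ = g′ m q l k r h
            r₂ , h₂ , i , k₂ , e₂ = g j r₁ (≤-trans h₁ (≤-trans h l)) k₁ r₁ ≤-refl
        in r₂ , ≤-trans h₂ h₁ , i , k₂ , raw-trans _ _ _ _ e₂ (raw-mono _ _ h₂ e₁))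

  infix 3 _⊩_≐_ _⊩_ε_

  -- `forces-≈` unfolds by recursion on names, which hides them from unification; the wrapper keeps
  -- them visible as parameters.
  record _⊩_≐_ (p : C) (σ τ : Name) : Set (suc ℓ) where
    constructor mk≐
    field un≐ : forces-≈ σ τ p
  open _⊩_≐_ public

  record _⊩_ε_ (p : C) (σ τ : Name) : Set (suc ℓ) where
    constructor mkε
    field unε : forces-∈ σ τ p
  open _⊩_ε_ public

  private variable
    p q r : C
    σ τ ρ σ′ τ′ υ f : Name
    x y a b : V ℓ

  ≐-mono : q ≤ p → p ⊩ σ ≐ τ → q ⊩ σ ≐ τ
  ≐-mono l (mk≐ e) = mk≐ (raw-mono _ _ l e)

  ≐-refl : p ⊩ σ ≐ σ
  ≐-refl = mk≐ (raw-refl _ _)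

  ≐-sym : p ⊩ σ ≐ τ → p ⊩ τ ≐ σ
  ≐-sym (mk≐ e) = mk≐ (raw-sym _ _ _ e)

  ≐-trans : p ⊩ σ ≐ τ → p ⊩ τ ≐ ρ → p ⊩ σ ≐ ρ
  ≐-trans (mk≐ e) (mk≐ e′) = mk≐ (raw-trans _ _ _ _ e e′)

  ≐-local : Dense p (λ q → q ⊩ σ ≐ τ) → p ⊩ σ ≐ τ
  ≐-local {σ = mk I σ s} {τ = mk J τ t} d = mk≐
    ( (λ i q l k r h → let r₁ , h₁ , e = d r (≤-trans h l)
                           r₂ , h₂ , x = proj₁ (un≐ e) i r₁ ≤-refl (≤-trans h₁ (≤-trans h k)) r₁ ≤-refl
                       in r₂ , ≤-trans h₂ h₁ , x)
    , (λ j q l k r h → let r₁ , h₁ , e = d r (≤-trans h l)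
                           r₂ , h₂ , x = proj₂ (un≐ e) j r₁ ≤-refl (≤-trans h₁ (≤-trans h k)) r₁ ≤-refl
                       in r₂ , ≤-trans h₂ h₁ , x))

  ε-elim : p ⊩ σ ε τ → Dense p (λ q → Σ[ j ∈ Ix τ ] (q ≤ tag τ j × q ⊩ σ ≐ el τ j))
  ε-elim {τ = mk J τ t} (mkε d) q l = let r , k , j , k′ , e = d q l in r , k , j , k′ , mk≐ e

  ε-intro : Dense p (λ q → Σ[ j ∈ Ix τ ] (q ≤ tag τ j × q ⊩ σ ≐ el τ j)) → p ⊩ σ ε τ
  ε-intro {τ = mk J τ t} d = mkε λ q l → let r , k , j , k′ , e = d q l in r , k , j , k′ , un≐ e

  el-ε : (τ : Name) (j : Ix τ) → p ≤ tag τ j → p ⊩ el τ j ε τ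
  el-ε τ j l = ε-intro (dense-return λ q k → j , ≤-trans k l , ≐-refl)

  ε-mono : q ≤ p → p ⊩ σ ε τ → q ⊩ σ ε τ
  ε-mono l m = ε-intro (dense-mono l (ε-elim m))

  ε-local : Dense p (λ q → q ⊩ σ ε τ) → p ⊩ σ ε τ
  ε-local d = ε-intro (dense-bind d λ q l m → ε-elim m)

  ε-resp-≐ˡ : p ⊩ σ ≐ σ′ → p ⊩ σ ε τ → p ⊩ σ′ ε τ
  ε-resp-≐ˡ e m = ε-intro (dense-map (ε-elim m) λ q l (j , k , e′) → j , k , ≐-trans (≐-sym (≐-mono l e)) e′)

  ε-resp-≐ʳ : p ⊩ τ ≐ τ′ → p ⊩ σ ε τ → p ⊩ σ ε τ′
  ε-resp-≐ʳ {τ = mk J τ t} {τ′ = mk J′ τ′ t′} (mk≐ e) m = ε-intro (dense-bind (ε-elim m)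
    λ q l (j , k , e′) r h → let r′ , h′ , j′ , k′ , e″ = proj₁ e j q l k r h in
      r′ , h′ , j′ , k′ , ≐-trans (≐-mono (≤-trans h′ h) e′) (mk≐ e″))

  name-ext : (∀ {ρ q} → q ≤ p → q ⊩ ρ ε σ → q ⊩ ρ ε τ) → (∀ {ρ q} → q ≤ p → q ⊩ ρ ε τ → q ⊩ ρ ε σ) →
    p ⊩ σ ≐ τ
  name-ext {σ = σ@(mk I _ _)} {τ = τ@(mk J _ _)} f g = mk≐
    ( (λ i q l k r h → let s , h′ , j , k′ , e = ε-elim (f l (el-ε σ i k)) r h in s , h′ , j , k′ , un≐ e)
    , (λ j q l k r h → let s , h′ , i , k′ , e = ε-elim (g l (el-ε τ j k)) r h in s , h′ , i , k′ , un≐ (≐-sym e)))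

  no-3-cycleᴺ : (σ : Name) {τ ρ : Name} {p : C} → p ⊩ σ ε τ → p ⊩ τ ε ρ → p ⊩ ρ ε σ → ⊥₀
  no-3-cycleᴺ σ@(mk I f s) l m n = let q , k , i , k′ , e = ε-elim n _ ≤-refl in
    no-3-cycleᴺ (f i) (el-ε σ i k′) (ε-mono k l) (ε-resp-≐ʳ e (ε-mono k m))

  no-2-cycleᴺ : (σ : Name) {τ : Name} {p : C} → p ⊩ σ ε τ → p ⊩ τ ε σ → ⊥₀
  no-2-cycleᴺ σ@(mk I f s) l n = let q , k , i , k′ , e = ε-elim n _ ≤-refl in
    no-2-cycleᴺ (f i) (el-ε σ i k′) (ε-resp-≐ʳ e (ε-mono k l))

  check : V ℓ → Name
  check (sup A f) = mk A (check ∘ f) (λ _ → 𝟙)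

  check-elem : (a : V ℓ) (i : Index a) → p ⊩ check (elem a i) ε check a
  check-elem (sup A f) i = el-ε (check (sup A f)) i ≤-𝟙

  check-ε⁻ : (a : V ℓ) → p ⊩ σ ε check a → Dense p (λ q → Σ[ i ∈ Index a ] q ⊩ σ ≐ check (elem a i))
  check-ε⁻ (sup A f) m = dense-map (ε-elim m) λ q l (j , _ , e) → j , e

  check-≈ : x ≈ y → p ⊩ check x ≐ check y
  check-≈ {x} {y} (mk≈ e) = go x y e
    where
    go : ∀ x y → x Defs.≈ y → p ⊩ check x ≐ check y
    go (sup A f) (sup B g) (h , k) = mk≐
      ( (λ i q l _ r _ → r , ≤-refl , proj₁ (h i) , ≤-𝟙 , un≐ (go _ _ (proj₂ (h i))))
      , (λ j q l _ r _ → r , ≤-refl , proj₁ (k j) , ≤-𝟙 , un≐ (go _ _ (proj₂ (k j)))))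

  check-∈ : x ∈ y → p ⊩ check x ε check y
  check-∈ {y = y} (i at e) = ε-resp-≐ˡ (≐-sym (check-≈ e)) (check-elem y i)

  -- Every tag of a canonical name is `𝟙`, so the indices produced by density are already witnesses
  -- in V, whatever condition they are found at.
  check-≈⁻ : p ⊩ check x ≐ check y → x ≈ y
  check-≈⁻ {p} {x} {y} e = mk≈ (go x y p (un≐ e))
    where
    go : ∀ x y p → forces-≈ (check x) (check y) p → x Defs.≈ y
    go (sup A f) (sup B g) p (h , k) =
      (λ i → let _ , _ , j , _ , e = h i p ≤-refl ≤-𝟙 p ≤-refl in j , go (f i) (g j) _ e) ,
      (λ j → let _ , _ , i , _ , e = k j p ≤-refl ≤-𝟙 p ≤-refl in i , go (f i) (g j) _ e)

  check-∈⁻ : p ⊩ check x ε check y → x ∈ y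
  check-∈⁻ {y = y} m = let _ , _ , i , e = check-ε⁻ y m _ ≤-refl in i at check-≈⁻ e

  upairᴺ : Name → Name → Name
  upairᴺ σ τ = mk (Lift ℓ Bool) (λ b → if lower b then σ else τ) (λ _ → 𝟙)

  upairᴺ⁻ : p ⊩ ρ ε upairᴺ σ τ → Dense p (λ q → (q ⊩ ρ ≐ σ) ⊎ (q ⊩ ρ ≐ τ))
  upairᴺ⁻ m = dense-map (ε-elim m) λ { q l (lift true , _ , e) → inj₁ e ; q l (lift false , _ , e) → inj₂ e }

  upairᴺˡ : p ⊩ ρ ≐ σ → p ⊩ ρ ε upairᴺ σ τ
  upairᴺˡ e = ε-intro (dense-return λ q l → lift true , ≤-𝟙 , ≐-mono l e)

  upairᴺʳ : p ⊩ ρ ≐ τ → p ⊩ ρ ε upairᴺ σ τ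
  upairᴺʳ e = ε-intro (dense-return λ q l → lift false , ≤-𝟙 , ≐-mono l e)

  upairᴺ-cong : p ⊩ σ ≐ σ′ → p ⊩ τ ≐ τ′ → p ⊩ upairᴺ σ τ ≐ upairᴺ σ′ τ′
  upairᴺ-cong d e = name-ext
    (λ l m → ε-local (dense-map (upairᴺ⁻ m) λ { q k (inj₁ e′) → upairᴺˡ (≐-trans e′ (≐-mono (≤-trans k l) d))
                                             ; q k (inj₂ e′) → upairᴺʳ (≐-trans e′ (≐-mono (≤-trans k l) e)) }))
    (λ l m → ε-local (dense-map (upairᴺ⁻ m) λ { q k (inj₁ e′) → upairᴺˡ (≐-trans e′ (≐-sym (≐-mono (≤-trans k l) d)))
                                             ; q k (inj₂ e′) → upairᴺʳ (≐-trans e′ (≐-sym (≐-mono (≤-trans k l) e))) }))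

  opairᴺ : Name → Name → Name
  opairᴺ σ τ = upairᴺ (upairᴺ σ σ) (upairᴺ σ τ)

  opairᴺ-cong : p ⊩ σ ≐ σ′ → p ⊩ τ ≐ τ′ → p ⊩ opairᴺ σ τ ≐ opairᴺ σ′ τ′
  opairᴺ-cong d e = upairᴺ-cong (upairᴺ-cong d d) (upairᴺ-cong d e)

  private
    fst-≐ : p ⊩ opairᴺ σ τ ≐ opairᴺ σ′ τ′ → p ⊩ σ ≐ σ′
    fst-≐ {σ = σ} {τ} {σ′} {τ′} e = ≐-local
      (dense-bind (upairᴺ⁻ (ε-resp-≐ʳ (≐-sym e) (upairᴺˡ {σ = upairᴺ σ′ σ′} {τ = upairᴺ σ′ τ′} ≐-refl))) λ
        { q l (inj₁ s) → dense-map (upairᴺ⁻ (ε-resp-≐ʳ s (upairᴺˡ {σ = σ′} {τ = σ′} ≐-refl))) λ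
            { r k (inj₁ e) → ≐-sym e ; r k (inj₂ e) → ≐-sym e }
        ; q l (inj₂ s) → dense-map (upairᴺ⁻ (ε-resp-≐ʳ (≐-sym s) (upairᴺˡ {σ = σ} {τ = τ} ≐-refl))) λ
            { r k (inj₁ e) → e ; r k (inj₂ e) → e } })

    snd-≐ : p ⊩ opairᴺ σ τ ≐ opairᴺ σ′ τ′ → Dense p (λ q → (q ⊩ τ ≐ σ′) ⊎ (q ⊩ τ ≐ τ′))
    snd-≐ {σ = σ} {τ} {σ′} {τ′} e =
      dense-bind (upairᴺ⁻ (ε-resp-≐ʳ e (upairᴺʳ {τ = upairᴺ σ τ} {σ = upairᴺ σ σ} ≐-refl))) λ
        { q l (inj₁ s) → dense-map (upairᴺ⁻ (ε-resp-≐ʳ s (upairᴺʳ {τ = τ} {σ = σ} ≐-refl))) λ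
            { r k (inj₁ e) → inj₁ e ; r k (inj₂ e) → inj₁ e }
        ; q l (inj₂ s) → upairᴺ⁻ (ε-resp-≐ʳ s (upairᴺʳ {τ = τ} {σ = σ} ≐-refl)) }

  opairᴺ-injective : p ⊩ opairᴺ σ τ ≐ opairᴺ σ′ τ′ → (p ⊩ σ ≐ σ′) × (p ⊩ τ ≐ τ′)
  opairᴺ-injective e = fst-≐ e , ≐-local (dense-bind (snd-≐ e) λ
    { q l (inj₂ d) → dense-return λ r k → ≐-mono k d
    ; q l (inj₁ d) → dense-map (snd-≐ (≐-sym (≐-mono l e))) λ
      { r k (inj₂ d′) → ≐-sym d′
      ; r k (inj₁ d′) → ≐-trans (≐-mono k d) (≐-trans (≐-sym (≐-mono (≤-trans k l) (fst-≐ e))) (≐-sym d′)) } })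

  upair⇒ᴺ : F.IsUPair υ σ τ p → p ⊩ υ ≐ upairᴺ σ τ
  upair⇒ᴺ h = name-ext
    (λ l m → ε-local (dense-map (proj₁ (h _) _ l (unε m)) λ
      { q k (inj₁ e) → upairᴺˡ (mk≐ e) ; q k (inj₂ e) → upairᴺʳ (mk≐ e) }))
    (λ l m → mkε (proj₂ (h _) _ l (dense-map (upairᴺ⁻ m) λ
      { q k (inj₁ e) → inj₁ (un≐ e) ; q k (inj₂ e) → inj₂ (un≐ e) })))

  ⇒upairᴺ : p ⊩ υ ≐ upairᴺ σ τ → F.IsUPair υ σ τ p
  ⇒upairᴺ e ρ =
    (λ q l m → dense-map (upairᴺ⁻ (ε-resp-≐ʳ (≐-mono l e) (mkε {τ = _} m))) λ
      { q k (inj₁ e) → inj₁ (un≐ e) ; q k (inj₂ e) → inj₂ (un≐ e) }) ,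
    (λ q l d → unε (ε-resp-≐ʳ (≐-sym (≐-mono l e)) (ε-local (dense-map d λ
      { q k (inj₁ e) → upairᴺˡ (mk≐ e) ; q k (inj₂ e) → upairᴺʳ (mk≐ e) }))))

  opair⇒ᴺ : F.IsOPair υ σ τ p → p ⊩ υ ≐ opairᴺ σ τ
  opair⇒ᴺ h = ≐-local (dense-bind h λ q l (s , h′) → dense-map h′ λ r k (t , hs , ht , hu) →
    ≐-trans (upair⇒ᴺ hu) (upairᴺ-cong (upair⇒ᴺ hs) (upair⇒ᴺ ht)))

  ⇒opairᴺ : p ⊩ υ ≐ opairᴺ σ τ → F.IsOPair υ σ τ p
  ⇒opairᴺ e = dense-return λ q l → _ , dense-return λ r k → _ ,
    ⇒upairᴺ ≐-refl , ⇒upairᴺ ≐-refl , ⇒upairᴺ (≐-mono (≤-trans k l) e)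

  maps⇒ᴺ : F.Maps f σ τ p → p ⊩ opairᴺ σ τ ε f
  maps⇒ᴺ h = ε-local (dense-map h λ q l (u , m , o) → ε-resp-≐ˡ (opair⇒ᴺ o) (mkε m))

  ⇒mapsᴺ : p ⊩ opairᴺ σ τ ε f → F.Maps f σ τ p
  ⇒mapsᴺ m = dense-return λ q l → _ , unε (ε-mono l m) , ⇒opairᴺ ≐-refl

-- Injections in the extension between subsets of a set of V.

module Injections {ℓ : Level} (em : ExcludedMiddle (suc ℓ))
  {C : Set ℓ} (_≤_ : C → C → Set (suc ℓ)) (≤-refl : ∀ {p} → p ≤ p)
  (≤-trans : ∀ {p q r} → p ≤ q → q ≤ r → p ≤ r) (𝟙 : C) (≤-𝟙 : ∀ {p} → p ≤ 𝟙) where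
  open Sets {ℓ}
  open Classical em
  open Extension em _≤_ ≤-refl ≤-trans 𝟙 ≤-𝟙
  open CantorBernstein em _≤_ ≤-refl ≤-trans using (KInjection; KBijection; cantor-bernstein)

  private variable
    p q r : C
    σ τ ρ : Name
    x y a b : V ℓ

  Class : Set (suc (suc ℓ))
  Class = Name → C → Set (suc ℓ)

  -- Each pair is tagged with every condition at which `R` holds, so the name denotes the union of
  -- `R` over the generic filter.
  relName : V ℓ → V ℓ → (V ℓ → V ℓ → C → Set (suc ℓ)) → Name
  relName a b R = mk (Σ[ i ∈ Index a ] Σ[ j ∈ Index b ] Σ[ c ∈ C ] Small (R (elem a i) (elem b j) c))
    (λ (i , j , _) → opairᴺ (check (elem a i)) (check (elem b j))) (λ (_ , _ , c , _) → c)

  module Relation (a b : V ℓ) (R : V ℓ → V ℓ → C → Set (suc ℓ))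
    (mono : ∀ {x y p q} → q ≤ p → R x y p → R x y q)
    (resp : ∀ {x x′ y y′ p} → x ≈ x′ → y ≈ y′ → R x y p → R x′ y′ p) where

    rel : Name
    rel = relName a b R

    rel-maps : x ∈ a → y ∈ b → R x y p → F.Maps rel (check x) (check y) p
    rel-maps (i at e) (j at e′) h = ⇒mapsᴺ (ε-intro (dense-return λ q l →
      (i , j , _ , small (resp e e′ h)) , l , opairᴺ-cong (check-≈ e) (check-≈ e′)))

    rel-maps⁻ : F.Maps rel σ τ p → Dense p (λ q →
      ∃[ x ] ∃[ y ] x ∈ a × y ∈ b × (q ⊩ σ ≐ check x) × (q ⊩ τ ≐ check y) × R x y q)
    rel-maps⁻ m = dense-map (ε-elim (maps⇒ᴺ m)) λ q l ((i , j , c , s) , k , e) →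
      let e₁ , e₂ = opairᴺ-injective e in
      _ , _ , elem∈ a i , elem∈ b j , e₁ , e₂ , mono k (unsmall s)

    rel-isPartialFun : {A B : Class} →
      (∀ {x y y′ q} → q ≤ p → R x y q → R x y′ q → y ≈ y′) →
      (∀ {x y q} → q ≤ p → x ∈ a → y ∈ b → R x y q → A (check x) q × B (check y) q) →
      F.IsPartialFun rel A B p
    rel-isPartialFun func into =
      (λ u q l m → dense-map (ε-elim (mkε {τ = rel} m)) λ r k ((i , j , c , s) , k′ , e) →
        let c₁ , c₂ = into (≤-trans k l) (elem∈ a i) (elem∈ b j) (mono k′ (unsmall s)) in
        _ , dense-return λ r′ h →
          let c₁ , c₂ = into (≤-trans h (≤-trans k l)) (elem∈ a i) (elem∈ b j) (mono (≤-trans h k′) (unsmall s))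
          in _ , c₁ , c₂ , ⇒opairᴺ (≐-mono h e)) ,
      (λ σ τ τ′ q l m q′ l′ m′ → un≐ (≐-local (dense-bind (rel-maps⁻ m′) λ
        r k (x , y , _ , _ , e₁ , e₂ , h) → dense-map (rel-maps⁻ (dense-mono (≤-trans k l′) m)) λ
        s k′ (x′ , y′ , _ , _ , e₁′ , e₂′ , h′) →
          ≐-trans e₂′ (≐-trans (check-≈ (func (≤-trans k′ (≤-trans k (≤-trans l′ l)))
             (resp (check-≈⁻ (≐-trans (≐-sym e₁′) (≐-mono k′ e₁))) ≈-refl h′) (mono k′ h)))
            (≐-sym (≐-mono k′ e₂))))))

    rel-isFun : {A B : Class} →
      (∀ {x y y′ q} → q ≤ p → R x y q → R x y′ q → y ≈ y′) →
      (∀ {x y q} → q ≤ p → x ∈ a → y ∈ b → R x y q → A (check x) q × B (check y) q) →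
      (∀ {σ q} → q ≤ p → A σ q → Dense q (λ r → ∃[ x ] ∃[ y ] x ∈ a × y ∈ b × (r ⊩ σ ≐ check x) × R x y r)) →
      F.IsFun rel A B p
    rel-isFun {A = A} {B = B} func into tot = rel-isPartialFun {A = A} {B = B} func into ,
      λ σ q l d → dense-map (tot l d) λ r k (x , y , m , n , e , h) →
        check y , dense-map (rel-maps m n h) λ s k′ (u , m′ , o) →
          u , m′ , ⇒opairᴺ (≐-trans (opair⇒ᴺ o) (opairᴺ-cong (≐-sym (≐-mono k′ e)) ≐-refl))

  -- A forced injection D → Z between subsets of X̌; R x y p stands for p ⊩ f(x̌) = y̌.
  record Inj (X : V ℓ) (D Z : Name) (p₀ : C) : Set (suc (suc ℓ)) where
    field
      R      : V ℓ → V ℓ → C → Set (suc ℓ)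
      R-mono : ∀ {x y p q} → q ≤ p → R x y p → R x y q
      R-resp : ∀ {x x′ y y′ p} → x ≈ x′ → y ≈ y′ → R x y p → R x′ y′ p
      R-dom  : ∀ {x y p} → p ≤ p₀ → x ∈ X → R x y p → p ⊩ check x ε D
      R-cod  : ∀ {x y p} → p ≤ p₀ → y ∈ X → R x y p → p ⊩ check y ε Z
      R-func : ∀ {x y y′ p} → p ≤ p₀ → R x y p → R x y′ p → y ≈ y′
      R-inj  : ∀ {x x′ y p} → p ≤ p₀ → R x y p → R x′ y p → x ≈ x′
      R-tot  : ∀ {x p} → p ≤ p₀ → x ∈ X → p ⊩ check x ε D → Dense p (λ q → ∃[ y ] y ∈ X × R x y q)
      D⊆     : ∀ {σ p} → p ≤ p₀ → p ⊩ σ ε D → p ⊩ σ ε check X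

  module _ {X : V ℓ} {D Z : Name} {p₀ : C} (I : Inj X D Z p₀) where
    open Inj I
    private open module Rel = Relation X X R R-mono R-resp

    isInjection : ∀ {q} → q ≤ p₀ → F.IsInjection rel D Z q
    isInjection l₀ = rel-isFun
        (λ l → R-func (≤-trans l l₀))
        (λ l m n h → unε (R-dom (≤-trans l l₀) m h) , unε (R-cod (≤-trans l l₀) n h))
        (λ l d → dense-bind (check-ε⁻ X (D⊆ (≤-trans l l₀) (mkε d))) λ r k (i , e) →
          dense-map (R-tot (≤-trans k (≤-trans l l₀)) (elem∈ X i) (ε-resp-≐ˡ e (ε-mono k (mkε d)))) λ s k′ (y , n , h) →
          _ , y , elem∈ X i , n , ≐-mono k′ e , h) ,
      (λ σ σ′ τ q l m q′ l′ m′ → un≐ (≐-local (dense-bind (rel-maps⁻ m′) λ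
        r k (x , y , _ , _ , e₁ , e₂ , h) → dense-map (rel-maps⁻ (dense-mono (≤-trans k l′) m)) λ
        s k′ (x′ , y′ , _ , _ , e₁′ , e₂′ , h′) →
          ≐-trans e₁′ (≐-trans (check-≈ (R-inj (≤-trans k′ (≤-trans k (≤-trans l′ (≤-trans l l₀))))
             (R-resp ≈-refl (check-≈⁻ (≐-trans (≐-sym e₂′) (≐-mono k′ e₂))) h′) (R-mono k′ h)))
            (≐-sym (≐-mono k′ e₁))))))

    inj⇒≼ : F._≼_ D Z p₀
    inj⇒≼ q l = q , ≤-refl , rel , isInjection l

    inj⇒≃ : (∀ {y p} → p ≤ p₀ → y ∈ X → p ⊩ check y ε Z → Dense p (λ q → ∃[ x ] x ∈ X × R x y q)) →
      (∀ {σ p} → p ≤ p₀ → p ⊩ σ ε Z → p ⊩ σ ε check X) → F._≃_ D Z p₀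
    inj⇒≃ onto Z⊆ q l = q , ≤-refl , rel , isInjection l ,
      λ τ s k m → dense-bind (check-ε⁻ X (Z⊆ (≤-trans k l) (mkε m))) λ t k₁ (j , e) →
        dense-map (onto (≤-trans k₁ (≤-trans k l)) (elem∈ X j) (ε-resp-≐ˡ e (ε-mono k₁ (mkε m)))) λ u k₂ (x , d , h) →
        check x , unε (R-dom (≤-trans k₂ (≤-trans k₁ (≤-trans k l))) d h) ,
        ⇒mapsᴺ (ε-resp-≐ˡ (opairᴺ-cong ≐-refl (≐-sym (≐-mono k₂ e))) (maps⇒ᴺ (rel-maps d (elem∈ X j) h)))

  -- Since Z is forced to be a subset of X̌, each value of f is densely the canonical name of an
  -- element of V, so f is determined by a relation on V.
  injection⇒inj : ∀ {X f Z p₀} → F.IsInjection f (check X) Z p₀ →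
    (∀ {σ p} → p ≤ p₀ → p ⊩ σ ε Z → p ⊩ σ ε check X) → Inj X (check X) Z p₀
  injection⇒inj {X} {f} {Z} {p₀} (((pf , ff) , tot) , inj) Z⊆ = record
    { R = λ x y p → x ∈ X × F.Maps f (check x) (check y) p
    ; R-mono = λ l (d , m) → d , dense-mono l m
    ; R-resp = λ e e′ (d , m) → ∈-resp-≈ˡ e d , ⇒mapsᴺ (ε-resp-≐ˡ (opairᴺ-cong (check-≈ e) (check-≈ e′)) (maps⇒ᴺ m))
    ; R-dom = λ _ d _ → check-∈ d
    ; R-cod = λ l _ (_ , m) → cod l m
    ; R-func = λ l (_ , m) (_ , m′) → check-≈⁻ (mk≐ (ff _ _ _ _ l m _ ≤-refl m′))
    ; R-inj = λ l (_ , m) (_ , m′) → check-≈⁻ (mk≐ (inj _ _ _ _ l m _ ≤-refl m′))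
    ; R-tot = λ l d m → dense-bind (tot _ _ l (unε m)) λ q k (τ , h) →
        dense-map (check-ε⁻ X (Z⊆ (≤-trans k l) (cod (≤-trans k l) h))) λ r k′ (j , e) →
        _ , elem∈ X j , d , ⇒mapsᴺ (ε-resp-≐ˡ (opairᴺ-cong ≐-refl e) (maps⇒ᴺ (dense-mono k′ h)))
    ; D⊆ = λ _ → id }
    where
    cod : ∀ {σ τ q} → q ≤ p₀ → F.Maps f σ τ q → q ⊩ τ ε Z
    cod l m = ε-local (dense-bind m λ r k (u , n , o) →
      dense-bind (pf u r (≤-trans k l) n) λ s k₁ (x′ , h) → dense-map h λ t k₂ (y′ , _ , yz , o′) →
      let e = ≐-trans (≐-sym (opair⇒ᴺ o′)) (opair⇒ᴺ (dense-mono (≤-trans k₂ k₁) o)) in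
      ε-resp-≐ˡ (proj₂ (opairᴺ-injective e)) (mkε yz))

  ≼⇒inj : ∀ {X Z p} → F._≼_ (check X) Z p →
    (∀ {σ q} → q ≤ p → q ⊩ σ ε Z → q ⊩ σ ε check X) →
    ∀ q → q ≤ p → Σ[ r ∈ C ] (r ≤ q × Inj X (check X) Z r)
  ≼⇒inj h Z⊆ q l = let r , k , f , i = h q l in
    r , k , injection⇒inj i (λ k′ → Z⊆ (≤-trans k′ (≤-trans k l)))

  module _ {X : V ℓ} {Z : Name} {p₀ : C} (I : Inj X (check X) Z p₀)
    (Z⊆ : ∀ {σ p} → p ≤ p₀ → p ⊩ σ ε Z → p ⊩ σ ε check X) where
    private
      open module I = Inj I
      B : V ℓ → C → Set (suc ℓ)
      B y p = p ⊩ check y ε Z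
      K : KInjection X B p₀
      K = record
        { R = λ x y p → x ∈ X × y ∈ X × I.R x y p
        ; R-mono = λ l (d , n , h) → d , n , I.R-mono l h
        ; R-resp = λ e e′ (d , n , h) → ∈-resp-≈ˡ e d , ∈-resp-≈ˡ e′ n , I.R-resp e e′ h
        ; R-into = λ l (d , n , h) → n , dense-return λ q k → ε-mono k (I.R-cod l n h)
        ; R-func = λ l (_ , _ , h) (_ , _ , h′) → I.R-func l h h′
        ; R-inj = λ l (_ , _ , h) (_ , _ , h′) → I.R-inj l h h′
        ; R-tot = λ l d → dense-map (I.R-tot l d (check-∈ d)) λ _ _ (y , n , h) → y , d , n , h }
      open KBijection (cantor-bernstein K ε-mono (λ e → ε-resp-≐ˡ (check-≈ e)))
        renaming (R to H; R-mono to H-mono; R-resp to H-resp;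
          R-func to H-func; R-inj to H-inj; R-tot to H-tot; R-into to H-into)

    -- Cantor-Bernstein inside the extension, for a target contained in a domain that comes from V.
    -- The bijections needed for A, for ℵ₁ and for ℵ₂ are all of this kind; `D` is another name for
    -- the domain.
    ≼-subset⇒≃ : ∀ {D} → (∀ {σ p} → p ≤ p₀ → p ⊩ σ ε D → p ⊩ σ ε check X) →
      (∀ {σ p} → p ≤ p₀ → p ⊩ σ ε check X → p ⊩ σ ε D) → F._≃_ D Z p₀ × F._≃_ Z D p₀
    ≼-subset⇒≃ {D} D⊆ ⊆D =
      inj⇒≃ (record
        { R = H ; R-mono = H-mono ; R-resp = H-resp
        ; R-dom = λ l d h → ⊆D l (check-∈ d)
        ; R-cod = λ l d h → ε-local (proj₂ (H-into l h))
        ; R-func = H-func ; R-inj = H-inj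
        ; R-tot = λ l d _ → dense-map (H-tot l d) λ q k (y , h) → y , proj₁ (H-into (≤-trans k l) h) , h
        ; D⊆ = D⊆ }) (λ l n b → onto l n b) Z⊆ ,
      inj⇒≃ (record
        { R = λ x y → H y x ; R-mono = H-mono ; R-resp = λ e e′ → H-resp e′ e
        ; R-dom = λ l d h → ε-local (proj₂ (H-into l h))
        ; R-cod = λ l d h → ⊆D l (check-∈ d)
        ; R-func = H-inj ; R-inj = H-func
        ; R-tot = λ l d b → onto l d b
        ; D⊆ = Z⊆ }) (λ l d _ → dense-map (H-tot l d) λ q k (y , h) → y , proj₁ (H-into (≤-trans k l) h) , h) D⊆

-- Ordinals and ω in the extension.

module Ordinals {ℓ : Level} (em : ExcludedMiddle (suc ℓ))
  {C : Set ℓ} (_≤_ : C → C → Set (suc ℓ)) (≤-refl : ∀ {p} → p ≤ p)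
  (≤-trans : ∀ {p q r} → p ≤ q → q ≤ r → p ≤ r) (𝟙 : C) (≤-𝟙 : ∀ {p} → p ≤ 𝟙) where
  open Sets {ℓ}
  open Classical em
  open Extension em _≤_ ≤-refl ≤-trans 𝟙 ≤-𝟙

  private variable
    p q r : C
    σ τ ρ : Name
    x y a b : V ℓ

  Tri : Name → Name → C → Set (suc ℓ)
  Tri σ τ p = (p ⊩ σ ε τ) ⊎ (p ⊩ σ ≐ τ) ⊎ (p ⊩ τ ε σ)

  record Ordᴺ (p : C) (σ : Name) : Set (suc ℓ) where
    field
      tr  : ∀ {q τ ρ} → q ≤ p → q ⊩ ρ ε τ → q ⊩ τ ε σ → q ⊩ ρ ε σ
      lin : ∀ {q τ ρ} → q ≤ p → q ⊩ τ ε σ → q ⊩ ρ ε σ → Dense q (Tri τ ρ)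
  open Ordᴺ public

  ordᴺ-mono : q ≤ p → Ordᴺ p σ → Ordᴺ q σ
  ordᴺ-mono l o = record { tr = λ k → tr o (≤-trans k l) ; lin = λ k → lin o (≤-trans k l) }

  ordinal⇒ᴺ : F.IsOrdinal σ p → Ordᴺ p σ
  ordinal⇒ᴺ (t , l) = record
    { tr = λ k m n → mkε (t _ _ k (unε n) _ _ ≤-refl (unε m))
    ; lin = λ k m n → dense-bind (l _ _ k (unε m) _ _ ≤-refl (unε n)) λ
        { q h (inj₁ e) → dense-return λ r h′ → inj₁ (ε-mono h′ (mkε e))
        ; q h (inj₂ d) → dense-map d λ { _ _ (inj₁ e) → inj₂ (inj₁ (mk≐ e)) ; _ _ (inj₂ e) → inj₂ (inj₂ (mkε e)) } } }

  ⇒ordinalᴺ : Ordᴺ p σ → F.IsOrdinal σ p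
  ⇒ordinalᴺ o =
    (λ τ q k n ρ r k′ m → unε (tr o (≤-trans k′ k) (mkε m) (ε-mono k′ (mkε n)))) ,
    (λ τ q k n ρ r k′ m → dense-map (lin o (≤-trans k′ k) (ε-mono k′ (mkε n)) (mkε m)) λ
       { _ _ (inj₁ e) → inj₁ (unε e)
       ; _ _ (inj₂ (inj₁ e)) → inj₂ (dense-return λ s h → inj₁ (un≐ (≐-mono h e)))
       ; _ _ (inj₂ (inj₂ e)) → inj₂ (dense-return λ s h → inj₂ (unε (ε-mono h e))) })

  ordᴺ-ε : Ordᴺ p σ → p ⊩ τ ε σ → Ordᴺ p τ
  ordᴺ-ε {τ = τ} o m = record
    { tr = λ k n n′ → ε-local (dense-bind (lin o k (tr o k n (tr o k n′ (ε-mono k m))) (ε-mono k m)) λ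
        { _ h (inj₁ e) → dense-return λ _ h′ → ε-mono h′ e
        ; _ h (inj₂ (inj₁ e)) → ⊥₀-elim (no-2-cycleᴺ τ (ε-resp-≐ˡ e (ε-mono h n)) (ε-mono h n′))
        ; _ h (inj₂ (inj₂ e)) → ⊥₀-elim (no-3-cycleᴺ τ e (ε-mono h n) (ε-mono h n′)) })
    ; lin = λ k n n′ → lin o k (tr o k n (ε-mono k m)) (tr o k n′ (ε-mono k m)) }

  -- The double induction used in V, on names, with every case distinction replaced by passing to a
  -- dense set on which it is decided.
  trichotomyᴺ : Ordᴺ p σ → Ordᴺ p τ → Dense p (Tri σ τ)
  trichotomyᴺ {p} {σ} {τ} o o′ = go σ τ p o o′
    where
    Above Above′ : Name → Name → C → Set (suc ℓ)
    Above σ τ q = Σ[ i ∈ Ix σ ] (q ≤ tag σ i × ((q ⊩ el σ i ≐ τ) ⊎ (q ⊩ τ ε el σ i)))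
    Above′ σ τ q = Σ[ j ∈ Ix τ ] (q ≤ tag τ j × ((q ⊩ σ ≐ el τ j) ⊎ (q ⊩ σ ε el τ j)))

    step : ∀ σ τ p → Ordᴺ p σ → Ordᴺ p τ →
      (∀ i q → q ≤ p → q ≤ tag σ i → Dense q (Tri (el σ i) τ)) →
      (∀ j q → q ≤ p → q ≤ tag τ j → Dense q (Tri σ (el τ j))) → Dense p (Tri σ τ)
    step σ τ p o o′ f g = dense-bind (dense? (Above σ τ)) λ
      { q l (inj₁ (i , k , inj₁ e)) → dense-return λ r h → inj₂ (inj₂ (ε-mono h (ε-resp-≐ˡ e (el-ε σ i k))))
      ; q l (inj₁ (i , k , inj₂ m)) → dense-return λ r h → inj₂ (inj₂ (ε-mono h (tr o l m (el-ε σ i k))))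
      ; q l (inj₂ no₁) → dense-bind (dense? (Above′ σ τ)) λ
        { r k (inj₁ (j , k′ , inj₁ e)) → dense-return λ s h → inj₁ (ε-mono h (ε-resp-≐ˡ (≐-sym e) (el-ε τ j k′)))
        ; r k (inj₁ (j , k′ , inj₂ m)) → dense-return λ s h → inj₁ (ε-mono h (tr o′ (≤-trans k l) m (el-ε τ j k′)))
        ; r k (inj₂ no₂) → dense-return λ s h → inj₂ (inj₁ (name-ext
            (λ {ρ} {t} h₁ m → ε-local (dense-bind (ε-elim m) λ t h₂ (i , k₁ , e) →
               let k₂ = ≤-trans h₂ (≤-trans h₁ (≤-trans h k)) in
               dense-map (f i t (≤-trans k₂ l) k₁) λ
                { u h₃ (inj₁ n) → ε-resp-≐ˡ (≐-sym (≐-mono h₃ e)) n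
                ; u h₃ (inj₂ n) → ⊥₀-elim (no₁ u (≤-trans h₃ k₂) (i , ≤-trans h₃ k₁ , n)) }))
            (λ {ρ} {t} h₁ m → ε-local (dense-bind (ε-elim m) λ t h₂ (j , k₁ , e) →
               let k₂ = ≤-trans h₂ (≤-trans h₁ h) in
               dense-map (g j t (≤-trans k₂ (≤-trans k l)) k₁) λ
                { u h₃ (inj₂ (inj₂ n)) → ε-resp-≐ˡ (≐-sym (≐-mono h₃ e)) n
                ; u h₃ (inj₁ n) → ⊥₀-elim (no₂ u (≤-trans h₃ k₂) (j , ≤-trans h₃ k₁ , inj₂ n))
                ; u h₃ (inj₂ (inj₁ n)) → ⊥₀-elim (no₂ u (≤-trans h₃ k₂) (j , ≤-trans h₃ k₁ , inj₁ n)) })))) } }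

    go : ∀ σ τ p → Ordᴺ p σ → Ordᴺ p τ → Dense p (Tri σ τ)
    go (mk I f s) (mk J g t) p o o′ = step (mk I f s) (mk J g t) p o o′
      (λ i q l k → go (f i) (mk J g t) q (ordᴺ-ε (ordᴺ-mono l o) (el-ε (mk I f s) i k)) (ordᴺ-mono l o′))
      (λ j q l k → go (mk I f s) (g j) q (ordᴺ-mono l o) (ordᴺ-ε (ordᴺ-mono l o′) (el-ε (mk J g t) j k)))

  check-ord : Ord x → Ordᴺ p (check x)
  check-ord {x} (t , l) = record
    { tr = λ {q} {τ} {ρ} _ m n → ε-local (dense-bind (check-ε⁻ x n) λ r k (i , e) →
        dense-map (check-ε⁻ (elem x i) (ε-resp-≐ʳ e (ε-mono k m))) λ s k′ (j , e′) →
        ε-resp-≐ˡ (≐-sym e′) (check-∈ (t (elem∈ (elem x i) j) (elem∈ x i))))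
    ; lin = λ _ m n → dense-bind (check-ε⁻ x m) λ r k (i , e) →
        dense-map (check-ε⁻ x (ε-mono k n)) λ s k′ (j , e′) →
        case l (elem∈ x i) (elem∈ x j) of λ
          { (inj₁ h) → inj₁ (ε-resp-≐ˡ (≐-sym (≐-mono k′ e)) (ε-resp-≐ʳ (≐-sym e′) (check-∈ h)))
          ; (inj₂ (inj₁ h)) → inj₂ (inj₁ (≐-trans (≐-mono k′ e) (≐-trans (check-≈ h) (≐-sym e′))))
          ; (inj₂ (inj₂ h)) → inj₂ (inj₂ (ε-resp-≐ˡ (≐-sym e′) (ε-resp-≐ʳ (≐-sym (≐-mono k′ e)) (check-∈ h)))) } }

  -- The union of the successors of the ranks of all named members. Tags are ignored, so it bounds
  -- the rank of every interpretation of the name.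
  rank : Name → V ℓ
  rank (mk I f s) = sup (Σ[ i ∈ I ] Index (succ (rank (f i)))) (λ (i , j) → elem (succ (rank (f i))) j)

  succ-ord : Ord x → Ord (succ x)
  succ-ord {x} (t , l) = tr′ , λ m n → lin′ (∈succ⁻ m) (∈succ⁻ n)
    where
    tr′ : ∀ {y z} → z ∈ y → y ∈ succ x → z ∈ succ x
    tr′ m n with ∈succ⁻ n
    ... | inj₁ n′ = ∈succˡ (t m n′)
    ... | inj₂ e  = ∈succˡ (∈-resp-≈ʳ e m)
    lin′ : ∀ {y z} → y ∈ x ⊎ y ≈ x → z ∈ x ⊎ z ≈ x → y ∈ z ⊎ y ≈ z ⊎ z ∈ y
    lin′ (inj₁ m) (inj₁ n) = l m n
    lin′ (inj₁ m) (inj₂ e) = inj₁ (∈-resp-≈ʳ (≈-sym e) m)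
    lin′ (inj₂ e) (inj₁ n) = inj₂ (inj₂ (∈-resp-≈ʳ (≈-sym e) n))
    lin′ (inj₂ e) (inj₂ d) = inj₂ (inj₁ (≈-trans e (≈-sym d)))

  rank-ord : ∀ σ → Ord (rank σ)
  rank-ord (mk I f s) =
    (λ { m ((i , j) at e) → let k at d = proj₁ (o i) m (j at e) in (i , k) at d }) ,
    (λ { ((i , j) at e) ((i′ , j′) at e′) → trichotomy (ord-∈ (o i) (j at e)) (ord-∈ (o i′) (j′ at e′)) })
    where
    o : ∀ i → Ord (succ (rank (f i)))
    o i = succ-ord (rank-ord (f i))

  -- If the rank of σ were a member of σ, it would densely equal some named member `f i`. But the
  -- rank of `f i` belongs to the rank of σ, hence to `f i`, and the argument repeats one level
  -- lower.
  rank-∉ : ∀ σ {p} → p ⊩ check (rank σ) ε σ → ⊥₀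
  rank-∉ (mk I f s) m = let q , l , i , k , e = ε-elim m _ ≤-refl in
    rank-∉ (f i) (ε-resp-≐ʳ e (check-∈ ((i , inj₂ (lift tt)) at ≈-refl)))

  -- Forcing adds no ordinals: compared with its rank, an ordinal of V, the name can only be smaller
  -- or equal.
  ordinal-check : Ordᴺ p σ → Dense p (λ q → ∃[ x ] Ord x × (q ⊩ σ ≐ check x))
  ordinal-check {σ = σ} o = dense-bind (trichotomyᴺ o (check-ord (rank-ord σ))) λ
    { q l (inj₁ m) → dense-map (check-ε⁻ (rank σ) m) λ r k (i , e) → _ , ord-∈ (rank-ord σ) (elem∈ (rank σ) i) , e
    ; q l (inj₂ (inj₁ e)) → dense-return λ r k → _ , rank-ord σ , ≐-mono k e
    ; q l (inj₂ (inj₂ m)) → ⊥₀-elim (rank-∉ σ m) }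

  omega-mono : ∀ {w p q} → q ≤ p → F.IsOmega w p → F.IsOmega w q
  omega-mono l (((t , ln) , ne , lim) , nl) =
    (((λ x r k → t x r (≤-trans k l)) , (λ x r k → ln x r (≤-trans k l))) , dense-mono l ne ,
      (λ x r k → lim x r (≤-trans k l))) , (λ x r k → nl x r (≤-trans k l))

  module Omega {w : Name} {p₀ : C} (hw : F.IsOmega w p₀) where
    private
      o : Ordᴺ p₀ w
      o = ordinal⇒ᴺ (proj₁ (proj₁ hw))

      Top : Name → Name → C → Set (suc ℓ)
      Top σ τ q = (q ⊩ τ ε σ) × (∀ r → r ≤ q → ∀ ρ → r ⊩ ρ ε σ → ¬ (r ⊩ τ ε ρ))

    -- The induction used in V, on names: it is decided densely whether σ is empty and whether it
    -- has a largest element, and a nonempty σ without one would be a limit below ω.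
    ω-numeral : q ≤ p₀ → q ⊩ σ ε w → Dense q (λ r → Σ[ n ∈ ℕ ] (r ⊩ σ ≐ check (num n)))
    ω-numeral {σ = σ} = go σ
      where
      step : ∀ σ {q} → q ≤ p₀ → q ⊩ σ ε w →
        (∀ i r → r ≤ q → r ≤ tag σ i → Dense r (λ s → Σ[ n ∈ ℕ ] (s ⊩ el σ i ≐ check (num n)))) →
        Dense q (λ r → Σ[ n ∈ ℕ ] (r ⊩ σ ≐ check (num n)))
      step σ {q} l m IH = dense-bind (dense? (λ r → ∃[ τ ] r ⊩ τ ε σ)) λ
        { r k (inj₂ h) → dense-return λ s k′ → 0 , name-ext
            (λ k″ n → ⊥₀-elim (h _ (≤-trans k″ k′) (_ , n)))
            (λ k″ n → ⊥₀-elim (dense-absurd (check-ε⁻ (num 0) n) λ { _ _ (() , _) }))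
        ; r k (inj₁ ne) → dense-bind (dense? (λ s → ∃[ τ ] Top σ τ s)) λ
          { s k′ (inj₂ h) → ⊥-elim (proj₂ hw σ s (≤-trans k′ (≤-trans k l)) (unε (ε-mono (≤-trans k′ k) m)) s ≤-refl
              ( ⇒ordinalᴺ (ordᴺ-mono (≤-trans k′ k) oσ)
              , dense-return (λ t h′ → proj₁ ne , unε (ε-mono (≤-trans h′ k′) (proj₂ ne)))
              , λ τ t h₁ n u h₂ → let (v , h₃ , ρ , n′ , n″) = by-contra {Σ[ v ∈ C ] (v ≤ u × (∃[ ρ ] (v ⊩ ρ ε σ) × (v ⊩ τ ε ρ)))}
                                        (λ no → h u (≤-trans h₂ h₁) (τ , ε-mono h₂ (mkε n) ,
                                            λ v h₃ ρ n′ n″ → no (v , h₃ , ρ , n′ , n″)))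
                                   in v , h₃ , ρ , unε n′ , unε n″))
          ; s k′ (inj₁ (τ , n , top)) → dense-bind (ε-elim n) λ t h₁ (i , h₂ , e) →
              let k₁ = ≤-trans h₁ (≤-trans k′ k) in
              dense-map (IH i t k₁ h₂) λ u h₃ (n′ , e′) →
              let k₂ = ≤-trans h₃ k₁
                  e″ = ≐-trans (≐-mono h₃ e) e′
              in 1+ n′ , name-ext
                (λ h₄ n₁ → ε-local (dense-map (lin oσ (≤-trans h₄ k₂) (ε-mono (≤-trans h₄ (≤-trans h₃ h₁)) n) n₁) λ
                  { v h₅ (inj₁ n₂) → ⊥₀-elim (top v (≤-trans h₅ (≤-trans h₄ (≤-trans h₃ h₁))) _ (ε-mono h₅ n₁) n₂)
                  ; v h₅ (inj₂ (inj₁ d)) → ε-resp-≐ˡ (≐-trans (≐-sym (≐-mono (≤-trans h₅ h₄) e″)) d) (check-∈ (∈succʳ ≈-refl))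
                  ; v h₅ (inj₂ (inj₂ n₂)) → ε-local (dense-map
                      (check-ε⁻ (num n′) (ε-resp-≐ʳ (≐-mono (≤-trans h₅ h₄) e″) n₂)) λ
                      _ h₆ (j , d) → ε-resp-≐ˡ (≐-sym d) (check-∈ (∈succˡ (elem∈ (num n′) j)))) }))
                (λ h₄ n₁ → ε-local (dense-map (check-ε⁻ (num (1+ n′)) n₁) λ v h₅ (j , d) →
                  case ∈succ⁻ {x = num n′} (elem∈ (num (1+ n′)) j) of λ
                  { (inj₁ n₂) → ε-resp-≐ˡ (≐-sym d) (tr oσ (≤-trans h₅ (≤-trans h₄ k₂))
                      (ε-resp-≐ʳ (≐-sym (≐-mono (≤-trans h₅ h₄) e″)) (check-∈ n₂))
                      (ε-mono (≤-trans h₅ (≤-trans h₄ (≤-trans h₃ h₁))) n))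
                  ; (inj₂ d′) → ε-resp-≐ˡ (≐-trans (≐-mono (≤-trans h₅ h₄) e″) (≐-trans (≐-sym (check-≈ d′)) (≐-sym d)))
                      (ε-mono (≤-trans h₅ (≤-trans h₄ (≤-trans h₃ h₁))) n) })) } }
        where
        oσ : Ordᴺ q σ
        oσ = ordᴺ-ε (ordᴺ-mono l o) m
      go : ∀ σ {q} → q ≤ p₀ → q ⊩ σ ε w → Dense q (λ r → Σ[ n ∈ ℕ ] (r ⊩ σ ≐ check (num n)))
      go (mk I f s) l m = step (mk I f s) l m λ i r k k′ →
        go (f i) (≤-trans k l) (tr o (≤-trans k l) (el-ε (mk I f s) i k′) (ε-mono k m))

    numeral-ω : q ≤ p₀ → ∀ n → q ⊩ check (num n) ε w
    numeral-ω {q} l n = ε-local (dense-map (above n) λ r k (m , h , e) → tr o (≤-trans k l) (check-∈ (num-< h)) e)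
      where
      Above : ℕ → C → Set (suc ℓ)
      Above n r = Σ[ m ∈ ℕ ] n < m × (r ⊩ check (num m) ε w)
      next : ∀ m r → r ≤ q → r ⊩ check (num m) ε w → Dense r (Above m)
      next m r k h = dense-bind (proj₂ (proj₂ (proj₁ hw)) _ _ (≤-trans k l) (unε h)) λ s k₁ (τ , n , n′) →
        dense-map (ω-numeral (≤-trans k₁ (≤-trans k l)) (mkε n)) λ t k₂ (j , e) →
        j , num-∈⁻ (check-∈⁻ (ε-resp-≐ʳ e (ε-mono k₂ (mkε n′)))) , ε-resp-≐ˡ e (ε-mono k₂ (mkε n))
        where
        num-∈⁻ : ∀ {m n} → num m ∈ num n → m < n
        num-∈⁻ {m} {n} h with num∈⁻ n h
        ... | k , lt , e = subst (_< n) (sym (num-injective m k e)) lt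
      above : ∀ n → Dense q (Above n)
      above zero = dense-bind (dense-mono l (proj₁ (proj₂ (proj₁ hw)))) λ r k (τ , n) →
        dense-bind (ω-numeral (≤-trans k l) (mkε n)) λ s k₁ (m , e) →
        dense-map (next m s (≤-trans k₁ k) (ε-resp-≐ˡ e (ε-mono k₁ (mkε n)))) λ t k₂ (j , lt , h) →
        j , ≤-<-trans z≤n lt , h
      above (1+ n) = dense-bind (above n) λ r k (m , lt , h) → dense-map (next m r k h) λ s k₁ (j , lt′ , h′) →
        j , ≤-<-trans lt lt′ , h′

  check-succ : F.IsSuccessor (check (succ x)) (check x) p
  check-succ {x} ρ =
    (λ q l m → dense-map (check-ε⁻ (succ x) (mkε m)) λ r k (j , e) → case ∈succ⁻ (elem∈ (succ x) j) of λ
      { (inj₁ n) → inj₁ (unε (ε-resp-≐ˡ (≐-sym e) (check-∈ n)))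
      ; (inj₂ d) → inj₂ (un≐ (≐-trans e (check-≈ d))) }) ,
    (λ q l d → unε (ε-local (dense-bind d λ
      { r k (inj₁ m) → dense-map (check-ε⁻ x (mkε m)) λ s k′ (j , e) →
          ε-resp-≐ˡ (≐-sym e) (check-∈ (∈succˡ (elem∈ x j)))
      ; r k (inj₂ e) → dense-return λ s k′ → ε-resp-≐ˡ (≐-sym (≐-mono k′ (mk≐ e))) (check-∈ (∈succʳ ≈-refl)) })))

-- Measures and their almost-everywhere quantifier.

-- A κ-complete ultrafilter on a set whose indices form T (t ~ u if t and u index
-- the same element), pushed to lam by m; AE Φ says that Φ holds almost everywhere.
record Measure {ℓ : Level} (κ lam : V ℓ) : Set (suc (suc ℓ)) where
  open Sets {ℓ}
  infix 4 _~_
  field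
    T        : Set ℓ
    _~_      : T → T → Set (suc ℓ)
    ~-refl   : ∀ {t} → t ~ t
    ~-sym    : ∀ {t u} → t ~ u → u ~ t
    AE       : (T → Set (suc ℓ)) → Set (suc ℓ)
    ae-map   : ∀ {Φ Ψ} → (∀ t → Φ t → Ψ t) → AE Φ → AE Ψ
    ae-⊥     : ¬ AE (λ _ → ⊥)
    ae-ultra : ∀ {Φ} → (∀ {t u} → t ~ u → Φ t → Φ u) → AE Φ ⊎ AE (λ t → ¬ Φ t)
    ae-~     : ∀ {Φ} → AE Φ → AE (λ t → ∀ u → t ~ u → Φ u)
    ae-ℕ     : {Φ : ℕ → T → Set (suc ℓ)} → (∀ n → AE (Φ n)) → AE (λ t → ∀ n → Φ n t)
    ae-κ     : ∀ {α} {Φ : V ℓ → T → Set (suc ℓ)} → α ∈ κ → (∀ {x y t} → x ≈ y → Φ x t → Φ y t) →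
               (∀ x → x ∈ α → AE (Φ x)) → AE (λ t → ∀ x → x ∈ α → Φ x t)
    -- The axiom of choice for the indices of a set: the chosen indices of one element may differ,
    -- but not their values under `g`.
    choose   : (g : T → V ℓ) →
               Σ[ ρ ∈ (T → T) ] (∀ t → t ~ ρ t) × (∀ {t u} → t ~ u → g (ρ t) ≈ g (ρ u))
    m        : T → V ℓ
    m∈       : ∀ t → m t ∈ lam
    m-resp   : ∀ {t u} → t ~ u → m t ≈ m u
    m-large  : ∀ {α} → α ∈ lam → AE (λ t → α ∈ m t)

module AlmostEverywhere {ℓ : Level} (em : ExcludedMiddle (suc ℓ)) {κ lam : V ℓ} (M : Measure κ lam) where
  open Sets {ℓ}
  open Classical em using (by-contra)
  open Measure M

  ae-× : ∀ {Φ Ψ} → AE Φ → AE Ψ → AE (λ t → Φ t × Ψ t)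
  ae-× {Φ} {Ψ} a b = ae-map (λ t h → h 0 , h 1) (ae-ℕ {Φs} λ { zero → a ; (1+ _) → b })
    where
    Φs : ℕ → T → Set (suc ℓ)
    Φs zero   = Φ
    Φs (1+ _) = Ψ

  ae-point : ∀ {Φ} → AE Φ → Σ[ t ∈ T ] Φ t
  ae-point {Φ} a = by-contra λ h → ae-⊥ (ae-map (λ t φ → ⊥₀-elim (h (t , φ))) a)

  ae-const : ∀ {A : Set (suc ℓ)} → A → AE (λ _ → A)
  ae-const {A} a with ae-ultra {λ _ → A} (λ _ x → x)
  ... | inj₁ h = h
  ... | inj₂ h = ⊥₀-elim (ae-⊥ (ae-map (λ _ k → ⊥₀-elim (k a)) h))

  -- If none of the countably many pieces had measure one, each complement would, and by countable
  -- completeness so would their intersection, which misses all the pieces.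
  ae-select : {Φ : ℕ → T → Set (suc ℓ)} → (∀ n {t u} → t ~ u → Φ n t → Φ n u) →
    AE (λ t → Σ[ n ∈ ℕ ] Φ n t) → Σ[ n ∈ ℕ ] AE (Φ n)
  ae-select {Φ} r a = by-contra λ h → ae-⊥ (ae-map (λ t ((n , φ) , k) → ⊥₀-elim (k n φ))
    (ae-× a (ae-ℕ λ n → [ (λ b → ⊥₀-elim (h (n , b))) , id ]′ (ae-ultra (r n)))))

  -- The same with κ-completeness. In effect, a function with values in a fixed α ∈ κ almost
  -- everywhere is constant almost everywhere.
  ae-selectκ : ∀ {α} {Φ : V ℓ → T → Set (suc ℓ)} → α ∈ κ → (∀ {x y t u} → x ≈ y → t ~ u → Φ x t → Φ y u) →
    AE (λ t → ∃[ x ] x ∈ α × Φ x t) → ∃[ x ] x ∈ α × AE (Φ x)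
  ae-selectκ {α} {Φ} d r a = by-contra λ h → ae-⊥ (ae-map (λ t ((x , n , φ) , k) → ⊥₀-elim (k x n φ))
    (ae-× a (ae-κ {Φ = λ x t → ¬ Φ x t} d (λ e k φ → k (r (≈-sym e) ~-refl φ))
      λ x n → [ (λ b → ⊥₀-elim (h (x , n , b))) , id ]′ (ae-ultra (r ≈-refl)))))

-- Conditions of j(P), and the construction of a homogeneous colour.

module Conditions {ℓ : Level} (em : ExcludedMiddle (suc ℓ))
  {C : Set ℓ} (_≤_ : C → C → Set (suc ℓ)) (≤-refl : ∀ {p} → p ≤ p)
  (≤-trans : ∀ {p q r} → p ≤ q → q ≤ r → p ≤ r) (𝟙 : C) (≤-𝟙 : ∀ {p} → p ≤ 𝟙)
  (code : C → V ℓ) (code-≤ : ∀ {p q} → Sets._≈_ (code p) (code q) → p ≤ q)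
  {κ lam : V ℓ} (M : Measure κ lam) where
  open Sets {ℓ}
  open Classical em using (by-contra)
  open Measure M
  open AlmostEverywhere em M public

  Compatible : C → C → Set (suc ℓ)
  Compatible p q = Σ[ r ∈ C ] (r ≤ p × r ≤ q)

  record Cond : Set (suc ℓ) where
    field
      at-t   : T → C
      resp-t : ∀ {t u} → t ~ u → at-t t ≤ at-t u
  open Cond public

  infix 4 _≤*_
  _≤*_ : Cond → Cond → Set (suc ℓ)
  F ≤* G = AE λ t → at-t F t ≤ at-t G t

  ≤*-refl : ∀ {F} → F ≤* F
  ≤*-refl {F} = ae-map (λ _ _ → ≤-refl) (ae-const (lift {ℓ = suc ℓ} tt))

  ≤*-trans : ∀ {F G H} → F ≤* G → G ≤* H → F ≤* H
  ≤*-trans a b = ae-map (λ t (h , k) → ≤-trans h k) (ae-× a b)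

  -- In terms of the ultrapower embedding j, p forces [F] ∈ j(P) into the quotient j(P) / G.
  Stem : C → Cond → Set (suc ℓ)
  Stem p F = ∀ q → q ≤ p → AE λ t → Compatible q (at-t F t)

  stem-mono : ∀ {p q F} → q ≤ p → Stem p F → Stem q F
  stem-mono l s r k = s r (≤-trans k l)

  -- Excluded middle on the Σ-type picks a witness at each index, without regard to `~`.
  -- Precomposing with the `ρ` of `choose` makes the witnesses respect `~`; the witness at t then
  -- comes from ρ t, which is harmless since `R` is invariant under `~`.
  choice : (R : T → C → Set (suc ℓ)) → (∀ {t u c} → t ~ u → R t c → R u c) →
    AE (λ t → Σ[ c ∈ C ] R t c) → Σ[ F ∈ Cond ] AE (λ t → R t (at-t F t))
  choice R r a = record { at-t = pick ∘ ρ ; resp-t = λ e → code-≤ (ρ-resp e) } ,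
    ae-map (λ t h → r (~-sym (ρ~ t)) (pick-R (ρ t) (h (ρ t) (ρ~ t)))) (ae-~ a)
    where
    pick : T → C
    pick t with em {Σ[ c ∈ C ] R t c}
    ... | yes (c , _) = c
    ... | no _ = 𝟙
    pick-R : ∀ t → Σ[ c ∈ C ] R t c → R t (pick t)
    pick-R t h with em {Σ[ c ∈ C ] R t c}
    ... | yes (_ , x) = x
    ... | no k = ⊥₀-elim (k h)
    ρ = proj₁ (choose (code ∘ pick))
    ρ~ = proj₁ (proj₂ (choose (code ∘ pick)))
    ρ-resp : ∀ {t u} → t ~ u → code (pick (ρ t)) ≈ code (pick (ρ u))
    ρ-resp = proj₂ (proj₂ (choose (code ∘ pick)))

  module Meets
    (meet : ∀ {p q} → Compatible p q → Σ[ r ∈ C ] (r ≤ p × r ≤ q × (∀ {s} → s ≤ p → s ≤ q → s ≤ r)))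
    (glb : (f : ℕ → C) → (∀ n → f (1+ n) ≤ f n) → Σ[ g ∈ C ] ((∀ n → g ≤ f n) × (∀ {s} → (∀ n → s ≤ f n) → s ≤ g)))
    where

    -- F(t) is replaced by its meet with q. That the meet is the greatest lower bound keeps q a
    -- stem: a common extension of some r ≤ q and F(t) lies below the meet.
    restrict : ∀ {p q F} → Stem p F → q ≤ p →
      Σ[ G ∈ Cond ] G ≤* F × AE (λ t → at-t G t ≤ q) × Stem q G
    restrict {p} {q} {F} s l = G , ae-map (λ t h → proj₁ (proj₂ h)) a , ae-map (λ t → proj₁) a ,
      λ r k → ae-map (λ t ((x , h , h′) , _ , _ , g) → x , h , g (≤-trans h k) h′) (ae-× (s r (≤-trans k l)) a)
      where
      R : T → C → Set (suc ℓ)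
      R t c = c ≤ q × c ≤ at-t F t × (∀ {d} → d ≤ q → d ≤ at-t F t → d ≤ c)
      ch = choice R (λ e (h , h′ , g) → h , ≤-trans h′ (resp-t F e) , λ k k′ → g k (≤-trans k′ (resp-t F (~-sym e))))
             (ae-map (λ t → meet) (s q l))
      G = proj₁ ch
      a = proj₂ ch

    -- G(t) is the greatest lower bound of the F_n(t). For the stem, the greatest meets of q with
    -- the F_n(t) form a decreasing sequence, and its bound lies below both q and G(t).
    limit : (Fs : ℕ → Cond) → (∀ n → Fs (1+ n) ≤* Fs n) → ∀ p → (∀ n → Stem p (Fs n)) →
      Σ[ G ∈ Cond ] (∀ n → G ≤* Fs n) × Stem p G
    limit Fs dec p st = G , (λ n → ae-map (λ t h → proj₁ h n) a) ,
      λ q l → ae-map (λ t ((cs , ds) , _ , g) → comp q t cs ds g) (ae-× (ae-× (ae-ℕ λ n → st n q l) (ae-ℕ dec)) a)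
      where
      R : T → C → Set (suc ℓ)
      R t c = (∀ n → c ≤ at-t (Fs n) t) × (∀ {d} → (∀ n → d ≤ at-t (Fs n) t) → d ≤ c)
      ch = choice R (λ e (h , g) → (λ n → ≤-trans (h n) (resp-t (Fs n) e)) ,
                                   (λ k → g λ n → ≤-trans (k n) (resp-t (Fs n) (~-sym e))))
             (ae-map (λ t d → glb (λ n → at-t (Fs n) t) d) (ae-ℕ dec))
      G = proj₁ ch
      a = proj₂ ch
      comp : ∀ q t → (∀ n → Compatible q (at-t (Fs n) t)) → (∀ n → at-t (Fs (1+ n)) t ≤ at-t (Fs n) t) →
        (∀ {d} → (∀ n → d ≤ at-t (Fs n) t) → d ≤ at-t G t) → Compatible q (at-t G t)
      comp q t cs ds g = let b , bl , _ = glb (λ n → proj₁ (meet (cs n))) (λ n →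
                                 let _ , _ , _ , h = meet (cs n) ; _ , k , k′ , _ = meet (cs (1+ n)) in h k (≤-trans k′ (ds n)))
                         in b , ≤-trans (bl 0) (proj₁ (proj₂ (meet (cs 0)))) ,
                            g (λ n → ≤-trans (bl n) (proj₁ (proj₂ (proj₂ (meet (cs n))))))

    module Colouring (stem : ∀ F → Σ[ p ∈ C ] Stem p F) (p₀ : C)
      (Col : V ℓ → V ℓ → ℕ → C → Set (suc ℓ))
      (col-mono : ∀ {α β n p q} → q ≤ p → Col α β n p → Col α β n q)
      (col-resp : ∀ {α α′ β β′ n p} → α ≈ α′ → β ≈ β′ → Col α β n p → Col α′ β′ n p)
      (col-tot : ∀ {α β p} → p ≤ p₀ → α ∈ lam → β ∈ lam → α ∈ β → Σ[ r ∈ C ] (r ≤ p × Σ[ n ∈ ℕ ] Col α β n r))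
      where

      Dec* : Cond → V ℓ → ℕ → Set (suc ℓ)
      Dec* F α n = AE λ t → Col α (m t) n (at-t F t)

      dec-mono : ∀ {F G α n} → G ≤* F → Dec* F α n → Dec* G α n
      dec-mono a b = ae-map (λ t (l , c) → col-mono l c) (ae-× a b)

      dec-resp : ∀ {F α β n} → α ≈ β → Dec* F α n → Dec* F β n
      dec-resp e = ae-map λ t → col-resp e ≈-refl

      -- F is strengthened pointwise until each F(t) decides the colour of δ and m t; there are
      -- countably many colours, so almost all t agree on one.
      decide : ∀ {p F δ} → p ≤ p₀ → Stem p F → δ ∈ lam →
        Σ[ n ∈ ℕ ] Σ[ q ∈ C ] Σ[ G ∈ Cond ] (q ≤ p × Stem q G × G ≤* F × Dec* G δ n)
      decide {p} {F} {δ} l s d = proj₁ sel , r , G , k , stem-mono {F = G} k′ sG ,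
        ≤*-trans {G} {F₁} {F} (ae-map (λ _ → proj₁) aG) F₁≤ , proj₂ sel
        where
        res = restrict {F = F} s ≤-refl
        F₁ = proj₁ res
        F₁≤ = proj₁ (proj₂ res)
        R : T → C → Set (suc ℓ)
        R t c = c ≤ at-t F₁ t × Σ[ n ∈ ℕ ] Col δ (m t) n c
        ch = choice R (λ e (h , n , c) → ≤-trans h (resp-t F₁ e) , n , col-resp ≈-refl (m-resp e) c)
          (ae-map (λ t (h , d′) → col-tot (≤-trans h l) d (m∈ t) d′) (ae-× (proj₁ (proj₂ (proj₂ res))) (m-large d)))
        G = proj₁ ch
        aG = proj₂ ch
        sel = ae-select {λ n t → Col δ (m t) n (at-t G t)}
          (λ n e c → col-mono (resp-t G (~-sym e)) (col-resp ≈-refl (m-resp e) c)) (ae-map (λ _ → proj₂) aG)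
        -- A stem of G need not lie below p. But it is compatible with almost every G(t), and after
        -- the restriction of F almost every G(t) is below p, so some extension of the stem is below
        -- p as well.
        pG = proj₁ (stem G)
        sG = proj₂ (stem G)
        pt = ae-point (ae-× (sG pG ≤-refl) (ae-× aG (proj₁ (proj₂ (proj₂ res)))))
        r = proj₁ (proj₁ (proj₂ pt))
        k′ : r ≤ pG
        k′ = proj₁ (proj₂ (proj₁ (proj₂ pt)))
        k : r ≤ p
        k = ≤-trans (proj₂ (proj₂ (proj₁ (proj₂ pt)))) (≤-trans (proj₁ (proj₁ (proj₂ (proj₂ pt)))) (proj₂ (proj₂ (proj₂ pt))))

      -- The vertex m t can still be put into A, by a condition below p and F(t). Being below F(t)
      -- matters: the colours that F decides at t then hold when m t enters A.
      record Good (n : ℕ) (p : C) (F : Cond) (t : T) : Set (suc ℓ) where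
        constructor mkGood
        field
          {r q} : C
          {G}   : Cond
          r≤p   : r ≤ p
          r≤Ft  : r ≤ at-t F t
          q≤r   : q ≤ r
          stemG : Stem q G
          G≤F   : G ≤* F
          decG  : Dec* G (m t) n

      good-resp : ∀ {n p F t u} → t ~ u → Good n p F t → Good n p F u
      good-resp {F = F} e (mkGood {G = G} l k h s b d) =
        mkGood {G = G} l (≤-trans k (resp-t F e)) h s b (dec-resp {G} (m-resp e) d)

      -- `G₁` and `G₂` share the stem `q` but may be incompatible with each other.
      record Both (n : ℕ) (p : C) (F₁ F₂ : Cond) (δ : V ℓ) : Set (suc ℓ) where
        constructor mkBoth
        field
          {q}     : C
          {G₁ G₂} : Cond
          q≤p     : q ≤ p
          stem₁   : Stem q G₁
          stem₂   : Stem q G₂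
          G₁≤     : G₁ ≤* F₁
          G₂≤     : G₂ ≤* F₂
          dec₁    : Dec* G₁ δ n
          dec₂    : Dec* G₂ δ n

      -- `both` supplies the midpoint δ of a path and `good` the common neighbours.
      -- Non-negligibility is enough in `both`: intersected with the measure-one set of `m-large` it
      -- yields such δ beyond any bound.
      record Homogeneous : Set (suc ℓ) where
        field
          col  : ℕ
          p    : C
          F    : Cond
          p≤   : p ≤ p₀
          st   : Stem p F
          both : ∀ {q F₁ F₂} → q ≤ p → Stem q F₁ → Stem q F₂ → F₁ ≤* F → F₂ ≤* F →
                 ¬ AE (λ t → ¬ Both col q F₁ F₂ (m t))
          good : ∀ {q G} → q ≤ p → Stem q G → G ≤* F → AE (Good col q G)

      record State : Set (suc ℓ) where
        constructor state
        field
          cnd : C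
          fun : Cond
          c≤  : cnd ≤ p₀
          stm : Stem cnd fun
      open State

      Bad : ℕ → State → Set (suc ℓ)
      Bad n s = AE λ t → ¬ Good n (cnd s) (fun s) t

      infix 4 _⊑_
      _⊑_ : State → State → Set (suc ℓ)
      s ⊑ s′ = cnd s ≤ cnd s′ × fun s ≤* fun s′

      good-mono : ∀ {n s s′ t} → s ⊑ s′ → at-t (fun s) t ≤ at-t (fun s′) t → Good n (cnd s) (fun s) t → Good n (cnd s′) (fun s′) t
      good-mono {s = s} {s′} (l , b) k (mkGood {G = G} h h′ h″ sG bG d) =
        mkGood {G = G} (≤-trans h l) (≤-trans h′ k) h″ sG (≤*-trans {G} {fun s} {fun s′} bG b) d

      bad-mono : ∀ {n s s′} → s ⊑ s′ → Bad n s′ → Bad n s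
      bad-mono {s = s} {s′} le b = ae-map (λ t (h , k) g → h (good-mono {s = s} {s′} le k g)) (ae-× b (proj₂ le))

      -- At step n, colour n is made bad if that is at all possible; if it is not, no later
      -- strengthening can do it either. Badness is inherited by strengthenings, so the limit of the
      -- steps settles every colour.
      module Settle (s₀ : State) where
        step : ℕ → State → State
        step n s with em {Σ[ s′ ∈ State ] (s′ ⊑ s × Bad n s′)}
        ... | yes (s′ , _) = s′
        ... | no _ = s

        step-⊑ : ∀ n s → step n s ⊑ s
        step-⊑ n s with em {Σ[ s′ ∈ State ] (s′ ⊑ s × Bad n s′)}
        ... | yes (s′ , le , _) = le
        ... | no _ = ≤-refl , ≤*-refl {fun s}

        step-bad : ∀ n s {s′} → s′ ⊑ step n s → Bad n s′ → Bad n (step n s)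
        step-bad n s {s′} le b with em {Σ[ s′ ∈ State ] (s′ ⊑ s × Bad n s′)}
        ... | yes (_ , _ , b′) = b′
        ... | no h = ⊥₀-elim (h (s′ , le , b))

        seq : ℕ → State
        seq zero   = s₀
        seq (1+ n) = step n (seq n)

        c∞ = glb (cnd ∘ seq) (λ n → proj₁ (step-⊑ n (seq n)))
        lim = limit (fun ∘ seq) (λ n → proj₂ (step-⊑ n (seq n))) (proj₁ c∞)
                (λ n → stem-mono {F = fun (seq n)} (proj₁ (proj₂ c∞) n) (stm (seq n)))

        settled : State
        settled = state (proj₁ c∞) (proj₁ lim) (≤-trans (proj₁ (proj₂ c∞) 0) (c≤ s₀)) (proj₂ (proj₂ lim))

        settled-⊑ : ∀ n → settled ⊑ seq n
        settled-⊑ n = proj₁ (proj₂ c∞) n , proj₁ (proj₂ lim) n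

        settled-spec : ∀ n → Bad n settled ⊎ (∀ s → s ⊑ settled → AE (Good n (cnd s) (fun s)))
        settled-spec n with em {Bad n (seq (1+ n))}
        ... | yes b = inj₁ (bad-mono {s = settled} {seq (1+ n)} (settled-⊑ (1+ n)) b)
        ... | no ¬b = inj₂ λ s le → [ id , (λ b → ⊥₀-elim (¬b (step-bad n (seq n) {s}
                (≤-trans (proj₁ le) (proj₁ (settled-⊑ (1+ n))) ,
                 ≤*-trans {fun s} {fun settled} {fun (seq (1+ n))} (proj₂ le) (proj₂ (settled-⊑ (1+ n)))) b))) ]′
              (ae-ultra (good-resp {n} {cnd s} {fun s}))

      module Tree (S : State)
        (spec : ∀ n → Bad n S ⊎ (∀ s → s ⊑ S → AE (Good n (cnd s) (fun s)))) (none : ¬ Homogeneous) where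

        Node : ℕ → Set
        Node zero   = ⊤
        Node (1+ n) = Node n × Bool

        ae-node : ∀ n {Φ : Node n → T → Set (suc ℓ)} → (∀ v → AE (Φ v)) → AE (λ t → ∀ v → Φ v t)
        ae-node zero   h = ae-map (λ _ x _ → x) (h tt)
        ae-node (1+ n) {Φ} h = ae-map (λ { t (a , b) (v , false) → a v ; t (a , b) (v , true) → b v })
          (ae-× (ae-node n λ v → h (v , false)) (ae-node n λ v → h (v , true)))

        Split : ℕ → C → Cond → Cond → Set (suc ℓ)
        Split n q F₁ F₂ = AE λ t → ¬ Bad n S → ¬ Both n q F₁ F₂ (m t)

        split-mono : ∀ {n q r F₁ F₂} → r ≤ q → Split n q F₁ F₂ → Split n r F₁ F₂
        split-mono l = ae-map λ { t h b (mkBoth {G₁ = G₁} {G₂} k s₁ s₂ b₁ b₂ d₁ d₂) →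
            h b (mkBoth {G₁ = G₁} {G₂} (≤-trans k l) s₁ s₂ b₁ b₂ d₁ d₂) }

        -- If no extension split at n, then q, F and n would form a `Homogeneous`. For a bad colour
        -- both children are F and the requirement is vacuous.
        split : ∀ n {q F} → q ≤ cnd S → Stem q F → F ≤* fun S →
          Σ[ r ∈ C ] Σ[ G ∈ (Bool → Cond) ] (r ≤ q × (∀ b → Stem r (G b)) × (∀ b → G b ≤* F) × Split n r (G false) (G true))
        split n {q} {F} l s b with em {Bad n S}
        ... | yes bad = q , (λ _ → F) , ≤-refl , (λ _ → s) , (λ _ → ≤*-refl {F}) ,
              ae-map (λ t _ ¬bad → ⊥₀-elim (¬bad bad)) (ae-const (lift {ℓ = suc ℓ} tt))
        ... | no ¬bad = by-contra λ h → none (record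
              { col = n ; p = q ; F = F ; p≤ = ≤-trans l (c≤ S) ; st = s
              ; both = λ {r} {F₁} {F₂} k s₁ s₂ b₁ b₂ a → h (r , (λ { false → F₁ ; true → F₂ }) , k ,
                  (λ { false → s₁ ; true → s₂ }) , (λ { false → b₁ ; true → b₂ }) , ae-map (λ t h′ _ → h′) a)
              ; good = λ {r} {G} k sG bG → [ (λ bad → ⊥₀-elim (¬bad bad)) ,
                  (λ g → g (state r G (≤-trans k (≤-trans l (c≤ S))) sG) (≤-trans k l , ≤*-trans {G} {F} {fun S} bG b)) ]′ (spec n) })

        record SplitAll (n k : ℕ) (q : C) (G : Node k → Cond) : Set (suc ℓ) where
          field
            r     : C
            H     : Node k × Bool → Cond
            r≤q   : r ≤ q
            H-stm : ∀ v → Stem r (H v)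
            H≤    : ∀ v b → H (v , b) ≤* G v
            H-spl : ∀ v → Split n r (H (v , false)) (H (v , true))

        -- The nodes of height k are split one after the other, each time extending the same
        -- condition of P; stems and earlier splittings survive these extensions, so in the end one
        -- `r` is a stem of all the children.
        splitAll : ∀ n k {q} (G : Node k → Cond) → q ≤ cnd S → (∀ v → Stem q (G v)) → (∀ v → G v ≤* fun S) →
          SplitAll n k q G
        splitAll n zero G l s b =
          let r , H , k , sH , bH , sp = split n {F = G tt} l (s tt) (b tt)
          in record { r = r ; H = H ∘ proj₂ ; r≤q = k ; H-stm = sH ∘ proj₂ ; H≤ = λ _ → bH ; H-spl = λ _ → sp }
        splitAll n (1+ k) {q} G l s b = record
          { r = A₂.r ; H = H ; r≤q = ≤-trans A₂.r≤q A₁.r≤q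
          ; H-stm = λ { ((v , false) , c) → stem-mono {F = A₁.H (v , c)} A₂.r≤q (A₁.H-stm (v , c))
                      ; ((v , true) , c) → A₂.H-stm (v , c) }
          ; H≤ = λ { (v , false) c → A₁.H≤ v c ; (v , true) c → A₂.H≤ v c }
          ; H-spl = λ { (v , false) → split-mono {F₁ = A₁.H (v , false)} {A₁.H (v , true)} A₂.r≤q (A₁.H-spl v)
                      ; (v , true) → A₂.H-spl v } }
          where
          module A₁ = SplitAll (splitAll n k (λ v → G (v , false)) l (λ v → s (v , false)) (λ v → b (v , false)))
          module A₂ = SplitAll (splitAll n k (λ v → G (v , true)) (≤-trans A₁.r≤q l)
                (λ v → stem-mono {F = G (v , true)} A₁.r≤q (s (v , true))) (λ v → b (v , true)))
          H : Node (1+ k) × Bool → Cond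
          H ((v , false) , c) = A₁.H (v , c)
          H ((v , true) , c)  = A₂.H (v , c)

        record Stage (n : ℕ) : Set (suc ℓ) where
          field
            root : C
            at-v : Node n → Cond
            r≤   : root ≤ cnd S
            stms : ∀ v → Stem root (at-v v)
            blw  : ∀ v → at-v v ≤* fun S
        open Stage

        splitStage : ∀ {n} (L : Stage n) → SplitAll n n (root L) (at-v L)
        splitStage {n} L = splitAll n n (at-v L) (r≤ L) (stms L) (blw L)

        nextStage : ∀ {n} (L : Stage n) → SplitAll n n (root L) (at-v L) → Stage (1+ n)
        nextStage L A = record
          { root = r ; at-v = H ; r≤ = ≤-trans r≤q (r≤ L) ; stms = H-stm
          ; blw = λ (v , c) → ≤*-trans {H (v , c)} {at-v L v} {fun S} (H≤ v c) (blw L v) }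
          where open SplitAll A

        lev : ∀ n → Stage n
        lev zero   = record { root = cnd S ; at-v = λ _ → fun S ; r≤ = ≤-refl ; stms = λ _ → stm S ; blw = λ _ → ≤*-refl {fun S} }
        lev (1+ n) = nextStage (lev n) (splitStage (lev n))

        root-dec : ∀ n → root (lev (1+ n)) ≤ root (lev n)
        root-dec n = SplitAll.r≤q (splitStage (lev n))

        at-v-dec : ∀ n v b → at-v (lev (1+ n)) (v , b) ≤* at-v (lev n) v
        at-v-dec n = SplitAll.H≤ (splitStage (lev n))

        at-v-split : ∀ n v → Split n (root (lev (1+ n))) (at-v (lev (1+ n)) (v , false)) (at-v (lev (1+ n)) (v , true))
        at-v-split n = SplitAll.H-spl (splitStage (lev n))

        root∞ = glb (root ∘ lev) root-dec

        NotBad : T → Set (suc ℓ)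
        NotBad t = ∀ n → Bad n S → ¬ Good n (cnd S) (fun S) t

        ae-notBad : AE NotBad
        ae-notBad = ae-ℕ λ n → case em {Bad n S} of λ
          { (yes b) → ae-map (λ t h _ → h) b
          ; (no ¬b) → ae-map (λ t _ b → ⊥₀-elim (¬b b)) (ae-const (lift {ℓ = suc ℓ} tt)) }

        -- The branch is chosen so that the vertex m t can no longer receive colour n after step n.
        module Branch (t : T) (sp : ∀ n v → ¬ Bad n S → ¬ Both n (root (lev (1+ n)))
              (at-v (lev (1+ n)) (v , false)) (at-v (lev (1+ n)) (v , true)) (m t))
            (nb : NotBad t) (cp : Compatible (proj₁ root∞) (at-t (fun S) t)) where

          -- If colour n can be decided for m t below the left child, the condition is extended to a
          -- stem of such a decision and the branch turns right: deciding n there too would complete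
          -- a `Both`. Otherwise the branch goes left, where n cannot be decided.
          Takes : ∀ n → C → Node n → Set (suc ℓ)
          Takes n q v = Σ[ r ∈ C ] Σ[ G ∈ Cond ] (r ≤ q × Stem r G × G ≤* at-v (lev (1+ n)) (v , false) × Dec* G (m t) n)

          go : ∀ n → C → Node n → C × Bool
          go n q v with em {Takes n q v}
          ... | yes (r , _) = r , true
          ... | no _ = q , false

          go-≤ : ∀ n q v → proj₁ (go n q v) ≤ q
          go-≤ n q v with em {Takes n q v}
          ... | yes (_ , _ , l , _) = l
          ... | no _ = ≤-refl

          go-avoids : ∀ n q v {r G} → ¬ Bad n S → r ≤ proj₁ (go n q v) → r ≤ root (lev (1+ n)) → Stem r G →
            G ≤* at-v (lev (1+ n)) (v , proj₂ (go n q v)) → Dec* G (m t) n → ⊥₀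
          go-avoids n q v {r} {G} ¬b l l′ s b d with em {Takes n q v}
          ... | yes (r′ , G′ , _ , s′ , b′ , d′) = sp n v ¬b (mkBoth {G₁ = G′} {G} l′ (stem-mono {F = G′} l s′) s b′ b d′ d)
          ... | no h = h (r , G , l , s , b , d)

          br : ∀ n → C × Node n
          -- Starting below all the roots keeps the conditions of the branch stems at every level;
          -- starting below the value of `fun S` at t is what a refutation of `NotBad` requires.
          br zero   = proj₁ cp , tt
          br (1+ n) = let q , v = br n ; r , b = go n q v in r , v , b

          q∞ = glb (proj₁ ∘ br) (λ n → go-≤ n (proj₁ (br n)) (proj₂ (br n)))

          q∞≤root : ∀ n → proj₁ q∞ ≤ root (lev n)
          q∞≤root n = ≤-trans (proj₁ (proj₂ q∞) 0) (≤-trans (proj₁ (proj₂ cp)) (proj₁ (proj₂ root∞) n))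

          Fs : ℕ → Cond
          Fs n = at-v (lev n) (proj₂ (br n))

          lim = limit Fs (λ n → at-v-dec n _ _) (proj₁ q∞)
                  (λ n → stem-mono {F = Fs n} (q∞≤root n) (stms (lev n) (proj₂ (br n))))

          refute : ∀ n q G → q ≤ proj₁ q∞ → Stem q G → G ≤* proj₁ lim → Dec* G (m t) n → Dec (Bad n S) → ⊥₀
          refute n q G l s b d (yes bad) = nb n bad (mkGood {G = G} (q∞≤root 0)
            (≤-trans (proj₁ (proj₂ q∞) 0) (proj₂ (proj₂ cp))) l s
            (≤*-trans {G} {proj₁ lim} {fun S} b (proj₁ (proj₂ lim) 0)) d)
          refute n q G l s b d (no ¬bad) = go-avoids n _ (proj₂ (br n)) {G = G} ¬bad
            (≤-trans l (proj₁ (proj₂ q∞) (1+ n))) (≤-trans l (q∞≤root (1+ n))) s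
            (≤*-trans {G} {proj₁ lim} {Fs (1+ n)} b (proj₁ (proj₂ lim) (1+ n))) d

          -- Below the limit of the branch `decide` still finds a colour n for the vertex m t. A bad
          -- n is excluded by `NotBad`, any other n by the turn taken at step n.
          absurd : ⊥₀
          absurd =
            let n , q , G , l , s , b , d = decide {F = proj₁ lim} (≤-trans (q∞≤root 0) (c≤ S)) (proj₂ (proj₂ lim)) (m∈ t)
            in refute n q G l s b d em

        contradiction : ⊥₀
        contradiction =
          -- A single t meets all the requirements, since the tree has countably many nodes.
          let t , sp , nb , cp = ae-point (ae-× (ae-ℕ λ n → ae-node n (at-v-split n))
                (ae-× ae-notBad (stm S (proj₁ root∞) (proj₁ (proj₂ root∞) 0))))
          in Branch.absurd t sp nb cp

      homogeneous : Homogeneous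
      homogeneous = by-contra λ h → Tree.contradiction settled settled-spec h
        where
        top : Cond
        top = record { at-t = λ _ → 𝟙 ; resp-t = λ _ → ≤-refl }
        open Settle (state p₀ top ≤-refl (λ q l → ae-map (λ t _ → q , ≤-refl , ≤-𝟙) (ae-const (lift {ℓ = suc ℓ} tt))))

-- Regularity in the extension, and enumerations of unbounded subsets of λ.

module Regularity {ℓ : Level} (em : ExcludedMiddle (suc ℓ))
  {C : Set ℓ} (_≤_ : C → C → Set (suc ℓ)) (≤-refl : ∀ {p} → p ≤ p)
  (≤-trans : ∀ {p q r} → p ≤ q → q ≤ r → p ≤ r) (𝟙 : C) (≤-𝟙 : ∀ {p} → p ≤ 𝟙) where
  open Sets {ℓ}
  open Classical em
  open Extension em _≤_ ≤-refl ≤-trans 𝟙 ≤-𝟙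
  open Injections em _≤_ ≤-refl ≤-trans 𝟙 ≤-𝟙

  -- R x y p stands for p ⊩ f(x̌) = y̌.
  record KFun (a b : V ℓ) (p₀ : C) : Set (suc (suc ℓ)) where
    field
      R      : V ℓ → V ℓ → C → Set (suc ℓ)
      R-mono : ∀ {x y p q} → q ≤ p → R x y p → R x y q
      R-resp : ∀ {x x′ y y′ p} → x ≈ x′ → y ≈ y′ → R x y p → R x′ y′ p
      R-cod  : ∀ {x y p} → R x y p → y ∈ b
      R-func : ∀ {x y y′ p} → p ≤ p₀ → R x y p → R x y′ p → y ≈ y′
      R-tot  : ∀ {x p} → p ≤ p₀ → x ∈ a → Dense p (λ q → ∃[ y ] R x y q)

  -- Regularity in the form in which recursion along λ uses it: the bound is an ordinal of V decided
  -- by a condition.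
  Regular : V ℓ → C → Set (suc (suc ℓ))
  Regular lam p = ∀ {ξ q} → q ≤ p → ξ ∈ lam → (f : KFun ξ lam q) →
    Dense q (λ r → ∃[ γ ] γ ∈ lam × (∀ {ζ δ s} → s ≤ r → ζ ∈ ξ → KFun.R f ζ δ s → δ ∈ γ))

  ∈-least : (P : V ℓ → Set (suc ℓ)) → Respects P → ∀ x → P x → ∃[ y ] P y × (∀ z → z ∈ y → ¬ P z)
  ∈-least P r (sup A f) px = go em
    where
    go : Dec (Σ[ i ∈ A ] P (f i)) → ∃[ y ] P y × (∀ z → z ∈ y → ¬ P z)
    go (yes (i , pi)) = ∈-least P r (f i) pi
    go (no h) = sup A f , px , λ { z (i at e) pz → h (i , r e pz) }

  -- H ξ δ says that δ is the ξ-th element of Y.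
  module Enumerate {lam : V ℓ} (ol : Ord lam) {Y : Name} {q₀ : C} (reg : Regular lam q₀)
    (unb : ∀ {r γ} → r ≤ q₀ → γ ∈ lam → ∃[ δ ] δ ∈ lam × γ ∈ δ × Σ[ s ∈ C ] (s ≤ r × s ⊩ check δ ε Y)) where

    H : V ℓ → V ℓ → C → Set (suc ℓ)
    H (sup X f) δ p = δ ∈ lam × (p ⊩ check δ ε Y)
      × (∀ i δ′ q → q ≤ p → H (f i) δ′ q → δ′ ∈ δ)
      × (∀ δ′ → δ′ ∈ δ → ∀ q → q ≤ p → q ⊩ check δ′ ε Y → ¬ (∀ i δ″ r → r ≤ q → H (f i) δ″ r → δ″ ∈ δ′))

    H-mono : ∀ ξ {δ p q} → q ≤ p → H ξ δ p → H ξ δ q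
    H-mono (sup X f) l (d , m , a , b) =
      d , ε-mono l m , (λ i δ′ r k → a i δ′ r (≤-trans k l)) , (λ δ′ n r k → b δ′ n r (≤-trans k l))

    H-respʳ : ∀ ξ {δ δ′ p} → δ ≈ δ′ → H ξ δ p → H ξ δ′ p
    H-respʳ (sup X f) e (d , m , a , b) = ∈-resp-≈ˡ e d , ε-resp-≐ˡ (check-≈ e) m ,
      (λ i δ′ r k h → ∈-resp-≈ʳ e (a i δ′ r k h)) , (λ δ′ n → b δ′ (∈-resp-≈ʳ (≈-sym e) n))

    -- `H` occurs to the left of an arrow in its own definition, so invariance needs the opposite
    -- direction at the members. Reading the equality backwards in a second function keeps the
    -- recursion structural.
    H-respˡ : ∀ ξ ξ′ {δ p} → ξ Defs.≈ ξ′ → H ξ δ p → H ξ′ δ p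
    H-respˡ′ : ∀ ξ ξ′ {δ p} → ξ′ Defs.≈ ξ → H ξ δ p → H ξ′ δ p
    H-respˡ (sup X f) (sup Z g) (h , k) (d , m , a , b) = d , m ,
      (λ j δ′ r l x → let i , e = k j in a i δ′ r l (H-respˡ′ (g j) (f i) e x)) ,
      (λ δ′ n q l y c → b δ′ n q l y λ i δ″ r l′ x → let j , e = h i in c j δ″ r l′ (H-respˡ (f i) (g j) e x))
    H-respˡ′ (sup X f) (sup Z g) (h , k) (d , m , a , b) = d , m ,
      (λ j δ′ r l x → let i , e = h j in a i δ′ r l (H-respˡ (g j) (f i) e x)) ,
      (λ δ′ n q l y c → b δ′ n q l y λ i δ″ r l′ x → let j , e = k i in c j δ″ r l′ (H-respˡ′ (f i) (g j) e x))

    H-resp : ∀ {ξ ξ′ δ δ′ p} → ξ ≈ ξ′ → δ ≈ δ′ → H ξ δ p → H ξ′ δ′ p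
    H-resp {ξ} {ξ′} e e′ h = H-respˡ ξ ξ′ (un≈ e) (H-respʳ ξ e′ h)

    H-∈ : ∀ {ξ δ p} → H ξ δ p → δ ∈ lam
    H-∈ {sup X f} = proj₁

    H-Y : ∀ {ξ δ p} → H ξ δ p → p ⊩ check δ ε Y
    H-Y {sup X f} h = proj₁ (proj₂ h)

    H-func : ∀ {ξ δ δ′ p} → H ξ δ p → H ξ δ′ p → δ ≈ δ′
    H-func {sup X f} (d , m , a , b) (d′ , m′ , a′ , b′) = case proj₂ ol d d′ of λ
      { (inj₁ n) → ⊥₀-elim (b′ _ n _ ≤-refl m a)
      ; (inj₂ (inj₁ e)) → e
      ; (inj₂ (inj₂ n)) → ⊥₀-elim (b _ n _ ≤-refl m′ a′) }

    H-∈∈ : ∀ {ξ ξ′ δ δ′ p} → ξ ∈ ξ′ → H ξ δ p → H ξ′ δ′ p → δ ∈ δ′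
    H-∈∈ {ξ} {sup X f} (i at e) h (_ , _ , a , _) = a i _ _ ≤-refl (H-resp e ≈-refl h)

    H-inj : ∀ {ξ ξ′ δ p} → ξ ∈ lam → ξ′ ∈ lam → H ξ δ p → H ξ′ δ p → ξ ≈ ξ′
    H-inj d d′ h h′ = case proj₂ ol d d′ of λ
      { (inj₁ n) → ⊥₀-elim (∈-irrefl ≈-refl (H-∈∈ n h h′))
      ; (inj₂ (inj₁ e)) → e
      ; (inj₂ (inj₂ n)) → ⊥₀-elim (∈-irrefl ≈-refl (H-∈∈ n h′ h)) }

    -- Regularity bounds the earlier elements by some γ, and Y has elements above γ. Among the
    -- ordinals that some s ≤ q forces to be in Y above the earlier elements, the least is taken;
    -- since all s ≤ q compete, the chosen s forces its minimality.
    H-tot : ∀ ξ {p} → p ≤ q₀ → ξ ∈ lam → Dense p (λ q → ∃[ δ ] H ξ δ q)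
    H-tot (sup X f) {p} l d = dense-bind (reg l d F<) λ r k (γ , g , bd) q k′ →
      let δ₀ , d₀ , γδ , s₀ , h₀ , m₀ = unb (≤-trans k′ (≤-trans k l)) g
          δ , (dδ , s , h , m , a) , mn = ∈-least (P q)
            (λ e (n , s , h , m , a) → ∈-resp-≈ˡ e n , s , h , ε-resp-≐ˡ (check-≈ e) m , λ i δ′ t j x → ∈-resp-≈ʳ e (a i δ′ t j x))
            δ₀ (d₀ , s₀ , h₀ , m₀ , λ i δ′ t j x →
              proj₁ (ord-∈ ol d₀) (bd (≤-trans j (≤-trans h₀ k′)) (elem∈ (sup X f) i) (i , ≈-refl , x)) γδ)
      in s , h , δ , dδ , m , a , λ δ′ n t j m′ a′ → mn δ′ n (proj₁ ol n dδ , t , ≤-trans j h , m′ , a′)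
      where
      P : C → V ℓ → Set (suc ℓ)
      P q δ = δ ∈ lam × Σ[ s ∈ C ] (s ≤ q × (s ⊩ check δ ε Y) × (∀ i δ′ t → t ≤ s → H (f i) δ′ t → δ′ ∈ δ))
      F< : KFun (sup X f) lam p
      F< = record
        { R = λ ζ δ q → Σ[ i ∈ X ] ζ ≈ f i × H (f i) δ q
        ; R-mono = λ k (i , e , h) → i , e , H-mono (f i) k h
        ; R-resp = λ e e′ (i , e″ , h) → i , ≈-trans (≈-sym e) e″ , H-resp ≈-refl e′ h
        ; R-cod = λ (i , e , h) → H-∈ {f i} h
        ; R-func = λ _ (i , e , h) (j , e′ , h′) → H-func h (H-resp (≈-trans (≈-sym e′) e) ≈-refl h′)
        ; R-tot = λ { k (i at e) → dense-map (H-tot (f i) (≤-trans k l) (proj₁ ol (elem∈ (sup X f) i) d)) λ _ _ (δ , h) → δ , i , e , h } }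

    enumerate : Inj lam (check lam) Y q₀
    enumerate = record
      { R = λ ξ δ p → ξ ∈ lam × H ξ δ p
      ; R-mono = λ l (d , h) → d , H-mono _ l h
      ; R-resp = λ e e′ (d , h) → ∈-resp-≈ˡ e d , H-resp e e′ h
      ; R-dom = λ _ d _ → check-∈ d
      ; R-cod = λ _ _ (_ , h) → H-Y h
      ; R-func = λ _ (_ , h) (_ , h′) → H-func h h′
      ; R-inj = λ _ (d , h) (d′ , h′) → H-inj d d′ h h′
      ; R-tot = λ l d _ → dense-map (H-tot _ l d) λ _ _ (δ , h) → δ , H-∈ h , d , h
      ; D⊆ = λ _ → id }

  regular-mono : ∀ {lam p q} → q ≤ p → Regular lam p → Regular lam q
  regular-mono l reg k = reg (≤-trans k l)

  -- Otherwise Y would be enumerated in type λ, and the enumeration restricted to A ⊆ λ would inject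
  -- A into Y.
  ≺⇒bounded : ∀ {lam Y A p} → Ord lam → Regular lam p → F._≺_ Y A p →
    (∀ {σ q} → q ≤ p → q ⊩ σ ε A → q ⊩ σ ε check lam) →
    Dense p (λ r → ∃[ γ ] γ ∈ lam × (∀ δ s → s ≤ r → δ ∈ lam → γ ∈ δ → ¬ (s ⊩ check δ ε Y)))
  ≺⇒bounded {lam} {Y} {A} {p} ol reg (_ , ¬le) A⊆ q l = by-contra λ h →
    let module E = Enumerate ol {Y} {q} (regular-mono l reg) (λ {r} {γ} k g → by-contra λ h′ →
          h (r , k , γ , g , λ δ s k′ d γδ m → h′ (_ , d , γδ , _ , k′ , m)))
        open Inj E.enumerate
    in ⊥-elim (¬le q l (inj⇒≼ {X = lam} {A} {Y} {q} (record
      { R = λ x y s → R x y s × (s ⊩ check x ε A)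
      ; R-mono = λ k (h , m) → R-mono k h , ε-mono k m
      ; R-resp = λ e e′ (h , m) → R-resp e e′ h , ε-resp-≐ˡ (check-≈ e) m
      ; R-dom = λ _ _ (_ , m) → m
      ; R-cod = λ k d (h , _) → R-cod k d h
      ; R-func = λ k (h , _) (h′ , _) → R-func k h h′
      ; R-inj = λ k (h , _) (h′ , _) → R-inj k h h′
      ; R-tot = λ k d m → dense-map (R-tot k d (check-∈ d)) λ _ k′ (y , n , h) → y , n , h , ε-mono k′ m
      ; D⊆ = λ k m → A⊆ (≤-trans k l) m })))

-- The highly connected set and its paths.

module Arrow {ℓ : Level} (em : ExcludedMiddle (suc ℓ))
  {C : Set ℓ} (_≤_ : C → C → Set (suc ℓ)) (≤-refl : ∀ {p} → p ≤ p)
  (≤-trans : ∀ {p q r} → p ≤ q → q ≤ r → p ≤ r) (𝟙 : C) (≤-𝟙 : ∀ {p} → p ≤ 𝟙)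
  (code : C → V ℓ) (code-≤ : ∀ {p q} → Sets._≈_ (code p) (code q) → p ≤ q)
  {κ lam : V ℓ} (M : Measure κ lam) where
  open Sets {ℓ}
  open Classical em
  open Extension em _≤_ ≤-refl ≤-trans 𝟙 ≤-𝟙
  open Injections em _≤_ ≤-refl ≤-trans 𝟙 ≤-𝟙
  open Ordinals em _≤_ ≤-refl ≤-trans 𝟙 ≤-𝟙
  open Regularity em _≤_ ≤-refl ≤-trans 𝟙 ≤-𝟙
  open Conditions em _≤_ ≤-refl ≤-trans 𝟙 ≤-𝟙 code code-≤ M
  open Measure M

  upairᴺ-comm : ∀ {p σ τ} → p ⊩ upairᴺ σ τ ≐ upairᴺ τ σ
  upairᴺ-comm = name-ext (λ _ m → swap m) (λ _ m → swap m)
    where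
    swap : ∀ {q ρ σ τ} → q ⊩ ρ ε upairᴺ σ τ → q ⊩ ρ ε upairᴺ τ σ
    swap m = ε-local (dense-map (upairᴺ⁻ m) λ { _ _ (inj₁ e) → upairᴺʳ e ; _ _ (inj₂ e) → upairᴺˡ e })

  successor-resp : ∀ {j σ τ p} → p ⊩ σ ≐ τ → F.IsSuccessor j σ p → F.IsSuccessor j τ p
  successor-resp e h ρ =
    (λ q l m → dense-map (proj₁ (h ρ) q l m) λ
      { r k (inj₁ n) → inj₁ (unε (ε-resp-≐ʳ (≐-mono (≤-trans k l) e) (mkε n)))
      ; r k (inj₂ d) → inj₂ (un≐ (≐-trans (mk≐ d) (≐-mono (≤-trans k l) e))) }) ,
    (λ q l d → proj₂ (h ρ) q l (dense-map d λ
      { r k (inj₁ n) → inj₁ (unε (ε-resp-≐ʳ (≐-sym (≐-mono (≤-trans k l) e)) (mkε n)))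
      ; r k (inj₂ d) → inj₂ (un≐ (≐-trans (mk≐ d) (≐-sym (≐-mono (≤-trans k l) e)))) }))

  maps-respᴺ : ∀ {f σ σ′ τ τ′ p} → p ⊩ σ ≐ σ′ → p ⊩ τ ≐ τ′ → F.Maps f σ τ p → F.Maps f σ′ τ′ p
  maps-respᴺ e e′ m = ⇒mapsᴺ (ε-resp-≐ˡ (opairᴺ-cong e e′) (maps⇒ᴺ m))

  twoSubset : ∀ {A : Class} {x y e p} → (∀ q → q ≤ p → A (check x) q × A (check y) q) → ¬ (x ≈ y) →
    F.IsUPair e (check x) (check y) p → F.IsTwoSubset A e p
  twoSubset h ne u = dense-return λ q l → _ , dense-return λ r k →
    _ , proj₁ (h r (≤-trans k l)) , proj₂ (h r (≤-trans k l)) , (λ s k′ d → ⊥₀-elim (ne (check-≈⁻ (mk≐ d)))) ,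
    λ ρ → (λ s k′ → proj₁ (u ρ) s (≤-trans k′ (≤-trans k l))) , (λ s k′ → proj₂ (u ρ) s (≤-trans k′ (≤-trans k l)))

  module Final
    (meet : ∀ {p q} → Compatible p q → Σ[ r ∈ C ] (r ≤ p × r ≤ q × (∀ {s} → s ≤ p → s ≤ q → s ≤ r)))
    (glb : (f : ℕ → C) → (∀ n → f (1+ n) ≤ f n) → Σ[ g ∈ C ] ((∀ n → g ≤ f n) × (∀ {s} → (∀ n → s ≤ f n) → s ≤ g)))
    (stem : ∀ F → Σ[ p ∈ C ] Stem p F) (ol : Ord lam) {p₀ : C} {l w c : Name} (reg : Regular lam p₀)
    (hl : p₀ ⊩ l ≐ check lam) (hw : F.IsOmega w p₀)
    (hc : F.IsFun c (F.IsTwoSubset (λ σ → forces-∈ σ l)) (λ σ → forces-∈ σ w) p₀) where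
    open Meets meet glb
    open Omega hw

    ε-l : ∀ {x p} → p ≤ p₀ → x ∈ lam → p ⊩ check x ε l
    ε-l k d = ε-resp-≐ʳ (≐-sym (≐-mono k hl)) (check-∈ d)

    Coloured : Name → V ℓ → V ℓ → ℕ → C → Set (suc ℓ)
    Coloured e α β n q = F.IsUPair e (check α) (check β) q × F.Maps c e (check (num n)) q

    Col : V ℓ → V ℓ → ℕ → C → Set (suc ℓ)
    Col α β n p = Dense p (λ q → ∃[ e ] Coloured e α β n q)

    col-tot : ∀ {α β p} → p ≤ p₀ → α ∈ lam → β ∈ lam → α ∈ β → Σ[ r ∈ C ] (r ≤ p × Σ[ n ∈ ℕ ] Col α β n r)
    col-tot {α} {β} {p} k a b ab =
      let q , k₁ , y , mp = proj₂ hc e p k two p ≤-refl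
          r , k₂ , n , d = ω-numeral (≤-trans k₁ k) (cod (≤-trans k₁ k) mp) q ≤-refl
      in r , ≤-trans k₂ k₁ , n , dense-return λ s k₃ →
           e , ⇒upairᴺ ≐-refl , maps-respᴺ ≐-refl (≐-mono k₃ d) (dense-mono (≤-trans k₃ k₂) mp)
      where
      e = upairᴺ (check α) (check β)
      two : F.IsTwoSubset (λ σ → forces-∈ σ l) e p
      two = twoSubset (λ q h → unε (ε-l (≤-trans h k) a) , unε (ε-l (≤-trans h k) b))
              (λ d → ∈-irrefl d ab) (⇒upairᴺ ≐-refl)
      cod : ∀ {σ τ q} → q ≤ p₀ → F.Maps c σ τ q → q ⊩ τ ε w
      cod l m = ε-local (dense-bind m λ r k (u , n , o) →
        dense-bind (proj₁ (proj₁ hc) u r (≤-trans k l) n) λ s k₁ (x′ , h) → dense-map h λ t k₂ (y′ , _ , yz , o′) →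
        ε-resp-≐ˡ (proj₂ (opairᴺ-injective (≐-trans (≐-sym (opair⇒ᴺ o′)) (opair⇒ᴺ (dense-mono (≤-trans k₂ k₁) o))))) (mkε yz))

    open Colouring stem p₀ Col dense-mono
      (λ e e′ d → dense-map d λ q k (u , h , mp) →
        u , ⇒upairᴺ (≐-trans (upair⇒ᴺ h) (upairᴺ-cong (check-≈ e) (check-≈ e′))) , mp)
      col-tot

    module Vertices (hom : Homogeneous) where
      open Homogeneous hom

      -- In terms of j, some condition in the quotient j(P) / G below [F] gives the edge from α to
      -- the ideal vertex [m] the colour `col`.
      InA : V ℓ → C → Set (suc ℓ)
      InA α r = r ≤ p × Σ[ G ∈ Cond ] (Stem r G × G ≤* F × Dec* G α col)

      inA-mono : ∀ {α q r} → q ≤ r → InA α r → InA α q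
      inA-mono k (h , G , s , b , d) = ≤-trans k h , G , stem-mono {F = G} k s , b , d

      inA-resp : ∀ {α β r} → α ≈ β → InA α r → InA β r
      inA-resp e (h , G , s , b , d) = h , G , s , b , dec-resp {G} e d

      A : Name
      A = mk (Σ[ i ∈ Index lam ] Σ[ r ∈ C ] Small (InA (elem lam i) r)) (λ (i , _) → check (elem lam i)) (λ (_ , r , _) → r)

      A-intro : ∀ {α r} → α ∈ lam → InA α r → r ⊩ check α ε A
      A-intro {r = r} (i at e) h = ε-intro (dense-return λ q k → (i , r , small (inA-resp e h)) , k , check-≈ e)

      A-elim : ∀ {σ q} → q ⊩ σ ε A → Dense q (λ r → ∃[ α ] α ∈ lam × (r ⊩ σ ≐ check α) × InA α r)
      A-elim m = dense-map (ε-elim m) λ q k ((i , r , s) , k′ , e) → _ , elem∈ lam i , e , inA-mono k′ (unsmall s)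

      A⊆ : ∀ {σ q} → q ⊩ σ ε A → q ⊩ σ ε check lam
      A⊆ m = ε-local (dense-map (A-elim m) λ q k (α , d , e , _) → ε-resp-≐ˡ (≐-sym e) (check-∈ d))

      bothAt : ∀ {q G₁ G₂ γ} → q ≤ p → Stem q G₁ → Stem q G₂ → G₁ ≤* F → G₂ ≤* F → γ ∈ lam →
        Σ[ t ∈ T ] γ ∈ m t × Both col q G₁ G₂ (m t)
      bothAt {G₁ = G₁} {G₂} k s₁ s₂ b₁ b₂ g = by-contra λ h → both {F₁ = G₁} {G₂} k s₁ s₂ b₁ b₂
        (ae-map (λ t γt b → h (t , γt , b)) (m-large g))

      unbounded : ∀ {r γ} → r ≤ p → γ ∈ lam → ∃[ δ ] δ ∈ lam × γ ∈ δ × Σ[ s ∈ C ] (s ≤ r × s ⊩ check δ ε A)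
      unbounded {r} k g =
        let t , γt , b = bothAt {G₁ = F} {F} k (stem-mono {F = F} k st) (stem-mono {F = F} k st) (≤*-refl {F}) (≤*-refl {F}) g
            open Both b
        in m t , m∈ t , γt , q , q≤p , A-intro (m∈ t) (≤-trans q≤p k , G₁ , stem₁ , G₁≤ , dec₁)

      -- A is unbounded in the regular λ, so its enumeration injects λ into A; A ⊆ λ and
      -- Cantor-Bernstein do the rest.
      A≃l : F._≃_ A l p
      A≃l = proj₂ (≼-subset⇒≃ (Enumerate.enumerate ol {A} {p} (regular-mono p≤ reg) unbounded) (λ _ → A⊆)
        (λ k m → ε-resp-≐ʳ (≐-mono (≤-trans k p≤) hl) m) (λ k m → ε-resp-≐ʳ (≐-sym (≐-mono (≤-trans k p≤) hl)) m))

      record Common (q : C) (γ α₁ α₂ : V ℓ) : Set (suc ℓ) where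
        constructor mkCommon
        field
          {β} : V ℓ
          {r} : C
          β∈  : β ∈ lam
          γβ  : γ ∈ β
          α₁β : α₁ ∈ β
          α₂β : α₂ ∈ β
          r≤q : r ≤ q
          βA  : InA β r
          c₁  : Col α₁ β col r
          c₂  : Col α₂ β col r

      -- β is m t for a t beyond the bounds at which m t can enter A by a condition below G(t). The
      -- edges from α₁ and α₂ to m t have the colour at G(t) by the decision of G, hence at that
      -- condition.
      common : ∀ {q G γ α₁ α₂} → q ≤ p → Stem q G → G ≤* F → γ ∈ lam → α₁ ∈ lam → α₂ ∈ lam →
        Dec* G α₁ col → Dec* G α₂ col → Common q γ α₁ α₂
      common {q} {G} {γ} {α₁} {α₂} k s b g a₁ a₂ d₁ d₂ = pick
        (ae-point (ae-× (good {G = G} k s b) (ae-× (m-large g) (ae-× (m-large a₁) (ae-× (m-large a₂) (ae-× d₁ d₂))))))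
        where
        pick : Σ[ t ∈ T ] Good col q G t × γ ∈ m t × α₁ ∈ m t × α₂ ∈ m t ×
                 Col α₁ (m t) col (at-t G t) × Col α₂ (m t) col (at-t G t) → Common q γ α₁ α₂
        pick (t , mkGood {G = H} r≤p r≤Gt q≤r sH H≤G dH , γt , t₁ , t₂ , c₁ , c₂) =
          mkCommon (m∈ t) γt t₁ t₂ (≤-trans q≤r r≤p) (≤-trans q≤r (≤-trans r≤p k) , H , sH , ≤*-trans {H} {G} {F} H≤G b , dH)
            (dense-mono (≤-trans q≤r r≤Gt) c₁) (dense-mono (≤-trans q≤r r≤Gt) c₂)

      Good∖ : Name → V ℓ → C → Set (suc ℓ)
      Good∖ Y x r = (r ⊩ check x ε A) × (∀ s → s ≤ r → ¬ (s ⊩ check x ε Y))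

      good-mono∖ : ∀ {Y x r s} → s ≤ r → Good∖ Y x r → Good∖ Y x s
      good-mono∖ k (a , n) = ε-mono k a , λ t k′ → n t (≤-trans k′ k)

      good-resp∖ : ∀ {Y x y r} → x ≈ y → Good∖ Y x r → Good∖ Y y r
      good-resp∖ e (a , n) = ε-resp-≐ˡ (check-≈ e) a , λ t k m → n t k (ε-resp-≐ˡ (check-≈ (≈-sym e)) m)

      X∖ : Name → Class
      X∖ Y σ q = forces-∈ σ A q × (∀ r → r ≤ q → forces-∈ σ Y r → ⊥ {suc ℓ})

      good⇒X∖ : ∀ {Y x r} → Good∖ Y x r → X∖ Y (check x) r
      good⇒X∖ (a , n) = unε a , λ s k y → ⊥₀-elim (n s k (mkε y))

      E : Class
      E e q = F.Maps c e (check (num col)) q × F.IsTwoSubset (λ σ → forces-∈ σ A) e q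

      E∖ : Name → Class
      E∖ Y e q = E e q × F.IsTwoSubset (X∖ Y) e q

      Edge : V ℓ → V ℓ → C → Set (suc ℓ)
      Edge x y r = ¬ (x ≈ y) × Col x y col r

      edge-sym : ∀ {x y r} → Edge x y r → Edge y x r
      edge-sym (n , d) = (λ e → n (≈-sym e)) , dense-map d λ q k (u , h , mp) →
        u , ⇒upairᴺ (≐-trans (upair⇒ᴺ h) upairᴺ-comm) , mp

      -- The walk is a finite function of V; what has to be forced is that its vertices lie in the
      -- graph and that its edges have the colour.
      module Path {Y : Name} {r : C} (vt : ℕ → V ℓ) (vt∈ : ∀ k → vt k ∈ lam)
        (vtA : ∀ k → Good∖ Y (vt k) r) (N : ℕ) (edge : ∀ k → k < N → Edge (vt k) (vt (1+ k)) r) where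

        Step : V ℓ → V ℓ → C → Set (suc ℓ)
        Step i y _ = Σ[ k ∈ ℕ ] i ≈ num k × y ≈ vt k

        open Relation (num (1+ N)) lam Step (λ _ h → h)
          (λ e e′ (k , d , d′) → k , ≈-trans (≈-sym e) d , ≈-trans (≈-sym e′) d′)

        step-maps : ∀ {q} k → k < 1+ N → F.Maps rel (check (num k)) (check (vt k)) q
        step-maps k lt = rel-maps (num-< lt) (vt∈ k) (k , ≈-refl , ≈-refl)

        isFun : ∀ {q} → q ≤ r → F.IsFun rel (λ σ → forces-∈ σ (check (num (1+ N)))) (X∖ Y) q
        isFun k = rel-isFun {A = λ σ → forces-∈ σ (check (num (1+ N)))} {B = X∖ Y}
          (λ { _ (i , e , d) (j , e′ , d′) → ≈-trans d (≈-trans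
                 (subst (λ n → vt i ≈ vt n) (num-injective i j (≈-trans (≈-sym e) e′)) ≈-refl) (≈-sym d′)) })
          (λ { k₁ d _ (i , e , e′) → unε (check-∈ d) ,
               good⇒X∖ (good-resp∖ (≈-sym e′) (good-mono∖ (≤-trans k₁ k) (vtA i))) })
          (λ k₁ d → dense-map (check-ε⁻ (num (1+ N)) (mkε d)) λ s k₂ (i , e) →
             let j , _ , e′ = num∈⁻ (1+ N) (elem∈ (num (1+ N)) i) in
             _ , vt j , elem∈ (num (1+ N)) i , vt∈ j , e , j , e′ , ≈-refl)

        not-in-0 : ∀ {q} → (F.~_ (F.Nonempty (check (num 0)))) q
        not-in-0 s _ ne = ⊥₀-elim (dense-absurd ne λ _ _ (z , h) → dense-absurd (check-ε⁻ (num 0) (mkε h)) λ { _ _ (() , _) })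

        E∖-intro : ∀ {e q j} → q ≤ r → j < N → Coloured e (vt j) (vt (1+ j)) col q → E∖ Y e q
        E∖-intro {e} {q} {j} k lt (up , mp) =
          (mp , twoSubset {A = λ σ → forces-∈ σ A} (λ t h →
             unε (ε-mono (≤-trans h k) (proj₁ (vtA j))) , unε (ε-mono (≤-trans h k) (proj₁ (vtA (1+ j))))) (proj₁ (edge j lt)) up) ,
          twoSubset {A = X∖ Y} (λ t h → good⇒X∖ (good-mono∖ (≤-trans h k) (vtA j)) ,
                                        good⇒X∖ (good-mono∖ (≤-trans h k) (vtA (1+ j)))) (proj₁ (edge j lt)) up

        Joined : Name → Name → Name → Name → Name → C → Set (suc ℓ)
        Joined σ j a b e q = F.IsSuccessor j σ q × F.Maps rel σ a q × F.Maps rel j b q × F.IsUPair e a b q × E∖ Y e q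

        joined : ∀ {σ e q j} → q ≤ r → j < N → q ⊩ σ ≐ check (num j) → Coloured e (vt j) (vt (1+ j)) col q →
          Joined σ (check (num (1+ j))) (check (vt j)) (check (vt (1+ j))) e q
        joined {j = j} k lt eσ c =
          successor-resp (≐-sym eσ) check-succ , maps-respᴺ (≐-sym eσ) ≐-refl (step-maps j (m<n⇒m<1+n lt)) ,
          step-maps (1+ j) (s<s lt) , proj₁ c , E∖-intro k lt c

        coloured-mono : ∀ {e α β n p q} → q ≤ p → Coloured e α β n p → Coloured e α β n q
        coloured-mono k (up , mp) = ⇒upairᴺ (≐-mono k (upair⇒ᴺ up)) , dense-mono k mp

        edges : ∀ σ q → q ≤ r → forces-∈ σ (check (num N)) q →
          Dense q (λ q → ∃[ j ] Dense q (λ q → ∃[ a ] Dense q (λ q → ∃[ b ] Dense q (λ q → ∃[ e ] Joined σ j a b e q))))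
        edges σ q k h = dense-bind (check-ε⁻ (num N) (mkε h)) λ s k₁ (i , e) →
          let j , lt , e′ = num∈⁻ N (elem∈ (num N) i)
              eσ = ≐-trans e (check-≈ e′)
          in dense-map (dense-mono (≤-trans k₁ k) (proj₂ (edge j lt))) λ t k₂ (u , c) →
             check (num (1+ j)) , λ t₁ h₁ → t₁ , ≤-refl , check (vt j) , λ t₂ h₂ → t₂ , ≤-refl , check (vt (1+ j)) ,
             λ t₃ h₃ → t₃ , ≤-refl , u , joined {σ} {u}
               (≤-trans (≤-trans h₃ (≤-trans h₂ h₁)) (≤-trans k₂ (≤-trans k₁ k))) lt
               (≐-mono (≤-trans (≤-trans h₃ (≤-trans h₂ h₁)) k₂) eσ)
               (coloured-mono {u} (≤-trans h₃ (≤-trans h₂ h₁)) c)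

        isPath : ∀ {x y} → r ⊩ x ≐ check (vt 0) → r ⊩ y ≐ check (vt N) →
          F.IsPath (X∖ Y) (E∖ Y) (check (num N)) rel x y r
        isPath ex ey =
          (λ q k → q , ≤-refl , check (num (1+ N)) , check-succ , isFun k) ,
          (λ q k → q , ≤-refl , check (num 0) , not-in-0 , maps-respᴺ ≐-refl (≐-sym (≐-mono k ex)) (step-maps 0 z<s)) ,
          maps-respᴺ ≐-refl (≐-sym ey) (step-maps N (n<1+n N)) , edges

      Bounds : Name → V ℓ → C → Set (suc ℓ)
      Bounds Y γ q = ∀ δ s → s ≤ q → δ ∈ lam → γ ∈ δ → ¬ (s ⊩ check δ ε Y)

      PathTo : Name → Name → Name → C → Set (suc ℓ)
      PathTo Y x y r = ∃[ f ] F.IsPath (X∖ Y) (E∖ Y) (check (num 4)) f x y r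

      -- The inner vertices avoid Y because they lie above its bound γ, the end points because they
      -- are given outside Y.
      join : ∀ {Y x y α α′ δ γ q r} → α ∈ lam → α′ ∈ lam → δ ∈ lam → γ ∈ δ →
        q ⊩ x ≐ check α → q ⊩ y ≐ check α′ → X∖ Y x q → X∖ Y y q → Bounds Y γ q → InA δ q →
        (K : Common q γ α δ) (K′ : Common (Common.r K) γ α′ δ) → r ≤ Common.r K′ → PathTo Y x y r
      join {Y} {x} {y} {α} {α′} {δ} {γ} {q} {r} a a′ d γδ ex ey (xA , x∉) (yA , y∉) bd δA K K′ le =
        _ , isPath (≐-mono r≤q ex) (≐-mono r≤q ey)
        where
        module K = Common K
        module K′ = Common K′
        r≤K : r ≤ K.r
        r≤K = ≤-trans le K′.r≤q
        r≤q : r ≤ q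
        r≤q = ≤-trans r≤K K.r≤q
        outside : ∀ {v} → v ∈ lam → γ ∈ v → InA v r → Good∖ Y v r
        outside v∈ γv vA = A-intro v∈ vA , λ s k m′ → bd _ s (≤-trans k r≤q) v∈ γv m′
        endpoint : ∀ {v z} → q ⊩ z ≐ check v → q ⊩ z ε A → (∀ s → s ≤ q → forces-∈ z Y s → ⊥ {suc ℓ}) → Good∖ Y v r
        endpoint e zA z∉ = good-mono∖ r≤q (ε-resp-≐ˡ e zA ,
          λ s k m′ → ⊥-elim (z∉ s k (unε (ε-resp-≐ˡ (≐-sym (≐-mono k e)) m′))))
        vt : ℕ → V ℓ
        vt 0 = α
        vt 1 = K.β
        vt 2 = δ
        vt 3 = K′.β
        vt (1+ (1+ (1+ (1+ _)))) = α′
        vt∈ : ∀ k → vt k ∈ lam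
        vt∈ 0 = a
        vt∈ 1 = K.β∈
        vt∈ 2 = d
        vt∈ 3 = K′.β∈
        vt∈ (1+ (1+ (1+ (1+ _)))) = a′
        vtA : ∀ k → Good∖ Y (vt k) r
        vtA 0 = endpoint ex (mkε xA) x∉
        vtA 1 = outside K.β∈ K.γβ (inA-mono r≤K K.βA)
        vtA 2 = outside d γδ (inA-mono r≤q δA)
        vtA 3 = outside K′.β∈ K′.γβ (inA-mono le K′.βA)
        vtA (1+ (1+ (1+ (1+ _)))) = endpoint ey (mkε yA) y∉
        edge : ∀ k → k < 4 → Edge (vt k) (vt (1+ k)) r
        edge 0 _ = (λ e → ∈-irrefl e K.α₁β) , dense-mono r≤K K.c₁
        edge 1 _ = edge-sym ((λ e → ∈-irrefl e K.α₂β) , dense-mono r≤K K.c₂)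
        edge 2 _ = (λ e → ∈-irrefl e K′.α₂β) , dense-mono le K′.c₂
        edge 3 _ = edge-sym ((λ e → ∈-irrefl e K′.α₁β) , dense-mono le K′.c₁)
        edge (1+ (1+ (1+ (1+ _)))) (s<s (s<s (s<s (s<s ()))))
        open Path {Y} {r} vt vt∈ vtA 4 edge

      X∖-mono : ∀ {Y x p q} → q ≤ p → X∖ Y x p → X∖ Y x q
      X∖-mono k (a , n) = unε (ε-mono k (mkε a)) , λ r h → n r (≤-trans h k)

      connect₁ : ∀ {Y x y α α′ γ q} → q ≤ p → α ∈ lam → α′ ∈ lam → γ ∈ lam →
        q ⊩ x ≐ check α → q ⊩ y ≐ check α′ → X∖ Y x q → X∖ Y y q → Bounds Y γ q → InA α q → InA α′ q →
        Σ[ r ∈ C ] (r ≤ q × PathTo Y x y r)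
      connect₁ {Y} {x} {y} {α} {α′} {γ} {q} k a a′ g ex ey hx hy bd (_ , G₁ , s₁ , b₁ , d₁) (_ , G₂ , s₂ , b₂ , d₂) =
        go (bothAt {G₁ = G₁} {G₂} k s₁ s₂ b₁ b₂ g)
        where
        go : Σ[ t ∈ T ] γ ∈ m t × Both col q G₁ G₂ (m t) → Σ[ r ∈ C ] (r ≤ q × PathTo Y x y r)
        go (t , γt , mkBoth {q′} {H₁} {H₂} h sH₁ sH₂ bH₁ bH₂ dH₁ dH₂) =
          -- `H₁` decides the colour of α and δ = m t, which gives β. Then `H₂`, which decides it
          -- for α′ and δ, gives β′ below the condition reached with β; the common stem of `H₁` and
          -- `H₂` makes this possible.
          go₁ (common {G = H₁} (≤-trans h k) sH₁ (≤*-trans {H₁} {G₁} {F} bH₁ b₁) g a (m∈ t) (dec-mono {G₁} {H₁} bH₁ d₁) dH₁)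
          where
          go₁ : Common q′ γ α (m t) → Σ[ r ∈ C ] (r ≤ q × PathTo Y x y r)
          go₁ K = go₂ (common {G = H₂} (≤-trans (Common.r≤q K) (≤-trans h k)) (stem-mono {F = H₂} (Common.r≤q K) sH₂)
                    (≤*-trans {H₂} {G₂} {F} bH₂ b₂) g a′ (m∈ t) (dec-mono {G₂} {H₂} bH₂ d₂) dH₂)
            where
            go₂ : Common (Common.r K) γ α′ (m t) → Σ[ r ∈ C ] (r ≤ q × PathTo Y x y r)
            go₂ K′ = Common.r K′ , ≤-trans (Common.r≤q K′) (≤-trans (Common.r≤q K) h) ,
              join a a′ (m∈ t) γt (≐-mono h ex) (≐-mono h ey) (X∖-mono {Y} {x} h hx) (X∖-mono {Y} {y} h hy)
                (λ δ s k′ → bd δ s (≤-trans k′ h)) (≤-trans h k , H₁ , sH₁ , ≤*-trans {H₁} {G₁} {F} bH₁ b₁ , dH₁) K K′ ≤-refl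

      connect : ∀ {Y x y q} → q ≤ p → F._≺_ Y A q → X∖ Y x q → X∖ Y y q → Dense q (PathTo Y x y)
      connect {Y} {x} {y} {q} k sm hx hy = dense-bind (A-elim (mkε (proj₁ hx))) λ
        q₁ k₁ (α , a , ex , inα) → dense-bind (A-elim (ε-mono k₁ (mkε (proj₁ hy)))) λ
        q₂ k₂ (α′ , a′ , ey , inα′) →
        dense-bind (dense-mono (≤-trans k₂ k₁) (≺⇒bounded ol (regular-mono (≤-trans k p≤) reg) sm (λ _ → A⊆))) λ
        q₃ k₃ (γ , g , bd) q₄ k₄ →
          let k₃₁ = ≤-trans k₄ (≤-trans k₃ k₂) ; k₃₀ = ≤-trans k₃₁ k₁ in
          connect₁ {Y} {x} {y} (≤-trans k₃₀ k) a a′ g (≐-mono k₃₁ ex) (≐-mono (≤-trans k₄ k₃) ey)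
            (X∖-mono {Y} {x} k₃₀ hx) (X∖-mono {Y} {y} k₃₀ hy) (λ δ s k′ → bd δ s (≤-trans k′ k₄))
            (inA-mono k₃₁ inα) (inA-mono (≤-trans k₄ k₃) inα′)

      highlyConnected : F.IsHighlyConnected A E p
      highlyConnected Y q k Y⊆ q′ k′ sm x y q₁ k₁ hx q₂ k₂ hy q₃ k₃ =
        q₃ , ≤-refl , w , omega-mono (≤-trans (≤-trans k₃ (≤-trans k₂ k₁)) (≤-trans k′ (≤-trans k p≤))) hw , walk
        where
        walk : Dense q₃ (λ q → ∃[ n ] forces-∈ n w q × Dense q (λ q → ∃[ f ] F.IsPath (X∖ Y) (E∖ Y) n f x y q))
        walk q₄ k₄ = q₄ , ≤-refl , check (num 4) , unε (numeral-ω (≤-trans (≤-trans k₆ (≤-trans k′ k)) p≤) 4) ,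
          connect {Y} (≤-trans k₆ (≤-trans k′ k)) (dense-mono k₆ (proj₁ sm) , λ r h → proj₂ sm r (≤-trans h k₆))
            (X∖-mono {Y} {x} (≤-trans k₅ k₂) hx) (X∖-mono {Y} {y} k₅ hy)
          where
          k₅ = ≤-trans k₄ k₃
          k₆ = ≤-trans k₅ (≤-trans k₂ k₁)

      Conclusion : Name → C → Set (suc ℓ)
      Conclusion B q = F._⊆_ B l q × F._≃_ B l q ×
        F.IsHighlyConnected B (λ e q → F.Maps c e (check (num col)) q × F.IsTwoSubset (λ σ → forces-∈ σ B) e q) q

      A⊆l : ∀ {q} → q ≤ p → F._⊆_ A l q
      A⊆l k σ r k′ d = unε (ε-resp-≐ʳ (≐-sym (≐-mono (≤-trans (≤-trans k′ k) p≤) hl)) (A⊆ (mkε d)))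

      highlyConnected-mono : ∀ {q} → q ≤ p → F.IsHighlyConnected A E q
      highlyConnected-mono k Y r k′ = highlyConnected Y r (≤-trans k′ k)

      conclusion : ∀ {q} → q ≤ p → Conclusion A q
      conclusion k = A⊆l k , dense-mono k A≃l , highlyConnected-mono k

    Goal : C → Set (suc ℓ)
    Goal r = ∃[ i ] forces-∈ i w r × DenseBelow r (λ q → ∃[ B ]
      F._⊆_ B l q × F._≃_ B l q × F.IsHighlyConnected B (λ e q → F.Maps c e i q × F.IsTwoSubset (λ σ → forces-∈ σ B) e q) q)

    arrow-of : Homogeneous → Σ[ r ∈ C ] (r ≤ p₀ × Goal r)
    arrow-of hom = p , p≤ , check (num col) , unε (numeral-ω p≤ col) , λ q k → q , ≤-refl , A , conclusion k
      where
      open Homogeneous hom using (p; p≤; col)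
      open Vertices hom using (A; conclusion)

    arrow : Σ[ r ∈ C ] (r ≤ p₀ × Goal r)
    arrow = arrow-of homogeneous

  isFun-mono : ∀ {f} {A B : Class} {p q} → q ≤ p → F.IsFun f A B p → F.IsFun f A B q
  isFun-mono k ((a , b) , c) =
    ((λ u r h → a u r (≤-trans h k)) , (λ x y y′ r h → b x y y′ r (≤-trans h k))) , (λ x r h → c x r (≤-trans h k))

  hcArrow :
    (∀ {p q} → Compatible p q → Σ[ r ∈ C ] (r ≤ p × r ≤ q × (∀ {s} → s ≤ p → s ≤ q → s ≤ r))) →
    ((f : ℕ → C) → (∀ n → f (1+ n) ≤ f n) → Σ[ g ∈ C ] ((∀ n → g ≤ f n) × (∀ {s} → (∀ n → s ≤ f n) → s ≤ g))) →
    (∀ F → Σ[ p ∈ C ] Stem p F) → Ord lam →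
    ∀ {p l} → Regular lam p → p ⊩ l ≐ check lam → F.HCArrow l p
  hcArrow meet glb stem ol {p} {l} reg hl w q k hw c r k′ hc s k″ =
    Final.arrow meet glb stem ol {s} {l} {w} {c} (regular-mono (≤-trans k″ (≤-trans k′ k)) reg)
      (≐-mono (≤-trans k″ (≤-trans k′ k)) hl) (omega-mono (≤-trans k″ k′) hw)
      (isFun-mono {c} {F.IsTwoSubset (λ σ → forces-∈ σ l)} {λ σ → forces-∈ σ w} k″ hc)

  hcArrow-local : ∀ {p l} → Dense p (F.HCArrow l) → F.HCArrow l p
  hcArrow-local {p} {l} d w q k hw c r k′ hc s k″ =
    let t , h , a = d s (≤-trans k″ (≤-trans k′ k))
        u , h′ , x = a w t ≤-refl (omega-mono (≤-trans h (≤-trans k″ k′)) hw) c t ≤-refl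
          (isFun-mono {c} {F.IsTwoSubset (λ σ → forces-∈ σ l)} {λ σ → forces-∈ σ w} (≤-trans h k″) hc) t ≤-refl
    in u , ≤-trans h′ h , x

-- Cantor's enumeration of the pairs of natural numbers.

unpair : ℕ → ℕ × ℕ
unpair zero = 0 , 0
unpair (1+ n) with unpair n
... | zero , b = 1+ b , 0
... | 1+ a , b = a , 1+ b

private
  unpair-step : ∀ n {a b} → unpair n ≡ (1+ a , b) → unpair (1+ n) ≡ (a , 1+ b)
  unpair-step n e with unpair n
  unpair-step n refl | _ = refl

  unpair-turn : ∀ n {b} → unpair n ≡ (0 , b) → unpair (1+ n) ≡ (1+ b , 0)
  unpair-turn n e with unpair n
  unpair-turn n refl | _ = refl

  walk : ∀ n a b k → unpair n ≡ (a + k , b) → Σ[ m ∈ ℕ ] unpair m ≡ (k , a + b)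
  walk n zero b k e = n , e
  walk n (1+ a) b k e = let m , e′ = walk (1+ n) a (1+ b) k (unpair-step n e) in m , trans e′ (cong (k ,_) (+-suc a b))

  diagonal : ∀ d → Σ[ n ∈ ℕ ] unpair n ≡ (d , 0)
  diagonal zero = 0 , refl
  diagonal (1+ d) =
    let n , e = diagonal d
        m , e′ = walk n d 0 0 (trans e (cong (_, 0) (sym (+-identityʳ d))))
    in 1+ m , trans (unpair-turn m e′) (cong (λ x → 1+ x , 0) (+-identityʳ d))

unpair-surjective : ∀ a b → Σ[ n ∈ ℕ ] unpair n ≡ (a , b)
unpair-surjective a b =
  let n , e = diagonal (b + a) ; m , e′ = walk n b 0 a e in m , trans e′ (cong (a ,_) (+-identityʳ b))

-- The Levy collapse.

-- Conditions of Coll(ω₁ , <κ) as countable sets of triples (α , ξ , η) with p(α)(ξ) = η.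
module Collapse {ℓ : Level} (em : ExcludedMiddle (suc ℓ)) {κ P : V ℓ}
  (oκ : Sets.Ord κ) (hP : In-V.IsColl P κ) where
  open Sets {ℓ}
  open Classical em
  open In-V {ℓ}

  ω₁ ω₀ : V ℓ
  ω₁ = proj₁ hP
  ω₀ = proj₁ (proj₁ (proj₂ hP))

  ω₀-omega : IsOmega ω₀
  ω₀-omega = proj₁ (proj₂ (proj₁ (proj₂ hP)))

  ω₁-cardinal : IsCardinal ω₁
  ω₁-cardinal = proj₁ (proj₂ (proj₂ (proj₁ (proj₂ hP))))

  ω₀∈ω₁ : ω₀ ∈ ω₁
  ω₀∈ω₁ = lower∈ (proj₁ (proj₂ (proj₂ (proj₂ (proj₁ (proj₂ hP))))))

  ω₁-countable : ∀ {α} → α ∈ ω₁ → Injective α ω₀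
  ω₁-countable m = ≼⇒injective (proj₂ (proj₂ (proj₂ (proj₂ (proj₁ (proj₂ hP))))) _ (lift∈ m))

  ω₁-uncovered : ¬ Cover ω₁
  ω₁-uncovered = cardinal-uncovered ω₁-cardinal ω₀-omega ω₀∈ω₁

  C : Set ℓ
  C = Index P

  infix 4 _≤_

  -- Abstract, because unification would otherwise unfold CollOrder at every use of _≤_.
  abstract
    _≤_ : C → C → Set (suc ℓ)
    p ≤ q = CollOrder κ (elem P p) (elem P q)

    ≤-def : _≤_ ≡ (λ p q → CollOrder κ (elem P p) (elem P q))
    ≤-def = refl

  private
    cond : ∀ i → IsCollCondition ω₁ κ (elem P i)
    cond i = proj₁ (proj₂ (proj₂ hP) (elem P i)) (lift∈ (elem∈ P i))

    In∈ : V ℓ → V ℓ → Set (suc ℓ)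
    In∈ a x = Lift (suc ℓ) (x Defs.∈ a)

    in∈-resp : ∀ {a} → Respects (In∈ a)
    in∈-resp {a} e m = lift∈ {y = a} (∈-resp-≈ˡ e (lower∈ m))

  record Tr (p : C) (α ξ η : V ℓ) : Set (suc ℓ) where
    constructor mkTr
    field
      {comp} : V ℓ
      mp₁    : Maps (elem P p) α comp
      mp₂    : Maps comp ξ η

  private variable
    p q r : C
    α ξ η : V ℓ

  total : ∀ p {α} → α ∈ κ → ∃[ g ] Maps (elem P p) α g
  total p {α} d = proj₂ (proj₁ (cond p)) α (lift∈ d)

  private
    dom : ∀ p {α g} → Maps (elem P p) α g → α ∈ κ
    dom p {α} {g} (u , m , o) =
      let x , y , d , _ , o′ = proj₁ (proj₁ (proj₁ (cond p))) u m
      in ∈-resp-≈ˡ (proj₁ (opair-injective (≈-trans (≈-sym (opair⇒ {u = u} o′)) (opair⇒ {u = u} o)))) (lower∈ d)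

    comp-unique : ∀ p {α g h} → Maps (elem P p) α g → Maps (elem P p) α h → g ≈ h
    comp-unique p m n = lower≈ (proj₂ (proj₁ (proj₁ (cond p))) _ _ _ m n)

    comp-partial : ∀ p {α g} → Maps (elem P p) α g → IsPartialFun g (In∈ ω₁) (In∈ α)
    comp-partial p mp = proj₁ (proj₁ (proj₂ (cond p)) _ (lift∈ (dom p mp)) _ mp)

  tr-resp : Respects₃ (Tr p)
  tr-resp {p} e₁ e₂ e₃ (mkTr {g} m n) = mkTr (maps-resp {v = elem P p} e₁ ≈-refl m) (maps-resp {v = g} e₂ e₃ n)

  tr-bound : Tr p α ξ η → α ∈ κ × ξ ∈ ω₁ × η ∈ α
  tr-bound {p} {α} (mkTr {g} m n) =
    let a , b = partialFun-maps {v = g} {A = In∈ ω₁} {B = In∈ α} (in∈-resp {ω₁}) (in∈-resp {α}) (comp-partial p m) n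
    in dom p m , lower∈ a , lower∈ b

  tr-func : ∀ {η′} → Tr p α ξ η → Tr p α ξ η′ → η ≈ η′
  tr-func {p} (mkTr {g} m n) (mkTr {h} m′ n′) =
    lower≈ (proj₂ (comp-partial p m) _ _ _ n (maps-resp-fun (comp-unique p m′ m) n′))

  abstract
    ≤⇒tr : p ≤ q → Tr q α ξ η → Tr p α ξ η
    ≤⇒tr {p} {q} {α} {ξ} {η} l t@(mkTr {h} m n) =
      let d = proj₁ (tr-bound t)
          g , m′ = total p d
      in mkTr {comp = g} m′ (⇒maps {v = g} (lower∈ (l α (lift∈ d) g h m′ m (opair ξ η) (lift∈ (maps⇒ {v = h} n)))))

    tr⇒≤ : (∀ {α ξ η} → Tr q α ξ η → Tr p α ξ η) → p ≤ q
    tr⇒≤ {q} {p} f α d g h m n z zh =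
      let x , y , _ , _ , o = proj₁ (comp-partial q n) z zh
          mkTr {g′} m′ n′ = f (mkTr {q} {α} {x} {y} {h} n (z , zh , o))
      in lift∈ (∈-resp-≈ˡ (≈-sym (opair⇒ {u = z} o)) (maps⇒ {v = g} (maps-resp-fun (comp-unique p m′ m) n′)))

  ≤-refl : p ≤ p
  ≤-refl {p} = tr⇒≤ {p} {p} id

  ≤-trans : p ≤ q → q ≤ r → p ≤ r
  ≤-trans {p} {q} {r} l k = tr⇒≤ {r} {p} λ t → ≤⇒tr {p} {q} l (≤⇒tr {q} {r} k t)

  code : C → V ℓ
  code = elem P

  code-≤ : code p ≈ code q → p ≤ q
  code-≤ {p} {q} e = tr⇒≤ {q} {p} λ { (mkTr m n) → mkTr (maps-resp-fun (≈-sym e) m) n }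

  Triple : Set (suc ℓ)
  Triple = V ℓ × V ℓ × V ℓ

  _≈³_ : Triple → Triple → Set (suc ℓ)
  (a , b , c) ≈³ (a′ , b′ , c′) = a ≈ a′ × b ≈ b′ × c ≈ c′

  record Cover₃ (R : V ℓ → V ℓ → V ℓ → Set (suc ℓ)) : Set (suc ℓ) where
    field
      enum : ℕ → Triple
      hits : ∀ {α ξ η} → R α ξ η → Σ[ n ∈ ℕ ] (α , ξ , η) ≈³ enum n
  open Cover₃ public

  cover-⋃ : {R : ℕ → V ℓ → V ℓ → V ℓ → Set (suc ℓ)} → (∀ n → Cover₃ (R n)) →
    Cover₃ (λ α ξ η → Σ[ n ∈ ℕ ] R n α ξ η)
  cover-⋃ c = record
    { enum = λ k → enum (c (proj₁ (unpair k))) (proj₂ (unpair k))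
    ; hits = λ {α} {ξ} {η} (n , h) → let k , e = hits (c n) h ; j , e′ = unpair-surjective n k in
        j , subst (λ (n , k) → (α , ξ , η) ≈³ enum (c n) k) (sym e′) e }

  private
    split : V ℓ → V ℓ × V ℓ
    split z with em {∃[ x ] ∃[ y ] z ≈ opair x y}
    ... | yes (x , y , _) = x , y
    ... | no _ = z , z

    split-opair : ∀ {z x y} → opair x y ≈ z → x ≈ proj₁ (split z) × y ≈ proj₂ (split z)
    split-opair {z} {x} {y} e with em {∃[ x ] ∃[ y ] z ≈ opair x y}
    ... | yes (_ , _ , e′) = opair-injective (≈-trans e e′)
    ... | no h = ⊥₀-elim (h (x , y , ≈-sym e))

    record Comp (p : C) (α : V ℓ) : Set (suc ℓ) where
      constructor mkComp
      field
        {comp} : V ℓ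
        mp     : Maps (elem P p) α comp

    compOf : ∀ {p α} → Dec (Comp p α) → V ℓ
    compOf (yes k) = Comp.comp k
    compOf (no _)  = num 0

    compOf-cover : ∀ {p α} (k : Dec (Comp p α)) → Cover (compOf k)
    compOf-cover {p} (yes (mkComp m)) = countable⇒cover (proj₂ (proj₁ (proj₂ (cond p)) _ (lift∈ (dom p m)) _ m))
    compOf-cover (no _) = (λ _ → num 0) , λ { (() at _) }

    compOf-≈ : ∀ {p α g} (k : Dec (Comp p α)) → Maps (elem P p) α g → g ≈ compOf k
    compOf-≈ {p} (yes (mkComp n)) m = comp-unique p m n
    compOf-≈ (no h) m = ⊥₀-elim (h (mkComp m))

  private
    -- The index i runs through the countable support of p, and j through the countable function
    -- that p has at the i-th coordinate; `split` recovers the argument and the value from an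
    -- ordered pair.
    tr-cover′ : ∀ p → Cover₃ (Tr p)
    tr-cover′ p = record
      { enum = λ k → let i , j = unpair k in e i j
      ; hits = λ { {α} {ξ} {η} t@(mkTr {g} m n) →
          let i , a = proj₂ S (lower∈ (proj₂ (s-spec α) (lift∈ (proj₁ (tr-bound t)) , g , m , opair ξ η , lift∈ (maps⇒ {v = g} n))))
              j , b = proj₂ (compOf-cover (em {Comp p (proj₁ S i)})) (∈-resp-≈ʳ (compOf-≈ em (maps-resp {v = elem P p} a ≈-refl m)) (maps⇒ {v = g} n))
              k , c = unpair-surjective i j
          in k , subst (λ (i , j) → (α , ξ , η) ≈³ e i j) (sym c) (a , split-opair b) } }
      where
      S : Cover (proj₁ (proj₂ (proj₂ (cond p))))
      S = countable⇒cover (proj₁ (proj₂ (proj₂ (proj₂ (cond p)))))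
      s-spec = proj₂ (proj₂ (proj₂ (proj₂ (cond p))))
      e : ℕ → ℕ → Triple
      e i j = proj₁ S i , split (proj₁ (compOf-cover (em {Comp p (proj₁ S i)})) j)

  abstract
    tr-cover : ∀ p → Cover₃ (Tr p)
    tr-cover = tr-cover′

  -- Since P contains every set that is a condition, such data always come from an element of P.
  -- Unions of conditions can therefore be formed as predicates, without handling coded functions.
  record Triples : Set (suc (suc ℓ)) where
    field
      R     : V ℓ → V ℓ → V ℓ → Set (suc ℓ)
      resp  : Respects₃ R
      bound : ∀ {α ξ η} → R α ξ η → α ∈ κ × ξ ∈ ω₁ × η ∈ α
      func  : ∀ {α ξ η η′} → R α ξ η → R α ξ η′ → η ≈ η′
      cov   : Cover₃ R

  module Build (S : Triples) where
    open Triples S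

    private
      resp₂ : ∀ {α} → Respects₂ (R α)
      resp₂ e e′ = resp ≈-refl e e′

      g : V ℓ → V ℓ
      g α = relSet ω₁ α (R α)

      g-∈ : ∀ {α z} → z ∈ g α → ∃[ ξ ] ∃[ η ] z ≈ opair ξ η × R α ξ η
      g-∈ ((i , j , s) at e) = _ , _ , e , unsmall s

      ∈-g : ∀ {α ξ η} → R α ξ η → opair ξ η ∈ g α
      ∈-g {α} r = let _ , b , c = bound r in maps⇒ {v = g α} (∈relSet resp₂ {a = ω₁} {b = α} b c r)

      g-⊆ : ∀ {α β z} → α ≈ β → z ∈ g α → z ∈ g β
      g-⊆ e m = let ξ , η , d , r = g-∈ m in ∈-resp-≈ˡ (≈-sym d) (∈-g (resp e ≈-refl ≈-refl r))

      g-resp : ∀ {α β} → α ≈ β → g α ≈ g β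
      g-resp e = extensionality (λ _ → g-⊆ e) (λ _ → g-⊆ (≈-sym e))

      g-partial : ∀ α → IsPartialFun (g α) (In∈ ω₁) (In∈ α)
      g-partial α = relSet-isPartialFun resp₂ {a = ω₁} {b = α} (λ _ → func)

      c : V ℓ
      c = sup (Index κ) (λ i → opair (elem κ i) (g (elem κ i)))

      c-maps : ∀ {α h} → α ∈ κ → h ≈ g α → Maps c α h
      c-maps (i at e) d = ⇒maps {v = c} (i at opair-cong e (≈-trans d (g-resp e)))

      c-maps⁻ : ∀ {α h} → Maps c α h → α ∈ κ × h ≈ g α
      c-maps⁻ {α} {h} m = go (maps⇒ {v = c} m)
        where
        go : opair α h ∈ c → α ∈ κ × h ≈ g α
        go (i at e) = let d , d′ = opair-injective e in i at d , ≈-trans d′ (g-resp (≈-sym d))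

      partial-resp : ∀ {h α} → h ≈ g α → IsPartialFun h (In∈ ω₁) (In∈ α)
      partial-resp {h} {α} e =
        (λ u m → proj₁ (g-partial α) u (lift∈ (∈-resp-≈ʳ e (lower∈ m)))) ,
        (λ x y y′ m m′ → proj₂ (g-partial α) x y y′ (maps-resp-fun e m) (maps-resp-fun e m′))

      widen : ∀ {h α} → α ∈ κ → IsPartialFun h (In∈ ω₁) (In∈ α) → IsPartialFun h (In∈ ω₁) (In∈ κ)
      widen d (a , b) = (λ u m → let x , y , x∈ , y∈ , o = a u m in
        x , y , x∈ , lift∈ (proj₁ oκ (lower∈ y∈) d) , o) , b

      support : V ℓ
      support = sep κ (λ α → ∃[ ξ ] ∃[ η ] R α ξ η)

      support-resp : Respects (λ α → ∃[ ξ ] ∃[ η ] R α ξ η)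
      support-resp e (ξ , η , r) = ξ , η , resp e ≈-refl ≈-refl r

      isCondition : IsCollCondition ω₁ κ c
      isCondition =
        (( (λ u m → let i at e = lower∈ {y = c} m in
              _ , _ , lift∈ (elem∈ κ i) , widen {g (elem κ i)} (elem∈ κ i) (g-partial (elem κ i)) , ⇒opair e)
         , (λ x y y′ m m′ → lift≈ (≈-trans (proj₂ (c-maps⁻ m)) (≈-sym (proj₂ (c-maps⁻ m′))))))
        , (λ x m → g x , c-maps (lower∈ m) ≈-refl)) ,
        (λ α d h m → let e = proj₂ (c-maps⁻ m) in partial-resp e ,
           cover⇒countable ((λ n → let _ , ξ , η = enum cov n in opair ξ η) ,
             λ z∈ → let ξ , η , d , r = g-∈ (∈-resp-≈ʳ e z∈) ; n , _ , a , b = hits cov r in n , ≈-trans d (opair-cong a b))) ,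
        (support ,
         cover⇒countable {support} ((λ n → proj₁ (enum cov n)) , λ α∈ →
           let _ , ξ , η , r = ∈sep⁻ {a = κ} support-resp α∈ ; n , a , _ = hits cov r in n , a) ,
         λ α → (λ m → let d , ξ , η , r = ∈sep⁻ {a = κ} support-resp (lower∈ {y = support} m) in
                  lift∈ d , g α , c-maps d ≈-refl , opair ξ η , lift∈ (∈-g r)) ,
               (λ (d , h , m , z , z∈) →
                  let ξ , η , _ , r = g-∈ (∈-resp-≈ʳ (proj₂ (c-maps⁻ m)) (lower∈ z∈)) in
                  lift∈ {y = support} (∈sep {a = κ} support-resp (lower∈ d) (ξ , η , r))))

      here : c ∈ P
      here = lower∈ (proj₂ (proj₂ (proj₂ hP) c) isCondition)

    abstract
      built : C
      built = pos here

      built⇒ : Tr built α ξ η → R α ξ η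
      built⇒ {α} (mkTr {h} m n) =
        let d , e = c-maps⁻ (maps-resp-fun (≈-sym (at-eq here)) m)
        in proj₂ (proj₂ (∈relSet⁻ resp₂ {a = ω₁} {b = α} (maps-resp-fun {v = h} e n)))

      ⇒built : R α ξ η → Tr built α ξ η
      ⇒built {α} r = let d , b , e = bound r in
        mkTr (maps-resp-fun (at-eq here) (c-maps d ≈-refl)) (∈relSet resp₂ {a = ω₁} {b = α} b e r)

  open Build

  private
    top : Triples
    top = record { R = λ _ _ _ → ⊥ ; resp = λ _ _ _ () ; bound = λ () ; func = λ ()
                 ; cov = record { enum = λ _ → num 0 , num 0 , num 0 ; hits = λ () } }

  𝟙 : C
  𝟙 = built top

  ≤-𝟙 : p ≤ 𝟙
  ≤-𝟙 {p} = tr⇒≤ {𝟙} {p} λ t → ⊥-elim (built⇒ top t)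

  seq-≤ : (f : ℕ → C) → (∀ n → f (1+ n) ≤ f n) → ∀ {m n} → m ≤′ n → f n ≤ f m
  seq-≤ f d (≤′-reflexive refl) = ≤-refl {f _}
  seq-≤ f d (≤′-step {n} h) = ≤-trans {f (1+ n)} {f n} (d n) (seq-≤ f d h)

  glb : (f : ℕ → C) → (∀ n → f (1+ n) ≤ f n) → Σ[ g ∈ C ] ((∀ n → g ≤ f n) × (∀ {s} → (∀ n → s ≤ f n) → s ≤ g))
  glb f d = built S , (λ n → tr⇒≤ {f n} {built S} λ t → ⇒built S (n , t)) ,
    λ {s} h → tr⇒≤ {built S} {s} λ t → let n , t′ = built⇒ S t in ≤⇒tr {s} {f n} (h n) t′
    where
    S : Triples
    S = record
      { R = λ α ξ η → Σ[ n ∈ ℕ ] Tr (f n) α ξ η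
      ; resp = λ e₁ e₂ e₃ (n , t) → n , tr-resp e₁ e₂ e₃ t
      ; bound = λ (n , t) → tr-bound t
      -- Triples from two stages are compared at the later stage, which contains both.
      ; func = λ (m , t) (n , t′) → tr-func
          (≤⇒tr {f (m ⊔ n)} {f m} (seq-≤ f d (≤⇒≤′ (m≤m⊔n m n))) t)
          (≤⇒tr {f (m ⊔ n)} {f n} (seq-≤ f d (≤⇒≤′ (m≤n⊔m m n))) t′)
      ; cov = cover-⋃ (tr-cover ∘ f) }

  -- The union of p and q. It is single-valued because it is contained in r, and it is the greatest
  -- lower bound because every common extension contains it.
  meet : (Σ[ r ∈ C ] (r ≤ p × r ≤ q)) → Σ[ r ∈ C ] (r ≤ p × r ≤ q × (∀ {s} → s ≤ p → s ≤ q → s ≤ r))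
  meet {p} {q} (r , l , k) = built S ,
    tr⇒≤ {p} {built S} (λ t → ⇒built S (inj₁ t)) , tr⇒≤ {q} {built S} (λ t → ⇒built S (inj₂ t)) ,
    λ {s} h h′ → tr⇒≤ {built S} {s} λ t → [ ≤⇒tr {s} {p} h , ≤⇒tr {s} {q} h′ ]′ (built⇒ S t)
    where
    sel : ℕ → C
    sel zero   = p
    sel (1+ _) = q
    cov′ = cover-⋃ (tr-cover ∘ sel)
    below : ∀ {α ξ η} → Tr p α ξ η ⊎ Tr q α ξ η → Tr r α ξ η
    below = [ ≤⇒tr {r} {p} l , ≤⇒tr {r} {q} k ]′
    S : Triples
    S = record
      { R = λ α ξ η → Tr p α ξ η ⊎ Tr q α ξ η
      ; resp = λ e₁ e₂ e₃ → [ inj₁ ∘ tr-resp e₁ e₂ e₃ , inj₂ ∘ tr-resp e₁ e₂ e₃ ]′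
      ; bound = [ tr-bound , tr-bound ]′
      ; func = λ t t′ → tr-func (below t) (below t′)
      ; cov = record { enum = enum cov′ ; hits = [ (λ t → hits cov′ (0 , t)) , (λ t → hits cov′ (1 , t)) ]′ } }

  module Extend {α η : V ℓ} (a : α ∈ κ) (h : η ∈ α) (p : C) {ξ : V ℓ} (d : ξ ∈ ω₁) (new : ∀ η′ → ¬ Tr p α ξ η′) where
    R′ : V ℓ → V ℓ → V ℓ → Set (suc ℓ)
    R′ x y z = Tr p x y z ⊎ (x ≈ α × y ≈ ξ × z ≈ η)

    clash : ∀ {x y z} → Tr p x y z → x ≈ α → y ≈ ξ → ⊥₀
    clash t e e′ = new _ (tr-resp e e′ ≈-refl t)

    resp′ : Respects₃ R′
    resp′ e₁ e₂ e₃ (inj₁ t) = inj₁ (tr-resp e₁ e₂ e₃ t)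
    resp′ e₁ e₂ e₃ (inj₂ (x , y , z)) = inj₂ (≈-trans (≈-sym e₁) x , ≈-trans (≈-sym e₂) y , ≈-trans (≈-sym e₃) z)

    bound′ : ∀ {x y z} → R′ x y z → x ∈ κ × y ∈ ω₁ × z ∈ x
    bound′ (inj₁ t) = tr-bound t
    bound′ (inj₂ (x , y , z)) =
      ∈-resp-≈ˡ (≈-sym x) a , ∈-resp-≈ˡ (≈-sym y) d , ∈-resp-≈ʳ (≈-sym x) (∈-resp-≈ˡ (≈-sym z) h)

    func′ : ∀ {x y z z′} → R′ x y z → R′ x y z′ → z ≈ z′
    func′ (inj₁ t) (inj₁ t′) = tr-func t t′
    func′ (inj₁ t) (inj₂ (x , y , z)) = ⊥₀-elim (clash t x y)
    func′ (inj₂ (x , y , z)) (inj₁ t) = ⊥₀-elim (clash t x y)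
    func′ (inj₂ (_ , _ , z)) (inj₂ (_ , _ , z′)) = ≈-trans z (≈-sym z′)

    enum′ : ℕ → Triple
    enum′ zero   = α , ξ , η
    enum′ (1+ n) = enum (tr-cover p) n

    hits′ : ∀ {x y z} → R′ x y z → Σ[ n ∈ ℕ ] (x , y , z) ≈³ enum′ n
    hits′ (inj₁ t) = let n , e = hits (tr-cover p) t in 1+ n , e
    hits′ (inj₂ e) = 0 , e

    extended : Triples
    extended = record { R = R′ ; resp = resp′ ; bound = bound′ ; func = func′ ; cov = record { enum = enum′ ; hits = hits′ } }

    result : Σ[ q ∈ C ] (q ≤ p × ∃[ ξ ] Tr q α ξ η)
    result = built extended , tr⇒≤ {p} {built extended} (λ t → ⇒built extended (inj₁ t)) , ξ ,
      ⇒built extended (inj₂ (≈-refl , ≈-refl , ≈-refl))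

  private
    ξ-enum : C → ℕ → V ℓ
    ξ-enum p n = proj₁ (proj₂ (enum (tr-cover p) n))

    ξ-hits : Tr p α ξ η → Σ[ n ∈ ℕ ] ξ ≈ ξ-enum p n
    ξ-hits {p} t = let n , e = hits (tr-cover p) t in n , proj₁ (proj₂ e)

    Fresh : C → V ℓ → V ℓ → Set (suc ℓ)
    Fresh p α ξ = ξ ∈ ω₁ × (∀ η → ¬ Tr p α ξ η)

    -- The domain of p(α) is countable, so it does not cover ω₁.
    fresh : ∀ p α → ∃ (Fresh p α)
    fresh p α = by-contra {∃ (Fresh p α)} λ no → ω₁-uncovered (ξ-enum p , λ {ξ} d →
      by-contra {Σ[ n ∈ ℕ ] ξ ≈ ξ-enum p n} λ k → no (ξ , d , λ η t → k (ξ-hits t)))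

  -- The density argument that makes the generic function from ω₁ to α surjective.
  collapse : α ∈ κ → η ∈ α → ∀ p → Σ[ q ∈ C ] (q ≤ p × ∃[ ξ ] Tr q α ξ η)
  collapse {α} {η} a h p = go (fresh p α)
    where
    go : ∃ (Fresh p α) → Σ[ q ∈ C ] (q ≤ p × ∃[ ξ ] Tr q α ξ η)
    go (ξ , d , new) = Extend.result a h p d new

-- The axiom of choice for indices.

module ChoiceOfIndices {ℓ : Level} (em : ExcludedMiddle (suc ℓ)) (ac : In-V.Choice {ℓ}) where
  open Sets {ℓ}
  open Classical em

  record Representatives (a : V ℓ) (g : Index a → V ℓ) : Set (suc ℓ) where
    field
      ρ      : Index a → Index a
      ρ-eq   : ∀ i → elem a i ≈ elem a (ρ i)
      ρ-resp : ∀ {i j} → elem a i ≈ elem a j → g (ρ i) ≈ g (ρ j)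

  -- Choice is applied to the disjoint sets X i = {(x , g j) : j an index of x}, where x = elem a i.
  representatives : ∀ a g → Representatives a g
  representatives a g = record
    { ρ = λ i → proj₁ (proj₁ (pick i)) ; ρ-eq = λ i → unsmall (proj₂ (proj₁ (pick i)))
    ; ρ-resp = λ {i} {j} e → proj₂ (opair-injective
        (≈-trans (≈-sym (proj₂ (pick i))) (≈-trans (z-resp e) (proj₂ (pick j))))) }
    where
    X : Index a → V ℓ
    X i = sup (Σ[ j ∈ Index a ] Small (elem a i ≈ elem a j)) (λ (j , _) → opair (elem a j) (g j))
    X-⊆ : ∀ {i j z} → elem a i ≈ elem a j → z ∈ X i → z ∈ X j
    X-⊆ e ((k , s) at d) = (k , small (≈-trans (≈-sym e) (unsmall s))) at d
    X-resp : ∀ {i j} → elem a i ≈ elem a j → X i ≈ X j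
    X-resp e = extensionality (λ _ → X-⊆ e) (λ _ → X-⊆ (≈-sym e))
    X-disjoint : ∀ {i j z} → z ∈ X i → z ∈ X j → X i ≈ X j
    X-disjoint ((k , s) at d) ((k′ , s′) at d′) =
      X-resp (≈-trans (unsmall s) (≈-trans (proj₁ (opair-injective (≈-trans (≈-sym d) d′))) (≈-sym (unsmall s′))))
    F : V ℓ
    F = sup (Index a) X
    nonempty : ∀ x → Lift (suc ℓ) (x Defs.∈ F) → ∃[ z ] Lift (suc ℓ) (z Defs.∈ x)
    nonempty x m = let i at e = lower∈ {y = F} m in
      opair (elem a i) (g i) , lift∈ (∈-resp-≈ʳ (≈-sym e) ((i , small ≈-refl) at ≈-refl))
    disjoint : ∀ x → Lift (suc ℓ) (x Defs.∈ F) → ∀ y → Lift (suc ℓ) (y Defs.∈ F) →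
      ∃[ z ] Lift (suc ℓ) (z Defs.∈ x) × Lift (suc ℓ) (z Defs.∈ y) → Lift (suc ℓ) (x Defs.≈ y)
    disjoint x m y n (z , zx , zy) = let i at e = lower∈ {y = F} m ; j at d = lower∈ {y = F} n in
      lift≈ (≈-trans e (≈-trans (X-disjoint (∈-resp-≈ʳ e (lower∈ zx)) (∈-resp-≈ʳ d (lower∈ zy))) (≈-sym d)))
    ch = ac F nonempty disjoint
    z : Index a → V ℓ
    z i = proj₁ (proj₂ ch (X i) (lift∈ (elem∈ F i)))
    z-spec : ∀ i z′ → _
    z-spec i = proj₂ (proj₂ ch (X i) (lift∈ (elem∈ F i)))
    z∈ : ∀ i → z i ∈ X i × z i ∈ proj₁ ch
    z∈ i = let m , n = proj₂ (z-spec i (z i)) (lift≈ ≈-refl) in lower∈ m , lower∈ n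
    pick : ∀ i → Σ[ s ∈ (Σ[ j ∈ Index a ] Small (elem a i ≈ elem a j)) ] z i ≈ opair (elem a (proj₁ s)) (g (proj₁ s))
    pick i = let s at e = proj₁ (z∈ i) in s , e
    z-resp : ∀ {i j} → elem a i ≈ elem a j → z i ≈ z j
    z-resp {i} {j} e = lower≈ (proj₁ (z-spec j (z i)) (lift∈ (X-⊆ e (proj₁ (z∈ i))) , lift∈ (proj₂ (z∈ i))))

-- The measure given by an ultrafilter in V.

module Ultrafilter {ℓ : Level} (em : ExcludedMiddle (suc ℓ)) (ac : In-V.Choice {ℓ}) {κ T U : V ℓ}
  (hκ : In-V.IsUncountableCardinal κ) (hU : In-V.IsUltrafilter U T) (complete : In-V.IsComplete U T κ) where
  open Sets {ℓ}
  open Classical em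
  open ChoiceOfIndices em ac
  open In-V {ℓ}

  private
    isCard : IsCardinal κ
    isCard = proj₁ hκ

    variable Φ Ψ : Index T → Set (suc ℓ)

  oκ : Ord κ
  oκ = ordinal⇒ (proj₁ isCard)

  -- Quantifying over all indices that present an element turns a predicate on indices, which need
  -- not respect equality, into a set of elements.
  ⟦_⟧ : (Index T → Set (suc ℓ)) → V ℓ
  ⟦ Φ ⟧ = sup (Σ[ t ∈ Index T ] Small (∀ u → elem T t ≈ elem T u → Φ u)) (elem T ∘ proj₁)

  ∈⟦⟧ : ∀ {x} → x ∈ T → (∀ u → x ≈ elem T u → Φ u) → x ∈ ⟦ Φ ⟧
  ∈⟦⟧ (t at e) h = (t , small λ u d → h u (≈-trans e d)) at e

  ∈⟦⟧⁻ : ∀ {x} → x ∈ ⟦ Φ ⟧ → x ∈ T × (∀ u → x ≈ elem T u → Φ u)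
  ∈⟦⟧⁻ ((t , s) at e) = t at e , λ u d → unsmall s u (≈-trans (≈-sym e) d)

  record AE (Φ : Index T → Set (suc ℓ)) : Set (suc ℓ) where
    constructor mkAE
    field measured : ⟦ Φ ⟧ ∈ U
  open AE public

  ae-mono⊆ : ∀ {X} → X ∈ U → (∀ {x} → x ∈ X → x ∈ ⟦ Φ ⟧) → AE Φ
  ae-mono⊆ {Φ} {X} m h = mkAE (lower∈ (proj₁ (proj₂ (proj₂ (proj₂ hU))) X (lift∈ m) ⟦ Φ ⟧
    (λ z n → lift∈ (h (lower∈ n))) (λ z n → lift∈ {y = T} (proj₁ (∈⟦⟧⁻ {Φ} (lower∈ n))))))

  ae-map : (∀ t → Φ t → Ψ t) → AE Φ → AE Ψ
  ae-map {Φ} {Ψ} f (mkAE m) = ae-mono⊆ m λ n → let d , h = ∈⟦⟧⁻ {Φ} n in ∈⟦⟧ {Ψ} d λ u e → f u (h u e)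

  ae-⊥ : ¬ AE (λ _ → ⊥)
  ae-⊥ (mkAE m) = let z , n = proj₁ (proj₂ (proj₂ hU)) _ (lift∈ m)
                      (t at e) , h = ∈⟦⟧⁻ {λ _ → ⊥} (lower∈ n) in ⊥-elim (h t e)

  ae-~ : AE Φ → AE (λ t → ∀ u → elem T t ≈ elem T u → Φ u)
  ae-~ {Φ} (mkAE m) = ae-mono⊆ m λ n → let d , h = ∈⟦⟧⁻ {Φ} n in
    ∈⟦⟧ {λ t → ∀ u → elem T t ≈ elem T u → Φ u} d λ u e v e′ → h v (≈-trans e e′)

  ae-ultra : (∀ {t u} → elem T t ≈ elem T u → Φ t → Φ u) → AE Φ ⊎ AE (λ t → ¬ Φ t)
  ae-ultra {Φ} r = [ (λ m → inj₁ (mkAE (lower∈ m))) , (λ m → inj₂ (mkAE (lower∈ m))) ]′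
    (proj₂ (proj₂ (proj₂ (proj₂ (proj₂ hU)))) ⟦ Φ ⟧ ⟦ (λ t → ¬ Φ t) ⟧
      (λ z n → lift∈ {y = T} (proj₁ (∈⟦⟧⁻ {Φ} (lower∈ n))))
      λ z → (λ n → let d , h = ∈⟦⟧⁻ {λ t → ¬ Φ t} (lower∈ n) in lift∈ {y = T} d ,
                λ n′ → ⊥₀-elim (h (pos d) (at-eq d) (proj₂ (∈⟦⟧⁻ {Φ} (lower∈ n′)) (pos d) (at-eq d)))) ,
            (λ (d , h) → lift∈ (∈⟦⟧ {λ t → ¬ Φ t} (lower∈ {y = T} d) λ u e φ →
                ⊥-elim (h (lift∈ (∈⟦⟧ {Φ} (lower∈ {y = T} d) λ v e′ → r (≈-trans (≈-sym e) e′) φ))))))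

  Lesser : V ℓ → Set (suc ℓ)
  Lesser a = Injective a κ × ¬ Injective κ a

  lesser⇒≺ : ∀ {a} → Lesser a → a ≺ κ
  lesser⇒≺ {a} (f , h) = injective⇒≼ {a} {κ} f , λ g → ⊥₀-elim (h (≼⇒injective {κ} {a} g))

  ≺⇒lesser : ∀ {a} → a ≺ κ → Lesser a
  ≺⇒lesser {a} (f , h) = ≼⇒injective {a} {κ} f , λ g → ⊥-elim (h (injective⇒≼ {κ} {a} g))

  ∈⇒lesser : ∀ {α} → α ∈ κ → Lesser α
  ∈⇒lesser d = ⊆⇒injective (λ m → proj₁ oκ m d) , cardinal-no-injection isCard d

  -- Completeness speaks of families of cardinality below κ, and the family of the sets ⟦ Φ x ⟧ is
  -- only an image of `a`. Choosing an x for each of its members injects it into `a`.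
  ae-lesser : ∀ {a} {Φ : V ℓ → Index T → Set (suc ℓ)} → Lesser a → (∀ {x y t} → x ≈ y → Φ x t → Φ y t) →
    (∀ x → x ∈ a → AE (Φ x)) → AE (λ t → ∀ x → x ∈ a → Φ x t)
  ae-lesser {a} {Φ} (f , nf) r h = mkAE (lower∈ (complete F
      (λ X m → let i at e = lower∈ {y = F} m in lift∈ (∈-resp-≈ˡ (≈-sym e) (measured (h _ (elem∈ a i)))))
      (lesser⇒≺ {F} (injective-∘ f F→a , λ g → nf (injective-∘ F→a g)))
      ⟦ (λ t → ∀ x → x ∈ a → Φ x t) ⟧ λ z →
        (λ n → let d , k = ∈⟦⟧⁻ {λ t → ∀ x → x ∈ a → Φ x t} (lower∈ n) in lift∈ {y = T} d ,
           λ Y m → let i at e = lower∈ {y = F} m in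
             lift∈ (∈-resp-≈ʳ (≈-sym e) (∈⟦⟧ {Φ (elem a i)} d λ u e′ → k u e′ _ (elem∈ a i)))) ,
        (λ (d , k) → lift∈ (∈⟦⟧ {λ t → ∀ x → x ∈ a → Φ x t} (lower∈ {y = T} d) λ { u e x (i at e′) →
           r (≈-sym e′) (proj₂ (∈⟦⟧⁻ {Φ (elem a i)} (lower∈ (k (X i) (lift∈ (elem∈ F i))))) u e) }))))
    where
    X : Index a → V ℓ
    X i = ⟦ Φ (elem a i) ⟧
    F : V ℓ
    F = sup (Index a) X
    X-⊆ : ∀ {i j z} → elem a i ≈ elem a j → z ∈ X i → z ∈ X j
    X-⊆ {i} {j} e n = let d , k = ∈⟦⟧⁻ {Φ (elem a i)} n in ∈⟦⟧ {Φ (elem a j)} d λ u e′ → r e (k u e′)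
    open Representatives (representatives F (elem a))
    F→a : Injective F a
    F→a = injective ρ ρ-resp (λ {i} {j} e → ≈-trans (ρ-eq i) (≈-trans
      (extensionality (λ _ → X-⊆ {ρ i} {ρ j} e) (λ _ → X-⊆ {ρ j} {ρ i} (≈-sym e))) (≈-sym (ρ-eq j))))

  ae-ℕ : {Φ : ℕ → Index T → Set (suc ℓ)} → (∀ n → AE (Φ n)) → AE (λ t → ∀ n → Φ n t)
  ae-ℕ {Φ} h = ae-map (λ t k n → k (num n) (num∈omega hw n) n ≈-refl)
    (ae-lesser {w} {λ x t → ∀ n → x ≈ num n → Φ n t} (∈⇒lesser w∈) (λ e k n e′ → k n (≈-trans e e′))
      λ x m → let n , e = omega⇒num hw x m in
        ae-map (λ t φ k e′ → subst (λ k → Φ k t) (num-injective n k (≈-trans (≈-sym e) e′)) φ) (h n))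
    where
    w = proj₁ (proj₂ hκ)
    hw : IsOmega w
    hw = proj₁ (proj₂ (proj₂ hκ))
    w∈ : w ∈ κ
    w∈ = lower∈ (proj₂ (proj₂ (proj₂ hκ)))

  measure : ∀ {lam} (m : Index T → V ℓ) → (∀ t → m t ∈ lam) → (∀ {t u} → elem T t ≈ elem T u → m t ≈ m u) →
    (∀ {α} → α ∈ lam → AE (λ t → α ∈ m t)) → Measure κ lam
  measure m m∈ m-resp m-large = record
    { T = Index T ; _~_ = λ t u → elem T t ≈ elem T u ; ~-refl = ≈-refl ; ~-sym = ≈-sym
    ; AE = AE ; ae-map = ae-map ; ae-⊥ = ae-⊥ ; ae-ultra = ae-ultra ; ae-~ = ae-~ ; ae-ℕ = ae-ℕ
    ; ae-κ = λ d r h → ae-lesser (∈⇒lesser d) r h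
    ; choose = λ g → let open Representatives (representatives T g) in ρ , ρ-eq , ρ-resp
    ; m = m ; m∈ = m∈ ; m-resp = m-resp ; m-large = m-large }

-- Sequences coded as sets, and Ulam's argument.

module Sequences {ℓ : Level} (em : ExcludedMiddle (suc ℓ)) where
  open Sets {ℓ}
  open Classical em

  -- With a whole sequence coded as one set, a single application of `choose` makes all of its terms
  -- invariant.
  codeSeq : (ℕ → V ℓ) → V ℓ
  codeSeq e = sup (Lift ℓ ℕ) (λ (lift n) → opair (num n) (e n))

  codeSeq-injective : ∀ {e e′} → codeSeq e ≈ codeSeq e′ → ∀ n → e n ≈ e′ n
  codeSeq-injective {e} {e′} h n = go (∈-resp-≈ʳ h (elem∈ (codeSeq e) (lift n)))
    where
    go : opair (num n) (e n) ∈ codeSeq e′ → e n ≈ e′ n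
    go (lift k at d) = let d₀ , d₁ = opair-injective d in
      subst (λ k → e n ≈ e′ k) (sym (num-injective n k d₀)) d₁

  -- Ulam's argument: some α ∈ κ is uncountable.
  module Ulam {κ : V ℓ} (M : Measure κ κ) (covers : ∀ {α} → α ∈ κ → Cover α) where
    open Measure M
    open AlmostEverywhere em M

    private
      e : T → ℕ → V ℓ
      e t = proj₁ (covers (m∈ t))
      ρ = proj₁ (choose (codeSeq ∘ e))
      ρ~ = proj₁ (proj₂ (choose (codeSeq ∘ e)))

      E : T → ℕ → V ℓ
      E t = e (ρ t)

      E-resp : ∀ {t u} → t ~ u → ∀ n → E t n ≈ E u n
      E-resp h = codeSeq-injective (proj₂ (proj₂ (choose (codeSeq ∘ e))) h)

      Constant : ℕ → V ℓ → Set (suc ℓ)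
      Constant n ξ = AE λ t → ξ ≈ E t n

      -- Almost every m t has ξ at some place of its enumeration, and countable completeness makes
      -- the place constant. Different ξ occupy different constant places, so κ would be countable.
      constant : ∀ {ξ} → ξ ∈ κ → Σ[ n ∈ ℕ ] Constant n ξ
      constant {ξ} d = ae-select {λ n t → ξ ≈ E t n} (λ n h k → ≈-trans k (E-resp h n))
        (ae-map (λ t h → proj₂ (covers (m∈ (ρ t))) (∈-resp-≈ʳ (m-resp (ρ~ t)) h)) (m-large d))

      value : ∀ {n} → Dec (∃ (Constant n)) → V ℓ
      value (yes (ξ , _)) = ξ
      value (no _) = num 0

      value-≈ : ∀ {n ξ} (d : Dec (∃ (Constant n))) → Constant n ξ → ξ ≈ value d
      value-≈ (yes (_ , b)) a = let t , h , h′ = ae-point (ae-× a b) in ≈-trans h (≈-sym h′)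
      value-≈ (no k) a = ⊥₀-elim (k (_ , a))

    κ-covered : Cover κ
    κ-covered = (λ n → value {n} em) , λ d → let n , c = constant d in n , value-≈ em c

-- Every condition of j(P) has a stem.

module Stems {ℓ : Level} (em : ExcludedMiddle (suc ℓ)) {κ P : V ℓ}
  (oκ : Sets.Ord κ) (hP : In-V.IsColl P κ) {lam : V ℓ} (M : Measure κ lam) where
  open Sets {ℓ}
  open Classical em
  open Collapse em {κ} {P} oκ hP
  open Sequences em
  open Measure M
  open Conditions em _≤_ (λ {p} → ≤-refl {p}) (λ {p} {q} {r} → ≤-trans {p} {q} {r}) 𝟙 (λ {p} → ≤-𝟙 {p})
    code (λ {p} {q} → code-≤ {p} {q}) M

  codeTriple : Triple → V ℓ
  codeTriple (a , b , c) = opair a (opair b c)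

  codeTriple-injective : ∀ {x y} → codeTriple x ≈ codeTriple y → x ≈³ y
  codeTriple-injective e = let d₁ , e′ = opair-injective e in d₁ , opair-injective e′

  noConflict⇒compatible : ∀ {p q} → (∀ {α ξ η η′} → Tr p α ξ η → Tr q α ξ η′ → η ≈ η′) → Compatible p q
  noConflict⇒compatible {p} {q} h = built S ,
      tr⇒≤ {p} {built S} (λ t → ⇒built S (inj₁ t)) , tr⇒≤ {q} {built S} (λ t → ⇒built S (inj₂ t))
    where
    open Build
    sel : ℕ → C
    sel zero   = p
    sel (1+ _) = q
    cov′ = cover-⋃ (tr-cover ∘ sel)
    R′ : V ℓ → V ℓ → V ℓ → Set (suc ℓ)
    R′ α ξ η = Tr p α ξ η ⊎ Tr q α ξ η
    func′ : ∀ {α ξ η η′} → R′ α ξ η → R′ α ξ η′ → η ≈ η′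
    func′ (inj₁ t) (inj₁ t′) = tr-func t t′
    func′ (inj₁ t) (inj₂ t′) = h t t′
    func′ (inj₂ t) (inj₁ t′) = ≈-sym (h t′ t)
    func′ (inj₂ t) (inj₂ t′) = tr-func t t′
    S : Triples
    S = record
      { R = R′ ; resp = λ e₁ e₂ e₃ → [ inj₁ ∘ tr-resp e₁ e₂ e₃ , inj₂ ∘ tr-resp e₁ e₂ e₃ ]′
      ; bound = [ tr-bound , tr-bound ]′ ; func = func′
      ; cov = record { enum = enum cov′ ; hits = [ (λ t → hits cov′ (0 , t)) , (λ t → hits cov′ (1 , t)) ]′ } }

  -- The stem consists of the triples that belong to almost all F(t), i.e. it is [F] ↾ κ.
  module Root (F : Cond) where
    private
      g : T → V ℓ
      g t = codeSeq (codeTriple ∘ enum (tr-cover (at-t F t)))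
      ρ = proj₁ (choose g)
      ρ~ = proj₁ (proj₂ (choose g))

      E : T → ℕ → Triple
      E t = enum (tr-cover (at-t F (ρ t)))

      E-resp : ∀ {t u} → t ~ u → ∀ n → E t n ≈³ E u n
      E-resp e n = codeTriple-injective (codeSeq-injective (proj₂ (proj₂ (choose g)) e) n)

      ≈³-sym : ∀ {x y} → x ≈³ y → y ≈³ x
      ≈³-sym (a , b , c) = ≈-sym a , ≈-sym b , ≈-sym c

      ≈³-trans : ∀ {x y z} → x ≈³ y → y ≈³ z → x ≈³ z
      ≈³-trans (a , b , c) (a′ , b′ , c′) = ≈-trans a a′ , ≈-trans b b′ , ≈-trans c c′

      tr-at : ∀ {α ξ η t u} → t ~ u → Tr (at-t F t) α ξ η → Tr (at-t F u) α ξ η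
      tr-at {t = t} {u} e = ≤⇒tr {at-t F u} {at-t F t} (resp-t F (~-sym e))

      R′ : V ℓ → V ℓ → V ℓ → Set (suc ℓ)
      R′ α ξ η = AE λ t → Tr (at-t F t) α ξ η

      Constant : ℕ → Triple → Set (suc ℓ)
      Constant n x = AE λ t → x ≈³ E t n

      -- This makes the stem countable, as in Ulam's argument: each of its triples keeps a constant
      -- place in the enumerations of almost all F(t).
      constant : ∀ {α ξ η} → R′ α ξ η → Σ[ n ∈ ℕ ] Constant n (α , ξ , η)
      constant {α} {ξ} {η} a = ae-select {λ n t → (α , ξ , η) ≈³ E t n} (λ n e h → ≈³-trans h (E-resp e n))
        (ae-map (λ t h → hits (tr-cover (at-t F (ρ t))) (tr-at (ρ~ t) h)) a)

      constantValue : ∀ {n} → Dec (Σ[ x ∈ Triple ] Constant n x) → Triple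
      constantValue (yes (x , _)) = x
      constantValue (no _) = num 0 , num 0 , num 0

      constantValue-≈ : ∀ {n x} (d : Dec (Σ[ x ∈ Triple ] Constant n x)) → Constant n x → x ≈³ constantValue d
      constantValue-≈ (yes (y , b)) a = let t , h , h′ = ae-point (ae-× a b) in ≈³-trans h (≈³-sym h′)
      constantValue-≈ {n} {x} (no k) a = ⊥₀-elim (k (x , a))

      S : Triples
      S = record
        { R = R′ ; resp = λ e₁ e₂ e₃ → ae-map λ t → tr-resp e₁ e₂ e₃
        ; bound = λ a → tr-bound (proj₂ (ae-point a))
        ; func = λ a b → let t , h , h′ = ae-point (ae-× a b) in tr-func h h′
        ; cov = record { enum = λ n → constantValue {n} em ; hits = λ a → let n , c = constant a in n , constantValue-≈ em c } }

      open Build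

      record Agrees (q : C) (α ξ η : V ℓ) (t : T) : Set (suc ℓ) where
        constructor mkAgrees
        field agree : Tr q α ξ η → ∀ {η′} → Tr (at-t F t) α ξ η′ → η ≈ η′
      open Agrees

      HasValue : V ℓ → V ℓ → T → Set (suc ℓ)
      HasValue α ξ t = ∃[ η ] Tr (at-t F t) α ξ η

      module _ {q : C} (q≤ : ∀ {α ξ η} → Tr (built S) α ξ η → Tr q α ξ η) where
        agrees-if-constant : ∀ {α ξ η x} → Tr q α ξ η → R′ α ξ x → AE (Agrees q α ξ η)
        agrees-if-constant {α} {ξ} {η} {x} tq b = ae-map
          (λ t h → mkAgrees λ _ k → ≈-trans (tr-func tq (q≤ (⇒built S b))) (tr-func h k)) b

        ValueAt : V ℓ → V ℓ → V ℓ → T → Set (suc ℓ)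
        ValueAt α ξ x t = Tr (at-t F t) α ξ x

        valueAt-resp : ∀ {α ξ x y t u} → x ≈ y → t ~ u → ValueAt α ξ x t → ValueAt α ξ y u
        valueAt-resp {t = t} {u} e e′ h = tr-resp {at-t F u} ≈-refl ≈-refl e (tr-at {t = t} {u} e′ h)

        bounded-value : ∀ {α ξ t} → HasValue α ξ t → ∃[ x ] x ∈ α × ValueAt α ξ x t
        bounded-value (η , h) = η , proj₂ (proj₂ (tr-bound h)) , h

        -- The value at (α , ξ) lies in α, which is smaller than κ, so κ-completeness makes it
        -- constant. Hence all of [F] below κ is captured by the stem.
        value-constant : ∀ {α ξ} → α ∈ κ → AE (HasValue α ξ) → ∃[ x ] x ∈ α × AE (ValueAt α ξ x)
        value-constant {α} {ξ} d a = ae-selectκ {α} {ValueAt α ξ} d valueAt-resp (ae-map (λ t → bounded-value) a)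

        -- Either almost all F(t) are undefined at (α , ξ) and cannot conflict with q, or their
        -- constant value belongs to the stem and so to q.
        agrees₁ : ∀ {α ξ η} → Tr q α ξ η → AE (HasValue α ξ) ⊎ AE (λ t → ¬ HasValue α ξ t) → AE (Agrees q α ξ η)
        agrees₁ tq (inj₂ a) = ae-map (λ t h → mkAgrees λ _ k → ⊥₀-elim (h (_ , k))) a
        agrees₁ tq (inj₁ a) = let _ , _ , b = value-constant (proj₁ (tr-bound tq)) a in agrees-if-constant tq b

        agrees₂ : ∀ {α ξ η} → Dec (Tr q α ξ η) → AE (Agrees q α ξ η)
        agrees₂ (no h) = ae-map (λ t _ → mkAgrees λ k → ⊥₀-elim (h k)) (ae-const (lift {ℓ = suc ℓ} tt))
        agrees₂ {α} {ξ} (yes tq) = agrees₁ tq (ae-ultra {HasValue α ξ} (λ e (η′ , h) → η′ , tr-at e h))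

        all-agree : AE (λ t → ∀ n → let α , ξ , η = enum (tr-cover q) n in Agrees q α ξ η t)
        all-agree = ae-ℕ λ n → agrees₂ em

    root : C
    root = built S

    root-stem : Stem root F
    root-stem q l = ae-map
      (λ t h → noConflict⇒compatible {q} {at-t F t} λ tq tF →
        let n , e₁ , e₂ , e₃ = hits (tr-cover q) tq in
        ≈-trans e₃ (agree (h n) (tr-resp e₁ e₂ e₃ tq) (tr-resp e₁ e₂ ≈-refl tF)))
      (all-agree {q} (≤⇒tr {q} {built S} l))

  stem : ∀ F → Σ[ p ∈ C ] Stem p F
  stem F = Root.root F , Root.root-stem F

-- The cardinals ℵ₁ and ℵ₂ of the extension.

module Cardinals {ℓ : Level} (em : ExcludedMiddle (suc ℓ))
  {C : Set ℓ} (_≤_ : C → C → Set (suc ℓ)) (≤-refl : ∀ {p} → p ≤ p)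
  (≤-trans : ∀ {p q r} → p ≤ q → q ≤ r → p ≤ r) (𝟙 : C) (≤-𝟙 : ∀ {p} → p ≤ 𝟙) where
  open Sets {ℓ}
  open Classical em
  open Extension em _≤_ ≤-refl ≤-trans 𝟙 ≤-𝟙
  open Injections em _≤_ ≤-refl ≤-trans 𝟙 ≤-𝟙
  open Ordinals em _≤_ ≤-refl ≤-trans 𝟙 ≤-𝟙
  open Regularity em _≤_ ≤-refl ≤-trans 𝟙 ≤-𝟙

  module Omega₁ {ω₁ ω₀ : V ℓ} (ho : In-V.IsOmega ω₀) (o₁ : Ord ω₁) (ω₀∈ω₁ : ω₀ ∈ ω₁)
    (countable : ∀ {α} → α ∈ ω₁ → Injective α ω₀) (uncovered : ¬ Cover ω₁)
    (glb : (f : ℕ → C) → (∀ n → f (1+ n) ≤ f n) → Σ[ g ∈ C ] ((∀ n → g ≤ f n) × (∀ {s} → (∀ n → s ≤ f n) → s ≤ g)))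
    where

    num∈ω₁ : ∀ n → num n ∈ ω₁
    num∈ω₁ n = proj₁ o₁ (num∈omega ho n) ω₀∈ω₁

    private
      module _ {w o : Name} {q : C} (hw : F.IsOmega o q) (cw : F.IsCardinal w q) (ow : q ⊩ o ε w) where
        open Omega hw

        not-countable : ∀ {β} → β ∈ ω₁ → q ⊩ w ≐ check β → ⊥₀
        not-countable {β} d e = ⊥-elim (proj₂ cw o q ≤-refl (unε ow) q ≤-refl
            (proj₁ (≼-subset⇒≃ I o⊆ (λ k m → ε-resp-≐ʳ (≐-mono k e) m) (λ k m → ε-resp-≐ʳ (≐-sym (≐-mono k e)) m))))
          where
          h = countable d
          o⊆ : ∀ {σ p} → p ≤ q → p ⊩ σ ε o → p ⊩ σ ε check β
          o⊆ k m = ε-resp-≐ʳ (≐-mono k e) (tr (ordinal⇒ᴺ (proj₁ cw)) k m (ε-mono k ow))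
          numeral : ∀ {y} → y ∈ ω₀ → ∀ {p} → p ≤ q → p ⊩ check y ε o
          numeral y∈ k = let n , d = omega⇒num ho _ y∈ in ε-resp-≐ˡ (check-≈ (≈-sym d)) (numeral-ω k n)
          I : Inj β (check β) o q
          I = record
            { R = λ x y _ → Graph h x y ; R-mono = λ _ g → g ; R-resp = graph-resp h
            ; R-dom = λ _ d _ → check-∈ d
            ; R-cod = λ { k _ (graph _ e′) → numeral (_ at e′) k }
            ; R-func = λ _ → graph-func h ; R-inj = λ _ → graph-inj h
            ; R-tot = λ l d _ → dense-return λ r k → let y , y∈ , g = graph-tot h d in
                y , check-∈⁻ (o⊆ (≤-trans k l) (numeral y∈ (≤-trans k l))) , g
            ; D⊆ = λ _ → id }

        module _ (I : Inj ω₁ (check ω₁) o q) where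
          open Inj I

          Value : ℕ → C → C → Set (suc ℓ)
          Value n p r = r ≤ p × ∃[ ξ ] ξ ∈ ω₁ × R ξ (num n) r

          next : ∀ n p → Dec (Σ[ r ∈ C ] Value n p r) → C
          next n p (yes (r , _)) = r
          next n p (no _) = p

          next-≤ : ∀ n p d → next n p d ≤ p
          next-≤ n p (yes (_ , l , _)) = l
          next-≤ n p (no _) = ≤-refl

          value : ∀ n p → Dec (Σ[ r ∈ C ] Value n p r) → V ℓ
          value n p (yes (_ , _ , ξ , _)) = ξ
          value n p (no _) = num 0

          value-≈ : ∀ {n p ξ s} (d : Dec (Σ[ r ∈ C ] Value n p r)) → p ≤ q → s ≤ next n p d → ξ ∈ ω₁ →
            R ξ (num n) s → ξ ≈ value n p d
          value-≈ (yes (r , k , ξ′ , _ , h)) l k′ _ h′ = R-inj (≤-trans k′ (≤-trans k l)) h′ (R-mono k′ h)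
          value-≈ (no no′) l k′ d h = ⊥₀-elim (no′ (_ , k′ , _ , d , h))

          -- Step n decides the preimage of n under the injection ω₁ → ω, if any extension can.
          -- Below the limit the whole inverse is known in V and covers ω₁.
          ps : ℕ → C
          ps zero   = q
          ps (1+ n) = next n (ps n) em

          p∞ : Σ[ g ∈ C ] ((∀ n → g ≤ ps n) × (∀ {s} → (∀ n → s ≤ ps n) → s ≤ g))
          p∞ = glb ps (λ n → next-≤ n (ps n) em)

          ps≤ : ∀ n → ps n ≤ q
          ps≤ zero   = ≤-refl
          ps≤ (1+ n) = ≤-trans (next-≤ n (ps n) em) (ps≤ n)

          not-collapsed : ⊥₀
          not-collapsed = uncovered ((λ n → value n (ps n) em) , cov)
            where
            l∞ = proj₁ (proj₂ p∞)
            cov : ∀ {ξ} → ξ ∈ ω₁ → Σ[ n ∈ ℕ ] ξ ≈ value n (ps n) em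
            cov {ξ} d =
              let s , k , y , y∈ , h = R-tot (l∞ 0) d (check-∈ d) (proj₁ p∞) ≤-refl
                  s′ , k′ , n , e = ω-numeral (≤-trans k (l∞ 0)) (R-cod (≤-trans k (l∞ 0)) y∈ h) s ≤-refl
              in n , value-≈ em (ps≤ n) (≤-trans k′ (≤-trans k (l∞ (1+ n)))) d (R-resp ≈-refl (check-≈⁻ e) (R-mono k′ h))

    omega⊆ω₁ : ∀ {o q p σ} → F.IsOmega o q → p ≤ q → p ⊩ σ ε o → p ⊩ σ ε check ω₁
    omega⊆ω₁ hw k m = ε-local (dense-map (Omega.ω-numeral hw k m) λ _ _ (n , e) →
      ε-resp-≐ˡ (≐-sym e) (check-∈ (num∈ω₁ n)))

    -- Trichotomy with ω₁: a smaller ordinal is countable already in V, and a larger one would give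
    -- an injection of ω₁ into ω, which countable closure forbids.
    aleph₁ : ∀ {w p} → F.IsAleph1 w p → p ⊩ w ≐ check ω₁
    aleph₁ {w} h = ≐-local (dense-bind h λ q l (o , hw , cw , ow , all≼) →
      dense-bind (trichotomyᴺ (ordinal⇒ᴺ (proj₁ cw)) (check-ord o₁)) λ
        { r k (inj₂ (inj₁ e)) → dense-return λ s k′ → ≐-mono k′ e
        ; r k (inj₁ m) → dense-bind (check-ε⁻ ω₁ m) λ s k′ (i , e) →
            ⊥₀-elim (not-countable {w} {o} (omega-mono (≤-trans k′ k) hw) (cardinal-down (≤-trans k′ k) cw)
              (ε-mono (≤-trans k′ k) (mkε ow)) (elem∈ ω₁ i) e)
        ; r k (inj₂ (inj₂ m)) →
            let s , k′ , I = ≼⇒inj {ω₁} {o} (all≼ (check ω₁) r k (unε m)) (λ k₁ → omega⊆ω₁ hw (≤-trans k₁ k)) r ≤-refl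
            in ⊥₀-elim (not-collapsed {w} {o} (omega-mono (≤-trans k′ k) hw) (cardinal-down (≤-trans k′ k) cw)
                 (ε-mono (≤-trans k′ k) (mkε ow)) I) })
      where
      cardinal-down : ∀ {w q r} → r ≤ q → F.IsCardinal w q → F.IsCardinal w r
      cardinal-down l ((t , ln) , nb) =
        ((λ x r k → t x r (≤-trans k l)) , (λ x r k → ln x r (≤-trans k l))) , (λ x r k → nb x r (≤-trans k l))

    module Omega₂ {κ : V ℓ} (oκ : Ord κ) (ω₁∈κ : ω₁ ∈ κ)
      (Tr : C → V ℓ → V ℓ → V ℓ → Set (suc ℓ))
      (tr-mono : ∀ {p q α ξ η} → q ≤ p → Tr p α ξ η → Tr q α ξ η)
      (tr-resp : ∀ {p} → Respects₃ (Tr p))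
      (tr-bound : ∀ {p α ξ η} → Tr p α ξ η → α ∈ κ × ξ ∈ ω₁ × η ∈ α)
      (tr-func : ∀ {p α ξ η η′} → Tr p α ξ η → Tr p α ξ η′ → η ≈ η′)
      (collapse : ∀ {α η} → α ∈ κ → η ∈ α → ∀ p → Σ[ q ∈ C ] (q ≤ p × ∃[ ξ ] Tr q α ξ η))
      (code : C → V ℓ) (code-≤ : ∀ {p q} → code p ≈ code q → p ≤ q) (M : Measure κ κ) where
      open Conditions em _≤_ ≤-refl ≤-trans 𝟙 ≤-𝟙 code code-≤ M
      open Measure M

      -- The least ξ at which the generic function g_α takes the value η.
      Least : V ℓ → V ℓ → V ℓ → C → Set (suc ℓ)
      Least α η ξ p = Tr p α ξ η × (∀ {ζ q} → ζ ∈ ξ → q ≤ p → ¬ Tr q α ζ η)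

      collapsed : ∀ {w α p} → α ∈ κ → ω₁ ∈ α → p ⊩ w ≐ check ω₁ → Inj α (check α) w p
      collapsed {w} {α} {p} a d ew = record
        { R = Least α
        ; R-mono = λ l (t , mn) → tr-mono l t , λ m k → mn m (≤-trans k l)
        ; R-resp = λ e e′ (t , mn) → tr-resp ≈-refl e′ e t ,
            λ m k t′ → mn (∈-resp-≈ʳ (≈-sym e′) m) k (tr-resp ≈-refl ≈-refl (≈-sym e) t′)
        ; R-dom = λ _ d _ → check-∈ d
        ; R-cod = λ l _ (t , _) → ε-resp-≐ʳ (≐-sym (≐-mono l ew)) (check-∈ (proj₁ (proj₂ (tr-bound t))))
        ; R-func = λ _ (t , mn) (t′ , mn′) →
            case proj₂ o₁ (proj₁ (proj₂ (tr-bound t))) (proj₁ (proj₂ (tr-bound t′))) of λ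
            { (inj₁ m) → ⊥₀-elim (mn′ m ≤-refl t) ; (inj₂ (inj₁ e)) → e ; (inj₂ (inj₂ m)) → ⊥₀-elim (mn m ≤-refl t′) }
        ; R-inj = λ _ (t , _) (t′ , _) → tr-func t t′
        ; R-tot = λ _ η∈ _ r _ → tot η∈ r (collapse a η∈ r)
        ; D⊆ = λ _ → id }
        where
        Hit : V ℓ → C → V ℓ → Set (suc ℓ)
        Hit η r ξ = Σ[ s ∈ C ] (s ≤ r × Tr s α ξ η)
        tot : ∀ {η} → η ∈ α → ∀ r → Σ[ s ∈ C ] (s ≤ r × ∃[ ξ ] Tr s α ξ η) →
          Σ[ s ∈ C ] (s ≤ r × ∃[ ξ ] ξ ∈ α × Least α η ξ s)
        tot {η} η∈ r (s₀ , l₀ , ξ₀ , t₀) =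
          -- The least ξ is sought among all the arguments that any extension of r sends to η, so
          -- that s also forces it to be least.
          let ξ , (s , l , t) , mn = ∈-least (Hit η r) (λ e (s , l , t) → s , l , tr-resp ≈-refl e ≈-refl t) ξ₀ (s₀ , l₀ , t₀)
          in s , l , ξ , proj₁ (ord-∈ oκ a) (proj₁ (proj₂ (tr-bound t))) d , t , λ m k t′ → mn _ m (_ , ≤-trans k l , t′)

      module Stemmed (stem : ∀ F → Σ[ p ∈ C ] Stem p F) where

        -- A stem of F makes F(t₀) compatible with F(t) for almost all t.
        TwoPoints : Cond → (T → Set (suc ℓ)) → Set (suc (suc ℓ))
        TwoPoints F Φ = Σ[ t₀ ∈ T ] Φ t₀ × Σ[ s ∈ C ] s ≤ at-t F t₀ ×
          (∀ {Ψ : T → Set (suc ℓ)} → AE Ψ → Σ[ t ∈ T ] Φ t × Ψ t × Σ[ r ∈ C ] r ≤ s × r ≤ at-t F t)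

        two-points : (F : Cond) {Φ : T → Set (suc ℓ)} → AE Φ → TwoPoints F Φ
        two-points F {Φ} a = go (ae-point (ae-× a (proj₂ (stem F) (proj₁ (stem F)) ≤-refl)))
          where
          go : Σ[ t ∈ T ] Φ t × Compatible (proj₁ (stem F)) (at-t F t) → TwoPoints F Φ
          go (t₀ , φ , s , k , k′) = t₀ , φ , s , k′ , λ b →
            let t , φ′ , ψ , r , h , h′ = ae-point (ae-× a (ae-× b (proj₂ (stem F) s k))) in t , φ′ , ψ , r , h , h′

        κ-preserved : ∀ {w q} → q ⊩ w ≐ check ω₁ → Inj κ (check κ) w q → ⊥₀
        κ-preserved {w} {q} ew I = go (choice R′ r-resp (ae-map (λ t _ → decided t) (ae-const (lift {ℓ = suc ℓ} tt))))
          where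
          open Inj I
          R′ : T → C → Set (suc ℓ)
          R′ t c = c ≤ q × ∃[ ξ ] ξ ∈ ω₁ × R (m t) ξ c
          r-resp : ∀ {t u c} → t ~ u → R′ t c → R′ u c
          r-resp e (l , ξ , d , h) = l , ξ , d , R-resp (m-resp e) ≈-refl h
          decided : ∀ t → Σ[ c ∈ C ] R′ t c
          decided t = let s , k , y , y∈ , h = R-tot ≤-refl (m∈ t) (check-∈ (m∈ t)) q ≤-refl
                      in s , k , y , check-∈⁻ (ε-resp-≐ʳ (≐-mono k ew) (R-cod k y∈ h)) , h
          go : Σ[ F ∈ Cond ] AE (λ t → R′ t (at-t F t)) → ⊥₀
          go (F , a) = go₁ (ae-selectκ {ω₁} {λ ξ t → at-t F t ≤ q × R (m t) ξ (at-t F t)} ω₁∈κ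
              (λ e e′ (l , h) → ≤-trans (resp-t F (~-sym e′)) l , R-mono (resp-t F (~-sym e′)) (R-resp (m-resp e′) e h))
              (ae-map (λ t (l , ξ , d , h) → ξ , d , l , h) a))
            where
            go₁ : (∃[ ξ ] ξ ∈ ω₁ × AE (λ t → at-t F t ≤ q × R (m t) ξ (at-t F t))) → ⊥₀
            go₁ (ξ , _ , b) =
              let t₀ , (l₀ , h₀) , s , k , f = two-points F b
                  t , (l , h) , lt , r , k₁ , k₂ = f (m-large (m∈ t₀))
              in ∈-irrefl (R-inj (≤-trans k₂ l) (R-mono (≤-trans k₁ k) h₀) (R-mono k₂ h)) lt

        aleph₂ : ∀ {l p} → F.IsAleph2 l p → p ⊩ l ≐ check κ
        aleph₂ {l} h = ≐-local (dense-bind h λ q _ (w , hw , cl , wl , all≼) →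
          let ew = aleph₁ hw in
          dense-bind (trichotomyᴺ (ordinal⇒ᴺ (proj₁ cl)) (check-ord oκ)) λ
            { r k (inj₂ (inj₁ e)) → dense-return λ s k′ → ≐-mono k′ e
            ; r k (inj₁ m) → dense-bind (check-ε⁻ κ m) λ s k′ (i , e) →
                ⊥₀-elim (not-small cl (≤-trans k′ k) (ε-mono (≤-trans k′ k) (mkε wl)) (≐-mono (≤-trans k′ k) ew) (elem∈ κ i) e)
            ; r k (inj₂ (inj₂ m)) →
                let s , k′ , I = ≼⇒inj {κ} {w} (all≼ (check κ) r k (unε m)) (λ k₁ n →
                       w⊆κ (≐-mono (≤-trans k₁ k) ew) n) r ≤-refl
                in ⊥₀-elim (κ-preserved (≐-mono (≤-trans k′ k) ew) I) })
          where
          w⊆κ : ∀ {w p σ} → p ⊩ w ≐ check ω₁ → p ⊩ σ ε w → p ⊩ σ ε check κ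
          w⊆κ ew n = tr (check-ord oκ) ≤-refl (ε-resp-≐ʳ ew n) (check-∈ ω₁∈κ)
          not-small : ∀ {l w q s α} → F.IsCardinal l q → s ≤ q → s ⊩ w ε l → s ⊩ w ≐ check ω₁ → α ∈ κ → s ⊩ l ≐ check α → ⊥₀
          not-small {l} {w} {q} {s} {α} cl k wl ew a e = ⊥-elim (proj₂ cl w s k (unε wl) s ≤-refl
            (proj₁ (≼-subset⇒≃ (collapsed {w} {α} {s} a (check-∈⁻ (ε-resp-≐ʳ e (ε-resp-≐ˡ ew wl))) ew)
              (λ k′ n → ε-resp-≐ʳ (≐-mono k′ e) (tr (ordinal⇒ᴺ (proj₁ cl)) (≤-trans k′ k) n (ε-mono k′ wl)))
              (λ k′ n → ε-resp-≐ʳ (≐-mono k′ e) n) (λ k′ n → ε-resp-≐ʳ (≐-sym (≐-mono k′ e)) n))))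

        -- Let almost every F(t) force a value of f at ζ outside m t. For compatible F(t₀) and F(t)
        -- the two values agree, yet the value at t₀ belongs to m t for almost all t. So m t bounds
        -- f(ζ) almost everywhere, and by κ-completeness some m t bounds f(ζ) for all ζ ∈ ξ.
        κ-regular : ∀ {p} → Regular κ p
        κ-regular {p} {ξ} {q} _ d f r k = r , ≤-refl , γ , γ∈ , λ {ζ} {δ} {s} k′ ζ∈ h → bd ζ ζ∈ δ s (≤-trans k′ k) h
          where
          open KFun f
          Φ : V ℓ → T → Set (suc ℓ)
          Φ ζ t = ∀ δ s → s ≤ q → R ζ δ s → δ ∈ m t
          module _ {ζ} (a : AE (λ t → ¬ Φ ζ t)) where
            R′ : T → C → Set (suc ℓ)
            R′ t c = c ≤ q × ∃[ δ ] R ζ δ c × ¬ (δ ∈ m t)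
            refute : Σ[ F ∈ Cond ] AE (λ t → R′ t (at-t F t)) → ⊥₀
            refute (F , b) =
              let t₀ , (l₀ , δ₀ , h₀ , _) , s , k , g = two-points F b
                  t , (l , δ , h , n) , δ₀t , r , k₁ , k₂ = g (m-large (R-cod h₀))
              in n (∈-resp-≈ˡ (R-func (≤-trans k₂ l) (R-mono (≤-trans k₁ k) h₀) (R-mono k₂ h)) δ₀t)
            witness : ∀ t → ¬ Φ ζ t → Σ[ c ∈ C ] R′ t c
            witness t h = by-contra λ no → h λ δ s k x → by-contra λ n → no (s , k , δ , x , n)
            absurd : ⊥₀
            absurd = refute (choice R′ (λ e (l , δ , h , n) → l , δ , h , λ n′ → n (∈-resp-≈ʳ (≈-sym (m-resp e)) n′))
              (ae-map witness a))
          ae-Φ : ∀ ζ → ζ ∈ ξ → AE (Φ ζ)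
          ae-Φ ζ _ = [ id , (λ a → ⊥₀-elim (absurd a)) ]′
            (ae-ultra {Φ ζ} (λ e h δ s k x → ∈-resp-≈ʳ (m-resp e) (h δ s k x)))
          pt = ae-point (ae-κ {Φ = Φ} d (λ e h δ s k x → h δ s k (R-resp (≈-sym e) ≈-refl x)) ae-Φ)
          γ = m (proj₁ pt)
          γ∈ = m∈ (proj₁ pt)
          bd = proj₂ pt

  -- If no extension of q₁ decided a bound, the name of the relation would be forced to be cofinal:
  -- above each γ some value not in γ can be forced densely.
  regular⇒ : ∀ {l lam p} → Ord lam → p ⊩ l ≐ check lam → F.IsRegular l p → Regular lam p
  regular⇒ {l} {lam} {p} ol e (_ , _ , reg) {ξ} {q} k d f q₁ k₁ = by-contra {Σ[ s ∈ C ] (s ≤ q₁ × Bound s)} λ no →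
    ⊥-elim (reg (check ξ) q k (unε (ε-resp-≐ʳ (≐-sym (≐-mono k e)) (check-∈ d))) rel q ≤-refl isFun q₁ k₁
      λ β r k₂ β∈ → dense-bind (check-ε⁻ lam (ε-resp-≐ʳ (≐-mono (≤-trans k₂ (≤-trans k₁ k)) e) (mkε β∈))) λ
        s k₃ (i , eβ) s₁ k₄ →
          cofinal no s₁ (≤-trans k₄ (≤-trans k₃ k₂)) (elem∈ lam i) (≐-mono k₄ eβ))
    where
    open KFun f
    open Relation ξ lam R R-mono R-resp
    isFun : F.IsFun rel (λ σ → forces-∈ σ (check ξ)) (λ σ → forces-∈ σ l) q
    isFun = rel-isFun {A = λ σ → forces-∈ σ (check ξ)} {B = λ σ → forces-∈ σ l} R-func
      (λ h a b _ → unε (check-∈ a) , unε (ε-resp-≐ʳ (≐-sym (≐-mono (≤-trans h k) e)) (check-∈ b)))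
      (λ h m → dense-bind (check-ε⁻ ξ (mkε m)) λ r k₁ (i , e′) →
        dense-map (R-tot (≤-trans k₁ h) (elem∈ ξ i)) λ s k₂ (y , x) → _ , y , elem∈ ξ i , R-cod x , ≐-mono k₂ e′ , x)
    Bound : C → Set (suc ℓ)
    Bound r = ∃[ γ ] γ ∈ lam × (∀ {ζ δ s} → s ≤ r → ζ ∈ ξ → R ζ δ s → δ ∈ γ)
    Exceeds : Name → C → Set (suc ℓ)
    Exceeds β s = ∃[ ζ ] forces-∈ ζ (check ξ) s × Dense s (λ t → ∃[ η ] F.Maps rel ζ η t × F._⊆_ β η t)
    ord⊆ : ∀ {β γ δ s} → s ⊩ β ≐ check γ → γ ∈ lam → δ ∈ lam → ¬ (δ ∈ γ) → F._⊆_ β (check δ) s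
    ord⊆ {β} {γ} {δ} eβ a b n σ r k′ m = unε (ε-local (dense-map (check-ε⁻ γ (ε-resp-≐ʳ (≐-mono k′ eβ) (mkε m))) λ
      _ _ (i , e′) → ε-resp-≐ˡ (≐-sym e′) (check-∈ (case proj₂ ol a b of λ
        { (inj₁ γδ) → proj₁ (ord-∈ ol b) (elem∈ γ i) γδ
        ; (inj₂ (inj₁ γδ)) → ∈-resp-≈ʳ γδ (elem∈ γ i)
        ; (inj₂ (inj₂ δγ)) → ⊥₀-elim (n δγ) }))))
    cofinal : ¬ (Σ[ s ∈ C ] (s ≤ q₁ × Bound s)) → ∀ {β γ} s → s ≤ q₁ → γ ∈ lam → s ⊩ β ≐ check γ →
      Σ[ t ∈ C ] (t ≤ s × Exceeds β t)
    cofinal unbd {β} {γ} s k₂ γ∈ eβ = by-contra {Σ[ t ∈ C ] (t ≤ s × Exceeds β t)} λ h →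
      unbd (s , k₂ , γ , γ∈ , λ {ζ} {δ} {s′} k₃ ζ∈ x → by-contra {δ ∈ γ} λ n →
        h (s′ , k₃ , check ζ , unε (check-∈ ζ∈) , λ t k₄ → t , ≤-refl , check δ ,
          rel-maps ζ∈ (R-cod x) (R-mono k₄ x) , ord⊆ (≐-mono (≤-trans k₄ k₃) eβ) γ∈ (R-cod x) n))

-- Measures from measurable and supercompact cardinals.

module LargeCardinals {ℓ : Level} (em : ExcludedMiddle (suc ℓ)) (ac : In-V.Choice {ℓ}) where
  open Sets {ℓ}
  open Classical em
  open ChoiceOfIndices em ac
  open In-V {ℓ}

  measurable⇒measure : ∀ {κ} → IsMeasurable κ → Measure κ κ
  measurable⇒measure {κ} (hκ , U , hU , complete , nonprincipal) =
    measure (elem κ) (elem∈ κ) id large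
    where
    open Ultrafilter em ac {κ} {κ} {U} hκ hU complete

    avoids : ∀ x → x ∈ κ → AE (λ t → ¬ (elem κ t ≈ x))
    avoids x d = [ (λ a → ⊥-elim (nonprincipal x (lift∈ d) ⟦ (λ t → elem κ t ≈ x) ⟧ (singleton d) (lift∈ (measured a)))) , id ]′
      (ae-ultra {λ t → elem κ t ≈ x} (λ e e′ → ≈-trans (≈-sym e) e′))
      where
      singleton : x ∈ κ → IsUPair ⟦ (λ t → elem κ t ≈ x) ⟧ x x
      singleton d = ⇒upair (extensionality
        (λ z n → let (t at e) , h = ∈⟦⟧⁻ {λ t → elem κ t ≈ x} n in ∈upairˡ (≈-trans e (h t e)))
        (λ z n → let e = [ id , id ]′ (∈upair⁻ n) in
          ∈⟦⟧ {λ t → elem κ t ≈ x} (∈-resp-≈ˡ (≈-sym e) d) (λ u e′ → ≈-trans (≈-sym e′) e)))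

    -- Almost every element of κ differs from α and from all members of α, by nonprincipality and
    -- κ-completeness; such an element lies above α.
    large : ∀ {α} → α ∈ κ → AE (λ t → α ∈ elem κ t)
    large {α} d = ae-map (λ t h → beyond t (h α (∈succʳ ≈-refl)) λ b b∈ → h b (∈succˡ b∈))
      (ae-succ λ x m → avoids x (below m))
      where
      below : ∀ {x} → x ∈ succ α → x ∈ κ
      below m = [ (λ n → proj₁ oκ n d) , (λ e → ∈-resp-≈ˡ (≈-sym e) d) ]′ (∈succ⁻ m)
      beyond : ∀ t → ¬ (elem κ t ≈ α) → (∀ b → b ∈ α → ¬ (elem κ t ≈ b)) → α ∈ elem κ t
      beyond t n h = case proj₂ oκ d (elem∈ κ t) of λ
        { (inj₁ m) → m ; (inj₂ (inj₁ e)) → ⊥₀-elim (n (≈-sym e)) ; (inj₂ (inj₂ m)) → ⊥₀-elim (h _ m ≈-refl) }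
      ae-succ : (∀ x → x ∈ succ α → AE (λ t → ¬ (elem κ t ≈ x))) → AE (λ t → ∀ x → x ∈ succ α → ¬ (elem κ t ≈ x))
      ae-succ h = ae-map
        (λ { t k x m → [ k 0 x , (λ e e′ → k 1 (≈-trans e′ e)) ]′ (∈succ⁻ m) })
        (ae-ℕ {Φs} λ { zero → ae-lesser (∈⇒lesser d) (λ e k e′ → k (≈-trans e′ (≈-sym e))) (λ x m → h x (∈succˡ m))
                     ; (1+ _) → h α (∈succʳ ≈-refl) })
        where
        Φs : ℕ → Index κ → Set (suc ℓ)
        Φs zero   t = ∀ x → x ∈ α → ¬ (elem κ t ≈ x)
        Φs (1+ _) t = ¬ (elem κ t ≈ α)

  -- Boolean characteristic functions form a type at level ℓ and can therefore index a set; excluded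
  -- middle supplies one for every subset.
  subset : (A : V ℓ) → (Index A → Bool) → V ℓ
  subset A f = sup (Σ[ i ∈ Index A ] Lift ℓ (f i ≡ true)) (elem A ∘ proj₁)

  smallSubsets : V ℓ → V ℓ → V ℓ
  smallSubsets κ A = sup (Σ[ f ∈ (Index A → Bool) ] Small (subset A f ≺ κ)) (subset A ∘ proj₁)

  ≺-resp : ∀ {κ} → Respects (_≺ κ)
  ≺-resp {κ} {x} {y} e (f , n) =
    injective⇒≼ {y} {κ} (injective-∘ (≼⇒injective {x} {κ} f) (⊆⇒injective (∈-resp-≈ʳ (≈-sym e)))) ,
    λ g → n (injective⇒≼ {κ} {x} (injective-∘ (⊆⇒injective (∈-resp-≈ʳ (≈-sym e))) (≼⇒injective {κ} {y} g)))

  smallSubsets-spec : ∀ κ A → IsSmallPowerset (smallSubsets κ A) κ A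
  smallSubsets-spec κ A x =
    (λ m → let (f , s) at e = lower∈ {y = smallSubsets κ A} m in
       (λ z n → let (i , _) at d = ∈-resp-≈ʳ e (lower∈ n) in lift∈ {y = A} (i at d)) ,
       ≺-resp {κ} (≈-sym e) (unsmall s)) ,
    (λ (sub , sm) → let e = cut (λ n → lower∈ (sub _ (lift∈ n))) in
       lift∈ {y = smallSubsets κ A} ((char , small (≺-resp {κ} e sm)) at e))
    where
    char : Index A → Bool
    char i = ⌊ em {elem A i ∈ x} ⌋
    char-true : ∀ {B : Set (suc ℓ)} (d : Dec B) → B → ⌊ d ⌋ ≡ true
    char-true (yes _) _ = refl
    char-true (no h) b = ⊥₀-elim (h b)
    true-char : ∀ {B : Set (suc ℓ)} (d : Dec B) → ⌊ d ⌋ ≡ true → B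
    true-char (yes b) _ = b
    true-char (no _) ()
    cut : (∀ {z} → z ∈ x → z ∈ A) → x ≈ subset A char
    cut s = extensionality
      (λ z n → let i at e = s n in (i , lift (char-true em (∈-resp-≈ˡ e n))) at e)
      (λ { z ((i , lift c) at e) → ∈-resp-≈ˡ (≈-sym e) (true-char em c) })

  module Supercompact {κ A : V ℓ} (hκ : IsSupercompact κ) (κ⊆A : ∀ {x} → x ∈ κ → x ∈ A) where
    T : V ℓ
    T = smallSubsets κ A

    private
      sc = proj₂ hκ A (injective⇒≼ {κ} {A} (⊆⇒injective κ⊆A)) T (smallSubsets-spec κ A)
      U : V ℓ
      U = proj₁ sc
    open Ultrafilter em ac {κ} {T} {U} (proj₁ hκ) (proj₁ (proj₂ sc)) (proj₁ (proj₂ (proj₂ sc))) public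

    T-⊆ : ∀ t {a} → a ∈ elem T t → a ∈ A
    T-⊆ t n = lower∈ (proj₁ (proj₁ (smallSubsets-spec κ A (elem T t)) (lift∈ (elem∈ T t))) _ (lift∈ n))

    T-lesser : ∀ t → Lesser (elem T t)
    T-lesser t = ≺⇒lesser (proj₂ (proj₁ (smallSubsets-spec κ A (elem T t)) (lift∈ (elem∈ T t))))

    fine : ∀ {a} → a ∈ A → AE (λ t → a ∈ elem T t)
    fine {a} d = mkAE (lower∈ (proj₁ (proj₂ (proj₂ (proj₂ sc))) a (lift∈ d) ⟦ (λ t → a ∈ elem T t) ⟧ λ x →
      (λ n → let (t at e) , h = ∈⟦⟧⁻ {λ t → a ∈ elem T t} (lower∈ n) in
         lift∈ {y = T} (t at e) , lift∈ (∈-resp-≈ʳ (≈-sym e) (h t e))) ,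
      (λ (m , n) → lift∈ (∈⟦⟧ {λ t → a ∈ elem T t} (lower∈ {y = T} m) λ u e → ∈-resp-≈ʳ e (lower∈ n)))))

    -- Pushing the fine measure forward along the bounds gives `m-large`: almost every t contains a
    -- given a, so its bound lies above a.
    measure-of-bounds : (∀ t → Σ[ i ∈ Index A ] (∀ {a} → a ∈ elem T t → a ∈ elem A i)) → Measure κ A
    measure-of-bounds b = measure (bd ∘ ρ) (λ t → elem∈ A (proj₁ (b (ρ t)))) ρ-resp
      (λ d → ae-map (λ t n → proj₂ (b (ρ t)) (∈-resp-≈ʳ (ρ-eq t) n)) (fine d))
      where
      bd : Index T → V ℓ
      bd t = elem A (proj₁ (b t))
      open Representatives (representatives T bd)

  supercompact⇒measure : ∀ {κ} → IsSupercompact κ → Measure κ κ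
  supercompact⇒measure {κ} hκ = measure-of-bounds bounded
    where
    open Supercompact {κ} {κ} hκ id

    too-big : ¬ AE (λ t → ∀ x → x ∈ κ → x ∈ elem T t)
    too-big a = ae-⊥ (ae-map (λ t h → ⊥₀-elim (proj₂ (T-lesser t) (⊆⇒injective (λ {x} → h x)))) a)

    contains : ∀ {α} → α ∈ κ → AE (λ t → ∀ x → x ∈ α → x ∈ elem T t)
    contains d = ae-lesser (∈⇒lesser d) ∈-resp-≈ˡ (λ x m → fine (proj₁ oκ m d))

    -- A largest element b would put κ = b ∪ {b} inside almost every t, although t has fewer than κ
    -- elements.
    limit : ∀ {b} → b ∈ κ → ∃[ γ ] γ ∈ κ × b ∈ γ
    limit {b} d = by-contra λ no′ → too-big (ae-map
      (λ t h x x∈ → case proj₂ oκ x∈ d of λ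
        { (inj₁ m) → h 0 x m ; (inj₂ (inj₁ e)) → ∈-resp-≈ˡ (≈-sym e) (h 1) ; (inj₂ (inj₂ m)) → ⊥₀-elim (no′ (x , x∈ , m)) })
      (ae-ℕ {Φs} λ { zero → contains d ; (1+ _) → fine d }))
      where
      Φs : ℕ → Index T → Set (suc ℓ)
      Φs zero   t = ∀ x → x ∈ b → x ∈ elem T t
      Φs (1+ _) t = b ∈ elem T t

    bounded : ∀ t → Σ[ i ∈ Index κ ] (∀ {a} → a ∈ elem T t → a ∈ elem κ i)
    bounded t =
      let γ , γ∈ , h = by-contra {∃[ γ ] γ ∈ κ × (∀ a → a ∈ elem T t → ¬ (γ ∈ a))} unbounded⇒⊥
          γ′ , γ′∈ , m = limit γ∈
      in pos γ′∈ , λ a∈ → ∈-resp-≈ʳ (at-eq γ′∈) (below γ∈ γ′∈ m (h _ a∈) (T-⊆ t a∈))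
      where
      below : ∀ {γ γ′ a} → γ ∈ κ → γ′ ∈ κ → γ ∈ γ′ → ¬ (γ ∈ a) → a ∈ κ → a ∈ γ′
      below γ∈ γ′∈ m n a∈ = case proj₂ oκ a∈ γ∈ of λ
        { (inj₁ k) → proj₁ (ord-∈ oκ γ′∈) k m ; (inj₂ (inj₁ e)) → ∈-resp-≈ˡ (≈-sym e) m ; (inj₂ (inj₂ k)) → ⊥₀-elim (n k) }
      -- The regularity of κ, from fineness and completeness: almost every s includes each a ∈ t as
      -- a subset, and if t were cofinal such an s would contain all of κ.
      unbounded⇒⊥ : ¬ (∃[ γ ] γ ∈ κ × (∀ a → a ∈ elem T t → ¬ (γ ∈ a))) → ⊥₀
      unbounded⇒⊥ no′ = too-big (ae-map
        (λ s h x x∈ → by-contra λ n → no′ (x , x∈ , λ a a∈ m → n (h a a∈ x m)))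
        (ae-lesser {elem T t} {λ a s → ∀ x → x ∈ a → x ∈ elem T s} (T-lesser t)
          (λ e h x m → h x (∈-resp-≈ʳ (≈-sym e) m)) (λ a m → contains (T-⊆ t m))))

  module _ {C : Set ℓ} (_≤_ : C → C → Set (suc ℓ)) (≤-refl : ∀ {p} → p ≤ p)
    (≤-trans : ∀ {p q r} → p ≤ q → q ≤ r → p ≤ r) (𝟙 : C) (≤-𝟙 : ∀ {p} → p ≤ 𝟙) where
    open Regularity em _≤_ ≤-refl ≤-trans 𝟙 ≤-𝟙

    -- Members of P_κ(λ) are bounded in λ by its regularity in the extension: the inverse of an
    -- injection t → κ, with value 0 off the range, is a function κ → λ of V, and a bound decided by
    -- a condition is a bound in V.
    supercompact⇒measure-on : ∀ {κ lam p} → IsSupercompact κ → Ord lam → κ ∈ lam → Regular lam p → Measure κ lam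
    supercompact⇒measure-on {κ} {lam} {p} hκ ol κ∈ reg = measure-of-bounds bounded
      where
      open Supercompact {κ} {lam} hκ (λ m → proj₁ ol m κ∈)

      num0∈ : num 0 ∈ lam
      num0∈ = proj₁ ol (proj₁ oκ (num∈omega (proj₁ (proj₂ (proj₂ (proj₁ hκ)))) 0) (lower∈ (proj₂ (proj₂ (proj₂ (proj₁ hκ)))))) κ∈

      module _ (t : Index T) where
        f : Injective (elem T t) κ
        f = proj₁ (T-lesser t)
        Inverse : V ℓ → V ℓ → Set (suc ℓ)
        Inverse ζ δ = δ ∈ elem T t × Graph f δ ζ
        Default : V ℓ → V ℓ → Set (suc ℓ)
        Default ζ δ = ¬ (∃[ δ′ ] Inverse ζ δ′) × δ ≈ num 0

        kfun : KFun κ lam p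
        kfun = record
          { R = λ ζ δ _ → Inverse ζ δ ⊎ Default ζ δ
          ; R-mono = λ _ h → h
          ; R-resp = λ { e e′ (inj₁ (d , g)) → inj₁ (∈-resp-≈ˡ e′ d , graph-resp f e′ e g)
                       ; e e′ (inj₂ (n , d)) → inj₂ ((λ (δ , d , g) → n (δ , d , graph-resp f ≈-refl (≈-sym e) g)) , ≈-trans (≈-sym e′) d) }
          ; R-cod = λ { (inj₁ (d , _)) → T-⊆ t d ; (inj₂ (_ , e)) → ∈-resp-≈ˡ (≈-sym e) num0∈ }
          ; R-func = λ { _ (inj₁ (_ , g)) (inj₁ (_ , g′)) → graph-inj f g g′
                       ; _ (inj₁ h) (inj₂ (n , _)) → ⊥₀-elim (n (_ , h))
                       ; _ (inj₂ (n , _)) (inj₁ h) → ⊥₀-elim (n (_ , h))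
                       ; _ (inj₂ (_ , e)) (inj₂ (_ , e′)) → ≈-trans e (≈-sym e′) }
          ; R-tot = λ {ζ} _ _ q _ → q , ≤-refl , tot ζ em }
          where
          tot : ∀ ζ → Dec (∃[ δ ] Inverse ζ δ) → ∃[ δ ] (Inverse ζ δ ⊎ Default ζ δ)
          tot ζ (yes (δ , h)) = δ , inj₁ h
          tot ζ (no n) = num 0 , inj₂ (n , ≈-refl)

        bounded : Σ[ i ∈ Index lam ] (∀ {a} → a ∈ elem T t → a ∈ elem lam i)
        bounded = let r , k , γ , γ∈ , h = reg ≤-refl κ∈ kfun p ≤-refl in
          pos γ∈ , λ a∈ → let ζ , ζ∈ , g = graph-tot f a∈ in ∈-resp-≈ʳ (at-eq γ∈) (h ≤-refl ζ∈ (inj₁ (a∈ , g)))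

-- The arrow relations in the extension.

module Arrows {ℓ : Level} (em : ExcludedMiddle (suc ℓ)) (ac : In-V.Choice {ℓ})
  {C : Set ℓ} (_≤_ : C → C → Set (suc ℓ)) (≤-refl : ∀ {p} → p ≤ p)
  (≤-trans : ∀ {p q r} → p ≤ q → q ≤ r → p ≤ r) (𝟙 : C) (≤-𝟙 : ∀ {p} → p ≤ 𝟙)
  (code : C → V ℓ) (code-≤ : ∀ {p q} → Sets._≈_ (code p) (code q) → p ≤ q)
  (meet : ∀ {p q} → Σ[ r ∈ C ] (r ≤ p × r ≤ q) → Σ[ r ∈ C ] (r ≤ p × r ≤ q × (∀ {s} → s ≤ p → s ≤ q → s ≤ r)))
  (glb : (f : ℕ → C) → (∀ n → f (1+ n) ≤ f n) → Σ[ g ∈ C ] ((∀ n → g ≤ f n) × (∀ {s} → (∀ n → s ≤ f n) → s ≤ g)))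
  {κ : V ℓ}
  (stem : ∀ {lam} (M : Measure κ lam) (F : Conditions.Cond em _≤_ ≤-refl ≤-trans 𝟙 ≤-𝟙 code code-≤ M) →
          Σ[ p ∈ C ] Conditions.Stem em _≤_ ≤-refl ≤-trans 𝟙 ≤-𝟙 code code-≤ M p F) where
  open Sets {ℓ}
  open Classical em
  open Extension em _≤_ ≤-refl ≤-trans 𝟙 ≤-𝟙
  open Ordinals em _≤_ ≤-refl ≤-trans 𝟙 ≤-𝟙
  open Regularity em _≤_ ≤-refl ≤-trans 𝟙 ≤-𝟙
  module Card = Cardinals em _≤_ ≤-refl ≤-trans 𝟙 ≤-𝟙
  module Large = LargeCardinals em ac

  arrow-at : ∀ {lam p l} → Measure κ lam → Ord lam → Regular lam p → p ⊩ l ≐ check lam → F.HCArrow l p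
  arrow-at {lam} M ol reg hl =
    Arrow.hcArrow em _≤_ ≤-refl ≤-trans 𝟙 ≤-𝟙 code code-≤ M meet glb (stem M) ol reg hl

  module _ {ω₁ ω₀ : V ℓ} (ho : In-V.IsOmega ω₀) (o₁ : Ord ω₁) (ω₀∈ω₁ : ω₀ ∈ ω₁)
    (countable : ∀ {α} → α ∈ ω₁ → Injective α ω₀) (uncovered : ¬ Cover ω₁)
    (oκ : Ord κ) (ω₁∈κ : ω₁ ∈ κ)
    (Tr : C → V ℓ → V ℓ → V ℓ → Set (suc ℓ))
    (tr-mono : ∀ {p q α ξ η} → q ≤ p → Tr p α ξ η → Tr q α ξ η)
    (tr-resp : ∀ {p} → Respects₃ (Tr p))
    (tr-bound : ∀ {p α ξ η} → Tr p α ξ η → α ∈ κ × ξ ∈ ω₁ × η ∈ α)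
    (tr-func : ∀ {p α ξ η η′} → Tr p α ξ η → Tr p α ξ η′ → η ≈ η′)
    (collapse : ∀ {α η} → α ∈ κ → η ∈ α → ∀ p → Σ[ q ∈ C ] (q ≤ p × ∃[ ξ ] Tr q α ξ η))
    (M : Measure κ κ) where
    private
      open module O = Card.Omega₁ ho o₁ ω₀∈ω₁ countable uncovered glb
      open module O₂ = O.Omega₂ oκ ω₁∈κ Tr tr-mono tr-resp tr-bound tr-func collapse code code-≤ M
      open module O₃ = O₂.Stemmed (stem M)

    arrow-aleph₂ : ∀ p → F.HCArrowAtAleph2 p
    arrow-aleph₂ p l q k h = arrow-at {κ} {q} {l} M oκ κ-regular (aleph₂ h)

    -- Densely, l is an ordinal lam of V, and the measure is chosen once lam is known: `M` if lam is
    -- κ, one from P_κ(lam) if κ is below lam. That lam is not below κ follows from ℵ₂ ⊆ l.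
    arrow-regular : In-V.IsSupercompact κ → ∀ p → F.HCArrowAtRegularsFromAleph2 p
    arrow-regular hκ p l q k reg r k′ h = Arrow.hcArrow-local em _≤_ ≤-refl ≤-trans 𝟙 ≤-𝟙 code code-≤ M {r} {l}
      (dense-bind h λ s k₁ (a , ha , a⊆l) →
       dense-map (ordinal-check (ordᴺ-mono (≤-trans k₁ k′) (ordinal⇒ᴺ (proj₁ (proj₁ reg))))) λ t k₂ (lam , ol , e) →
       at-lam ol e (≐-mono k₂ (aleph₂ ha)) (λ m → mkε (a⊆l _ t k₂ (unε m)))
         (Card.regular⇒ ol e (regular-down (≤-trans k₂ (≤-trans k₁ k′)) reg)))
      where
      regular-down : ∀ {l q r} → r ≤ q → F.IsRegular l q → F.IsRegular l r
      regular-down h (((t , ln) , nb) , om , cf) =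
        (((λ x s j → t x s (≤-trans j h)) , (λ x s j → ln x s (≤-trans j h))) , (λ x s j → nb x s (≤-trans j h))) ,
        dense-mono h om , (λ x s j → cf x s (≤-trans j h))
      at-lam : ∀ {lam a t} → Ord lam → t ⊩ l ≐ check lam → t ⊩ a ≐ check κ → (∀ {σ} → t ⊩ σ ε a → t ⊩ σ ε l) →
        Regular lam t → F.HCArrow l t
      at-lam {lam} {a} {t} ol e ea a⊆l rg = case trichotomy oκ ol of λ
        { (inj₁ m) → arrow-at (Large.supercompact⇒measure-on _≤_ ≤-refl ≤-trans 𝟙 ≤-𝟙 hκ ol m rg) ol rg e
        ; (inj₂ (inj₁ d)) → arrow-at M oκ κ-regular (≐-trans e (check-≈ (≈-sym d)))
        ; (inj₂ (inj₂ m)) → ⊥₀-elim (∈-irrefl ≈-refl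
            (check-∈⁻ {t} (ε-resp-≐ʳ e (a⊆l (ε-resp-≐ʳ (≐-sym ea) (check-∈ m)))))) }

-- The case of the Levy collapse, and the theorem.

module CollapseExtension {ℓ : Level} (em : ExcludedMiddle (suc ℓ)) (ac : In-V.Choice {ℓ}) {κ P : V ℓ}
  (hκ : In-V.IsUncountableCardinal κ) (hP : In-V.IsColl P κ) (M : Measure κ κ) where
  open Sets {ℓ}
  open Classical em

  oκ : Ord κ
  oκ = ordinal⇒ (proj₁ (proj₁ hκ))

  module Coll = Collapse em {κ} {P} oκ hP

  -- The case κ = ω₁ is excluded by Ulam's argument, and κ ∈ ω₁ because κ is uncountable.
  ω₁∈κ : Coll.ω₁ ∈ κ
  ω₁∈κ = case trichotomy (ordinal⇒ (proj₁ Coll.ω₁-cardinal)) oκ of λ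
    { (inj₁ m) → m
    ; (inj₂ (inj₁ e)) → ⊥₀-elim (uncovered (Sequences.Ulam.κ-covered em M λ d → cover (∈-resp-≈ʳ (≈-sym e) d)))
    ; (inj₂ (inj₂ m)) → ⊥₀-elim (uncovered (cover m)) }
    where
    uncovered : ¬ Cover κ
    uncovered = cardinal-uncovered (proj₁ hκ) (proj₁ (proj₂ (proj₂ hκ))) (lower∈ (proj₂ (proj₂ (proj₂ hκ))))
    cover : ∀ {α} → α ∈ Coll.ω₁ → Cover α
    cover {α} m = countable⇒cover {α} (Coll.ω₀ , Coll.ω₀-omega , injective⇒≼ {α} {Coll.ω₀} (Coll.ω₁-countable m))

  module A = Arrows em ac Coll._≤_ (λ {p} → Coll.≤-refl {p}) (λ {p} {q} {r} → Coll.≤-trans {p} {q} {r})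
    Coll.𝟙 (λ {p} → Coll.≤-𝟙 {p}) Coll.code (λ {p} {q} → Coll.code-≤ {p} {q})
    (λ {p} {q} → Coll.meet {p} {q}) Coll.glb {κ} (λ M′ → Stems.stem em {κ} {P} oκ hP M′)

  arrow₁ : ∀ p → Formulas.HCArrowAtAleph2 (Forcing.extension Coll.C Coll._≤_) p
  arrow₁ = A.arrow-aleph₂ {Coll.ω₁} {Coll.ω₀} Coll.ω₀-omega (ordinal⇒ (proj₁ Coll.ω₁-cardinal)) Coll.ω₀∈ω₁ Coll.ω₁-countable
    Coll.ω₁-uncovered oκ ω₁∈κ Coll.Tr (λ {p} {q} l → Coll.≤⇒tr {q} {p} l) (λ {p} → Coll.tr-resp {p}) Coll.tr-bound
    Coll.tr-func Coll.collapse M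

  arrow₂ : In-V.IsSupercompact κ → ∀ p → Formulas.HCArrowAtRegularsFromAleph2 (Forcing.extension Coll.C Coll._≤_) p
  arrow₂ = A.arrow-regular {Coll.ω₁} {Coll.ω₀} Coll.ω₀-omega (ordinal⇒ (proj₁ Coll.ω₁-cardinal)) Coll.ω₀∈ω₁ Coll.ω₁-countable
    Coll.ω₁-uncovered oκ ω₁∈κ Coll.Tr (λ {p} {q} l → Coll.≤⇒tr {q} {p} l) (λ {p} → Coll.tr-resp {p}) Coll.tr-bound
    Coll.tr-func Coll.collapse M

mainTheorem12 : ∀ {ℓ} → ExcludedMiddle (suc ℓ) → In-V.Choice {ℓ} →
    ((κ P : V ℓ) → In-V.IsMeasurable κ → In-V.IsColl P κ →
      CollExtension κ , P ⊨ (λ S → Formulas.HCArrowAtAleph2 S))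
    ×
    ((κ P : V ℓ) → In-V.IsSupercompact κ → In-V.IsColl P κ →
      CollExtension κ , P ⊨ (λ S → Formulas.HCArrowAtRegularsFromAleph2 S))
mainTheorem12 {ℓ} em ac =
  (λ κ P hκ hP → let open CollapseExtension em ac {κ} {P} (proj₁ hκ) hP (LargeCardinals.measurable⇒measure em ac hκ) in
    -- The order was made abstract for the proof; `Coll.≤-def` returns to `CollOrder`.
    subst (λ R → ∀ p → Formulas.HCArrowAtAleph2 (Forcing.extension (Index P) R) p) Coll.≤-def arrow₁) ,
  (λ κ P hκ hP → let open CollapseExtension em ac {κ} {P} (proj₁ hκ) hP (LargeCardinals.supercompact⇒measure em ac hκ) in
    subst (λ R → ∀ p → Formulas.HCArrowAtRegularsFromAleph2 (Forcing.extension (Index P) R) p) Coll.≤-def (arrow₂ hκ))
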